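{- For every $\alpha>0$ there is a $\Delta>0$ such that the following holds for every $I\ge1$, every Boolean function $f:\mathcal X\times\mathcal Y\to\{0,1\}$ on finite sets and every protocol distribution $p(xym)$. If $\mathsf M_I(p,f)\le\alpha I$ and $\mu(xy)=p(xy)$, then $$\mathsf{adv}_\mu(\Delta I,f)\ \ge\ \exp(-\Delta I).$$
   Context: All sets are finite, $xy$ means $(x,y)$, logs are base 2. For joint distributions we write e.g. $q(xy|m)$, $q(x|ym)$ for conditionals, $p(xy)$ for marginals. Protocol distribution: a distribution $p(xym)$ on inputs $xy$ and $m=(m_0,m_1,m_2,\dots)$ (finitely many messages), where $m_0$ is the public randomness and $m_1,m_2,\dots$ are the messages (odd ones sent by Alice, even ones by Bob), such that $$p(xym)=p(xy)\cdot p(m_0)\cdot\prod_{i=1,3,5,\dots}p(m_i|xm_{<i})\cdot p(m_{i+1}|ym_{\le i}).$$ A distribution $q(xym)$ is rectangular with respect to $\mu(xy)$ if $q(xym)=\mu(xy)\cdot A(xm)\cdot B(ym)$ for some functions $A,B$. Marginal information: for $I\ge1$, $\delta=1/15$, $$\mathsf M_I(p,f)=\inf_q\sup_{xym}\log\Big(\frac{q(x|ym)}{p(x|y)}\cdot\frac{q(y|xm)}{p(y|x)}\cdot\Big(\frac{q(xym)}{p(xym)}\Big)^I\cdot\Big|\mathbb E_{q(xy|m)}[(-1)^{f(xy)}]\Big|^{ -12I/\delta}\Big),$$ infimum over distributions $q$ rectangular with respect to $p(xy)$, supremum over $xym$ in the support of $q$ (division by $0$, or a negative power of $0$, is read as $+\infty$).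 A randomized two-party communication protocol $\pi$: Alice receives $x$, Bob receives $y$, they have public and private randomness and exchange bits; the output $\pi(xy)$ is determined by the transcript and the public randomness; $\|\pi\|$ is the maximum number of bits exchanged (public randomness not counted). For a distribution $\mu(xy)$ on inputs, $$\mathsf{adv}_\mu(T,f)=\sup_{\|\pi\|\le T}\mathbb E\big[(-1)^{\pi(xy)+f(xy)}\big],$$ the expectation being over $xy\sim\mu$ and the randomness of $\pi$. -}

module Defs where

open import Algebra.Bundles using (CommutativeRing)
open import Algebra.Structures using (IsCommutativeRing)
open import Axiom.ExcludedMiddle using (ExcludedMiddle)
open import Data.Bool.Base using (Bool; true; false; if_then_else_; _∧_; _xor_)
open import Data.Empty using (⊥-elim)
open import Data.Fin.Base using (Fin; zero; suc; toℕ)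
import Data.Fin.Properties as Fin
open import Data.List.Base using (List; []; _∷_; length)
open import Data.List.Relation.Unary.All using (All; []; _∷_)
open import Data.Nat.Base as ℕ using (ℕ; zero; suc; _⊔_; _!; parity)
open import Data.Parity.Base using (Parity; 0ℙ; 1ℙ)
open import Data.Product.Base using (Σ; ∃; ∃-syntax; _×_; _,_; proj₁; proj₂)
open import Data.Sum.Base using (_⊎_; [_,_]′)
open import Level using (0ℓ)
open import Relation.Binary.Core using (Rel)
open import Relation.Binary.Structures using (IsTotalOrder)
open import Relation.Nullary using (¬_; yes; no)
open import Relation.Nullary.Decidable.Core using (⌊_⌋)
open import Relation.Nullary.Construct.Add.Extrema using (_±; ⊥±; ⊤±; [_])
import Relation.Binary.Construct.Add.Extrema.NonStrict as AddExtrema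
import Relation.Binary.Construct.Add.Supremum.NonStrict as AddSupremum
import Relation.Binary.Construct.NonStrictToStrict as ToStrict
open import Relation.Unary using (Pred)

-- Dedekind completeness for arbitrary predicates makes this a categorical
-- description of the real numbers.

record RealNumbers : Set₁ where
  infix  4 _≈_ _≤_
  infixl 6 _+_
  infixl 7 _*_
  infix  8 -_
  field
    Carrier : Set
    _≈_ _≤_ : Rel Carrier 0ℓ
    _+_ _*_ : Carrier → Carrier → Carrier
    -_      : Carrier → Carrier
    0# 1#   : Carrier

    isCommutativeRing : IsCommutativeRing _≈_ _+_ _*_ -_ 0# 1#
    0≉1               : ¬ (0# ≈ 1#)
    inverse           : ∀ {x} → ¬ (x ≈ 0#) → ∃[ y ] (x * y ≈ 1#)

    isTotalOrder : IsTotalOrder _≈_ _≤_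
    +-monoˡ-≤    : ∀ {x y} z → x ≤ y → x + z ≤ y + z
    *-nonneg     : ∀ {x y} → 0# ≤ x → 0# ≤ y → 0# ≤ x * y

    supremum : (S : Pred Carrier 0ℓ) → ∃ S → (∃[ b ] (∀ {x} → S x → x ≤ b)) →
               ∃[ s ] ((∀ {x} → S x → x ≤ s) ×
                       (∀ {b} → (∀ {x} → S x → x ≤ b) → s ≤ b))

  commutativeRing : CommutativeRing 0ℓ 0ℓ
  commutativeRing = record { isCommutativeRing = isCommutativeRing }

  open ToStrict _≈_ _≤_ public using (_<_)


------------------------------------------------------------------------
-- Classical real analysis

module Analysis (em : ExcludedMiddle 0ℓ) (ℝ : RealNumbers) where

  open RealNumbers ℝ public
  open CommutativeRing commutativeRing public
    using (_-_; +-commutativeMonoid; *-commutativeMonoid; +-rawMonoid; *-rawMonoid)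
  open IsTotalOrder isTotalOrder public
    using (total) renaming (trans to ≤-trans; refl to ≤-refl)
  open import Algebra.Properties.CommutativeMonoid.Sum +-commutativeMonoid public
    using (sum; sum-syntax)
  open import Algebra.Properties.CommutativeMonoid.Sum *-commutativeMonoid public
    using () renaming (sum to product)
  open import Algebra.Definitions.RawMonoid +-rawMonoid
    using () renaming (_×_ to _·_)
  open import Algebra.Definitions.RawMonoid *-rawMonoid
    using () renaming (_×_ to multiply)

  infixr 8 _^_ _^ᴿ_
  infix  9 _⁻¹
  infixl 7 _/_

  fromℕ : ℕ → Carrier
  fromℕ n = n · 1#

  _^_ : Carrier → ℕ → Carrier
  x ^ n = multiply n x

  -- 0 ⁻¹ is 0, hence also x / 0 is 0.
  _⁻¹ : Carrier → Carrier
  x ⁻¹ with em {x ≈ 0#}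
  ... | yes _  = 0#
  ... | no x≉0 = proj₁ (inverse x≉0)

  _/_ : Carrier → Carrier → Carrier
  x / y = x * y ⁻¹

  ∣_∣ : Carrier → Carrier
  ∣ x ∣ = [ (λ _ → x) , (λ _ → - x) ]′ (total 0# x)

  ℝ± : Set
  ℝ± = Carrier ±

  open AddExtrema _≤_ public
    using (_≤±_; ≤±-trans; _≤⊤±; ⊥±≤_; [≤]-injective; ⊥±≤[_]; ⊥±≤⊥±; [_]≤⊤±; ⊤±≤⊤±)
    renaming ([_] to [_]≤)

  -- The supremum in ℝ± of an arbitrary family; that of the empty one is ⊥±.
  ⨆ : {I : Set} → (I → ℝ±) → ℝ±
  ⨆ {I} f with em {∃[ b ] (∀ i → f i ≤± [ b ])} | em {∃[ r ] ∃[ i ] ([ r ] ≤± f i)}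
  ... | no _          | _     = ⊤±
  ... | yes _         | no _  = ⊥±
  ... | yes (b , f≤b) | yes S = [ proj₁ (supremum (λ r → ∃[ i ] ([ r ] ≤± f i)) S
          (b , λ (i , r≤fi) → [≤]-injective (≤±-trans ≤-trans r≤fi (f≤b i)))) ]

  -±_ : ℝ± → ℝ±
  -± ⊥±    = ⊤±
  -± [ x ] = [ - x ]
  -± ⊤±    = ⊥±

  ⨅ : {I : Set} → (I → ℝ±) → ℝ±
  ⨅ f = -± ⨆ (λ i → -± f i)

  ⨆-upper : {I : Set} (f : I → ℝ±) (i : I) → f i ≤± ⨆ f
  ⨆-upper {I} f i with em {∃[ b ] (∀ i → f i ≤± [ b ])} | em {∃[ r ] ∃[ i ] ([ r ] ≤± f i)}
  ... | no _          | _     = f i ≤⊤±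
  ... | yes (b , f≤b) | no ¬S = finite (f i) (f≤b i) (λ r r≤ → ¬S (r , i , r≤))
    where
    finite : ∀ z → z ≤± [ b ] → (∀ r → ¬ ([ r ] ≤± z)) → z ≤± ⊥±
    finite ⊥±    _  _ = ⊥±≤⊥±
    finite [ x ] _  h = ⊥-elim (h x [ ≤-refl ]≤)
    finite ⊤±    () _
  ... | yes (b , f≤b) | yes S = finite (f i) (f≤b i) (λ r r≤ → proj₁ (proj₂ s) (i , r≤))
    where
    s = supremum (λ r → ∃[ i ] ([ r ] ≤± f i)) S
          (b , λ (i , r≤fi) → [≤]-injective (≤±-trans ≤-trans r≤fi (f≤b i)))
    finite : ∀ z → z ≤± [ b ] → (∀ r → [ r ] ≤± z → r ≤ proj₁ s) → z ≤± [ proj₁ s ]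
    finite ⊥±    _  _ = ⊥±≤[ _ ]
    finite [ x ] _  h = [ h x [ ≤-refl ]≤ ]≤
    finite ⊤±    () _

  ⨆-least : {I : Set} (f : I → ℝ±) (u : ℝ±) → (∀ i → f i ≤± u) → ⨆ f ≤± u
  ⨆-least {I} f u f≤u with em {∃[ b ] (∀ i → f i ≤± [ b ])} | em {∃[ r ] ∃[ i ] ([ r ] ≤± f i)}
  ⨆-least f u f≤u     | yes _         | no _ = ⊥±≤ u
  ⨆-least f ⊤± f≤u    | _             | _    = _ ≤⊤±
  ⨆-least f [ b ] f≤u | no ¬b         | _    = ⊥-elim (¬b (b , f≤u))
  ⨆-least f ⊥± f≤u    | no ¬b         | _    =
    ⊥-elim (¬b (0# , λ i → ≤±-trans ≤-trans (f≤u i) ⊥±≤[ 0# ]))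
  ⨆-least f ⊥± f≤u    | yes _         | yes (r , i , r≤fi) with ≤±-trans ≤-trans r≤fi (f≤u i)
  ... | AddSupremum.[_] ()
  ⨆-least f [ c ] f≤u | yes (b , f≤b) | yes S = [ proj₂ (proj₂ (supremum _ S _))
    (λ (i , r≤fi) → [≤]-injective (≤±-trans ≤-trans r≤fi (f≤u i))) ]≤

  toℝ : ℝ± → Carrier
  toℝ [ x ] = x
  toℝ ⊥±    = 0#
  toℝ ⊤±    = 0#

  -- The partial sums increase for 0 ≤ x, so that their limit is their supremum.
  exp₊ : Carrier → Carrier
  exp₊ x = toℝ (⨆ {ℕ} λ n → [ ∑[ k < n ] (x ^ toℕ k / fromℕ (toℕ k !)) ])

  exp : Carrier → Carrier
  exp x = [ (λ _ → exp₊ x) , (λ _ → exp₊ (- x) ⁻¹) ]′ (total 0# x)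

  -- Meaningful for 0 < z only, and so are log₂ z and z ^ᴿ s.
  ln : Carrier → Carrier
  ln z = toℝ (⨆ {∃[ x ] (exp x ≤ z)} λ (x , _) → [ x ])

  log₂ : Carrier → Carrier
  log₂ z = ln z / ln (fromℕ 2)

  _^ᴿ_ : Carrier → Carrier → Carrier
  z ^ᴿ s = exp (s * ln z)

  -- (-1) ^ b for a bit b
  sign : Bool → Carrier
  sign false = 1#
  sign true  = - 1#


------------------------------------------------------------------------
-- Protocol distributions and marginal information

-- The message tuples (m₀ , m₁ , …), where mᵢ ranges over the set Fin sᵢ.
Messages : List ℕ → Set
Messages = All Fin

-- Whether two message tuples have the same first j entries.
agree : ∀ {ss} → ℕ → Messages ss → Messages ss → Bool
agree zero    _       _         = true
agree (suc j) []      []        = true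
agree (suc j) (a ∷ m) (a′ ∷ m′) = ⌊ a Fin.≟ a′ ⌋ ∧ agree j m m′

module MarginalInformation (em : ExcludedMiddle 0ℓ) (ℝ : RealNumbers) where

  open Analysis em ℝ

  ∑ₘ : ∀ {ss} → (Messages ss → Carrier) → Carrier
  ∑ₘ {[]}     g = g []
  ∑ₘ {s ∷ ss} g = ∑[ a < s ] ∑ₘ {ss} (λ m → g (a ∷ m))

  δ : Carrier
  δ = 1# / fromℕ 15

  IsDistribution : ∀ {n} → (Fin n → Carrier) → Set
  IsDistribution {n} ρ = (∀ i → 0# ≤ ρ i) × (∑[ i < n ] ρ i ≈ 1#)

  module _ {nX nY : ℕ} where

    private
      X = Fin nX
      Y = Fin nY

    module Joint {ss : List ℕ} (p : X → Y → Messages ss → Carrier) where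

      IsJointDistribution : Set
      IsJointDistribution =
        (∀ x y m → 0# ≤ p x y m) ×
        (∑[ x < nX ] ∑[ y < nY ] ∑ₘ (λ m → p x y m) ≈ 1#)

      ℙ[xy] : X → Y → Carrier
      ℙ[xy] x y = ∑ₘ (λ m → p x y m)

      ℙ[x] : X → Carrier
      ℙ[x] x = ∑[ y < nY ] ℙ[xy] x y

      ℙ[y] : Y → Carrier
      ℙ[y] y = ∑[ x < nX ] ℙ[xy] x y

      ℙ[xm] : X → Messages ss → Carrier
      ℙ[xm] x m = ∑[ y < nY ] p x y m

      ℙ[ym] : Y → Messages ss → Carrier
      ℙ[ym] y m = ∑[ x < nX ] p x y m

      ℙ[m] : Messages ss → Carrier
      ℙ[m] m = ∑[ x < nX ] ∑[ y < nY ] p x y m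

      ℙ[x∣y] : X → Y → Carrier
      ℙ[x∣y] x y = ℙ[xy] x y / ℙ[y] y

      ℙ[y∣x] : Y → X → Carrier
      ℙ[y∣x] y x = ℙ[xy] x y / ℙ[x] x

      ℙ[x∣ym] : X → Y → Messages ss → Carrier
      ℙ[x∣ym] x y m = p x y m / ℙ[ym] y m

      ℙ[y∣xm] : Y → X → Messages ss → Carrier
      ℙ[y∣xm] y x m = p x y m / ℙ[xm] x m

      ℙ[xy∣m] : X → Y → Messages ss → Carrier
      ℙ[xy∣m] x y m = p x y m / ℙ[m] m

      -- The event that x (respectively y) and the first j messages are as given.
      ℙ[x,m<_] : ℕ → X → Messages ss → Carrier
      ℙ[x,m< j ] x m =
        ∑[ y < nY ] ∑ₘ (λ m′ → if agree j m m′ then p x y m′ else 0#)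

      ℙ[y,m<_] : ℕ → Y → Messages ss → Carrier
      ℙ[y,m< j ] y m =
        ∑[ x < nX ] ∑ₘ (λ m′ → if agree j m m′ then p x y m′ else 0#)

      ℙ[m₀] : Messages ss → Carrier
      ℙ[m₀] m =
        ∑[ x < nX ] ∑[ y < nY ] ∑ₘ (λ m′ → if agree 1 m m′ then p x y m′ else 0#)

      ℙ[mᵢ∣x,m<_] : ℕ → X → Messages ss → Carrier
      ℙ[mᵢ∣x,m< i ] x m = ℙ[x,m< suc i ] x m / ℙ[x,m< i ] x m

      ℙ[mᵢ∣y,m<_] : ℕ → Y → Messages ss → Carrier
      ℙ[mᵢ∣y,m< i ] y m = ℙ[y,m< suc i ] y m / ℙ[y,m< i ] y m

      -- The conditional distribution of the i-th message given its sender's view.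
      messageFactor : ℕ → X → Y → Messages ss → Carrier
      messageFactor i x y m with parity i
      ... | 1ℙ = ℙ[mᵢ∣x,m< i ] x m
      ... | 0ℙ = ℙ[mᵢ∣y,m< i ] y m

      Rectangular : (X → Y → Carrier) → Set
      Rectangular μ =
        Σ (X → Messages ss → Carrier) λ A →
        Σ (Y → Messages ss → Carrier) λ B →
        ∀ x y m → p x y m ≈ μ x y * A x m * B y m

    -- The division convention is harmless here: where a conditional
    -- distribution is undefined, both sides of the factorization vanish.
    IsProtocolDistribution : ∀ {s₀ ss} → (X → Y → Messages (s₀ ∷ ss) → Carrier) → Set
    IsProtocolDistribution {s₀} {ss} p =
      IsJointDistribution ×
      (∀ x y m → p x y m ≈
         ℙ[xy] x y * ℙ[m₀] m *
         product {length ss} (λ j → messageFactor (suc (toℕ j)) x y m))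
      where open Joint p

    module _ (f : X → Y → Bool) {ss : List ℕ} where

      private
        module ℙ = Joint {ss}

      correlation : (X → Y → Messages ss → Carrier) → Messages ss → Carrier
      correlation q m = ∑[ x < nX ] ∑[ y < nY ] (ℙ.ℙ[xy∣m] q x y m * sign (f x y))

      -- The denominators q(ym), q(xm) and q(m) of the conditionals of q are
      -- positive on the support of q, the only place where this is used.
      cost : (I : Carrier) (p q : X → Y → Messages ss → Carrier) →
             X → Y → Messages ss → ℝ±
      cost I p q x y m
        with em {(ℙ.ℙ[x∣y] p x y ≈ 0#) ⊎ (ℙ.ℙ[y∣x] p y x ≈ 0#) ⊎
                 (p x y m ≈ 0#) ⊎ (correlation q m ≈ 0#)}
      ... | yes _ = ⊤±
      ... | no  _ = [ log₂ ( ℙ.ℙ[x∣ym] q x y m / ℙ.ℙ[x∣y] p x y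
                           * (ℙ.ℙ[y∣xm] q y x m / ℙ.ℙ[y∣x] p y x)
                           * (q x y m / p x y m) ^ᴿ I
                           * ∣ correlation q m ∣ ^ᴿ (- (fromℕ 12 * I / δ))) ]

      M : (I : Carrier) → (X → Y → Messages ss → Carrier) → ℝ±
      M I p =
        ⨅ {∃[ q ] (ℙ.IsJointDistribution q × ℙ.Rectangular q (ℙ.ℙ[xy] p))} λ (q , _) →
        ⨆ {∃[ x ] ∃[ y ] ∃[ m ] (0# < q x y m)} λ (x , y , m , _) →
        cost I p q x y m


------------------------------------------------------------------------
-- Randomized communication protocols

-- Protocol trees; A and B are what Alice and Bob see.
data Tree (A B : Set) : Set where
  output : Bool → Tree A B
  alice  : (A → Bool) → (Bool → Tree A B) → Tree A B
  bob    : (B → Bool) → (Bool → Tree A B) → Tree A B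

run : ∀ {A B} → Tree A B → A → B → Bool
run (output c)  a b = c
run (alice s t) a b = run (t (s a)) a b
run (bob s t)   a b = run (t (s b)) a b

depth : ∀ {A B} → Tree A B → ℕ
depth (output _)  = 0
depth (alice _ t) = suc (depth (t false) ⊔ depth (t true))
depth (bob _ t)   = suc (depth (t false) ⊔ depth (t true))

maximum : ∀ {n} → (Fin n → ℕ) → ℕ
maximum {zero}  g = 0
maximum {suc n} g = g zero ⊔ maximum (λ i → g (suc i))

module Communication (em : ExcludedMiddle 0ℓ) (ℝ : RealNumbers) where

  open Analysis em ℝ
  open MarginalInformation em ℝ using (IsDistribution)

  record Protocol (X Y : Set) : Set where
    field
      nPub nA nB   : ℕ
      ρPub         : Fin nPub → Carrier
      ρA           : Fin nA → Carrier
      ρB           : Fin nB → Carrier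
      ρPub-isDist  : IsDistribution ρPub
      ρA-isDist    : IsDistribution ρA
      ρB-isDist    : IsDistribution ρB
      tree         : Fin nPub → Tree (X × Fin nA) (Y × Fin nB)

    ‖_‖ : ℕ
    ‖_‖ = maximum (λ r → depth (tree r))

  open Protocol

  module _ {nX nY : ℕ} (μ : Fin nX → Fin nY → Carrier) where

    advantage : Protocol (Fin nX) (Fin nY) → (Fin nX → Fin nY → Bool) → Carrier
    advantage π f =
      ∑[ x < nX ] ∑[ y < nY ] ∑[ r < nPub π ] ∑[ a < nA π ] ∑[ b < nB π ]
        (μ x y * ρPub π r * ρA π a * ρB π b *
         sign (run (tree π r) (x , a) (y , b) xor f x y))

    adv : Carrier → (Fin nX → Fin nY → Bool) → ℝ±
    adv T f = ⨆ {∃[ π ] (fromℕ ‖ π ‖ ≤ T)} λ (π , _) → [ advantage π f ]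

module Submission where

-- It suffices to find signs a(x) and b(y), exchanged in two bits, such that a ⊗ b correlates with
-- (-1) ^ f under μ. Take q = μ(xy) A(xm) B(ym) nearly optimal. Apart from a small part of q (Markov's
-- inequality for the reciprocals of the ratios in the cost), q ≤ K p, the correlation of m is bounded
-- below, and (A B)² ≤ exp (O(I)) p(m|x) p(m|y). Truncating A B to where this last bound holds, by means
-- of the kernel s ⊓ t, turns the function ∑ₘ ±A(xm) B(ym) of x and y, which correlates with (-1) ^ f,
-- into a sum ∑ᵢ uᵢ(x) vᵢ(y) with ∑ᵢ uᵢ² and ∑ᵢ vᵢ² at most L = exp (O(I)). Average the product of
-- ∑ᵢ ±uᵢ(x) and ∑ᵢ ±vᵢ(y) over the common signs: by the fourth moments the two factors may be clipped
-- to [-O(L) , O(L)], and then replaced by signs.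

open import Defs
open import Algebra.Bundles using (CommutativeRing)
open import Algebra.Solver.Ring.AlmostCommutativeRing
  using (fromCommutativeRing; _-Raw-AlmostCommutative⟶_)
open import Axiom.ExcludedMiddle using (ExcludedMiddle)
open import Data.Bool.Base using (Bool; true; false; _xor_)
open import Data.Empty using (⊥-elim)
open import Data.Fin.Base using (Fin; zero; suc; toℕ)
open import Data.Integer.Base as ℤ using (ℤ)
import Data.Integer.Properties as ℤ
open import Data.List.Base using (List; []; _∷_; length; filter; allFin)
open import Data.List.Membership.Propositional using (_∈_; lose)
open import Data.List.Membership.Propositional.Properties using (∈-allFin; ∈-filter⁺)
open import Data.List.Properties using (filter-notAll)
open import Data.List.Relation.Unary.All as All using (All; []; _∷_)
open import Data.List.Relation.Unary.All.Properties using (all-filter)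
open import Data.List.Relation.Unary.Any using (here; there)
open import Data.Maybe.Base using (Maybe; map)
open import Data.Nat.Base as ℕ using (ℕ; zero; suc; _!)
open import Data.Nat.Properties using (+-suc)
import Data.Nat.Properties as ℕ
open import Data.Product.Base using (∃-syntax; _×_; _,_; proj₁; proj₂; Σ)
open import Data.Sum.Base using (_⊎_; inj₁; inj₂)
open import Function.Base using (_∘_)
open import Level using (0ℓ)
open import Relation.Binary.Bundles using (TotalOrder)
import Relation.Binary.Construct.Add.Supremum.NonStrict as AddSupremum
open import Relation.Binary.PropositionalEquality.Core as ≡ using (_≡_)
open import Relation.Binary.Structures using (IsTotalOrder)
open import Relation.Nullary using (¬_; yes; no)
open import Relation.Nullary.Construct.Add.Extrema using (⊥±; ⊤±; [_])
open import Relation.Nullary.Decidable.Core using (dec⇒maybe; toSum; decidable-stable)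
open import Relation.Unary using (Decidable)

-- The cost bounds the correlation of m from below only where its three ratios are at least 1/T, for
-- a Markov threshold T = exp t. This makes the choice of T circular: the mass given up is of order
-- 1/T and has to be small against a correlation whose lower bound weakens as T grows. The exponent
-- 12 I / δ = 180 I breaks the circle, since minus the logarithm of the correlation is then at most
-- (ℓ + 3 t) / 180, far below t. The first two ratios control (A B)² by q(xm) / p(x) and q(ym) /
-- p(y). Their sums over m are q(x) / p(x) and q(y) / p(y), which may be large, as q need not have
-- the marginals of p. The sums of p(m|x) and p(m|y) are at most 1; hence the passage from q to p by
-- means of q ≤ K p. Cutting A B off with the indicator of the region where the bound holds would
-- not do: the indicator couples x and y and need not split into short vectors. The factor min (1 ,
-- g h / (A B)²) does split, because the kernel s ⊓ t does. Only products of signs enter the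
-- protocol, so any loss of the form exp (- O(I)) is affordable throughout.

-- Ordered field arithmetic, a ring solver, absolute values.

module OrderedField (em : ExcludedMiddle 0ℓ) (ℝ : RealNumbers) where

  open Analysis em ℝ public
  open CommutativeRing commutativeRing public
    using ( setoid; refl; sym; trans; reflexive; semiring; ring; +-group
          ; +-cong; +-congˡ; +-congʳ; +-assoc; +-comm; +-identityˡ; +-identityʳ; -‿cong; -‿inverseʳ
          ; *-cong; *-congˡ; *-congʳ; *-assoc; *-comm; *-identityˡ; *-identityʳ; zeroˡ; zeroʳ
          ; distribˡ; distribʳ )
  open IsTotalOrder isTotalOrder public
    using (antisym; ≤-respˡ-≈; ≤-respʳ-≈) renaming (reflexive to ≤-reflexive)

  totalOrder : TotalOrder 0ℓ 0ℓ 0ℓ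
  totalOrder = record { isTotalOrder = isTotalOrder }

  module ≤-Reasoning where
    open import Relation.Binary.Reasoning.PartialOrder (TotalOrder.poset totalOrder) public
      using (begin_; _∎; step-≤; step-≈; step-≈-⟩; step-≈-⟨)

  open import Algebra.Properties.Group +-group using (⁻¹-involutive; ε⁻¹≈ε; ⁻¹-anti-homo-∙)
  open import Algebra.Properties.Ring ring public using (-‿distribˡ-*; -‿distribʳ-*)
  open import Algebra.Properties.Semiring.Mult.TCOptimised semiring
    using (×-homo-+; ×1-homo-*; ×ᵤ≈×) renaming (_×_ to _×′_)

  -- The ring solver must be able to evaluate its coefficients, so these are integers.

  fromℤ : ℤ → Carrier
  fromℤ (ℤ.+ n)      = n ×′ 1#
  fromℤ (ℤ.-[1+ n ]) = - (suc n ×′ 1#)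

  private

    1+n×1 : ∀ n → suc n ×′ 1# ≈ 1# + n ×′ 1#
    1+n×1 n = ×-homo-+ 1# 1 n

    fromℤ-⊖ : ∀ m n → fromℤ (m ℤ.⊖ n) ≈ m ×′ 1# - n ×′ 1#
    fromℤ-⊖ zero    zero    = sym (-‿inverseʳ 0#)
    fromℤ-⊖ (suc m) zero    = sym (trans (+-congˡ ε⁻¹≈ε) (+-identityʳ _))
    fromℤ-⊖ zero    (suc n) = sym (+-identityˡ _)
    fromℤ-⊖ (suc m) (suc n) = trans (reflexive (≡.cong fromℤ (ℤ.[1+m]⊖[1+n]≡m⊖n m n)))
      (trans (fromℤ-⊖ m n) (sym (trans (+-cong (1+n×1 m) (-‿cong (1+n×1 n))) lemma)))
      where
      a = m ×′ 1#
      b = n ×′ 1#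
      lemma : (1# + a) - (1# + b) ≈ a - b
      lemma = trans (+-cong (+-comm 1# a) (trans (-‿cong (+-comm 1# b)) (⁻¹-anti-homo-∙ b 1#)))
        (trans (+-assoc a 1# _) (+-congˡ (trans (sym (+-assoc 1# (- 1#) (- b)))
          (trans (+-congʳ (-‿inverseʳ 1#)) (+-identityˡ _)))))

    fromℤ-neg : ∀ i → fromℤ (ℤ.- i) ≈ - fromℤ i
    fromℤ-neg (ℤ.+ zero)    = sym ε⁻¹≈ε
    fromℤ-neg (ℤ.+ suc n)   = refl
    fromℤ-neg ℤ.-[1+ n ]    = sym (⁻¹-involutive _)

    fromℤ-+ : ∀ i j → fromℤ (i ℤ.+ j) ≈ fromℤ i + fromℤ j
    fromℤ-+ (ℤ.+ m)    (ℤ.+ n)    = ×-homo-+ 1# m n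
    fromℤ-+ (ℤ.+ m)    ℤ.-[1+ n ] = fromℤ-⊖ m (suc n)
    fromℤ-+ ℤ.-[1+ m ] (ℤ.+ n)    = trans (fromℤ-⊖ n (suc m)) (+-comm _ _)
    fromℤ-+ ℤ.-[1+ m ] ℤ.-[1+ n ] = trans
      (-‿cong (trans (reflexive (≡.cong (λ k → suc k ×′ 1#) (≡.sym (+-suc m n))))
                     (trans (×-homo-+ 1# (suc m) (suc n)) (+-comm _ _))))
      (⁻¹-anti-homo-∙ _ _)

    fromℤ-*ˡ : ∀ m j → fromℤ (ℤ.+ m ℤ.* j) ≈ fromℤ (ℤ.+ m) * fromℤ j
    fromℤ-*ˡ m (ℤ.+ n)    = trans (reflexive (≡.cong fromℤ (≡.sym (ℤ.pos-* m n)))) (×1-homo-* m n)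
    fromℤ-*ˡ m ℤ.-[1+ n ] = trans
      (reflexive (≡.cong fromℤ (≡.sym (ℤ.neg-distribʳ-* (ℤ.+ m) (ℤ.+ suc n)))))
      (trans (fromℤ-neg (ℤ.+ m ℤ.* ℤ.+ suc n))
        (trans (-‿cong (fromℤ-*ˡ m (ℤ.+ suc n))) (-‿distribʳ-* _ _)))

    fromℤ-* : ∀ i j → fromℤ (i ℤ.* j) ≈ fromℤ i * fromℤ j
    fromℤ-* (ℤ.+ m)    j = fromℤ-*ˡ m j
    fromℤ-* ℤ.-[1+ m ] j = trans
      (reflexive (≡.cong fromℤ (≡.sym (ℤ.neg-distribˡ-* (ℤ.+ suc m) j))))
      (trans (fromℤ-neg (ℤ.+ suc m ℤ.* j))
        (trans (-‿cong (fromℤ-*ˡ (suc m) j)) (-‿distribˡ-* _ _)))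

    fromℤ-morphism : ℤ.+-*-rawRing -Raw-AlmostCommutative⟶ fromCommutativeRing commutativeRing
    fromℤ-morphism = record
      { ⟦_⟧    = fromℤ
      ; +-homo = fromℤ-+
      ; *-homo = fromℤ-*
      ; -‿homo = fromℤ-neg
      ; 0-homo = refl
      ; 1-homo = refl
      }

    fromℤ-≟ : ∀ i j → Maybe (fromℤ i ≈ fromℤ j)
    fromℤ-≟ i j = map (λ i≡j → reflexive (≡.cong fromℤ i≡j)) (dec⇒maybe (i ℤ.≟ j))

  open import Algebra.Solver.Ring ℤ.+-*-rawRing (fromCommutativeRing commutativeRing)
    fromℤ-morphism fromℤ-≟ public
    using (solve; _:=_; _:+_; _:*_; _:-_; :-_; con; Polynomial)

  num : ℕ → Carrier
  num n = fromℤ (ℤ.+ n)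

  `_ : ∀ {n} → ℕ → Polynomial n
  ` k = con (ℤ.+ k)
  infix 10 `_

  ≈⇒≤ : ∀ {x y} → x ≈ y → x ≤ y
  ≈⇒≤ = ≤-reflexive

  0≤- : ∀ {x y} → x ≤ y → 0# ≤ y - x
  0≤- {x} {y} x≤y = ≤-respˡ-≈ (-‿inverseʳ x) (+-monoˡ-≤ (- x) x≤y)

  -- Inequalities are derived by exhibiting the difference of the two sides as
  -- a combination of nonnegative quantities; the identity is left to the solver.
  lin : ∀ {x y d} → 0# ≤ d → y - x ≈ d → x ≤ y
  lin {x} {y} 0≤d eq = ≤-respʳ-≈ (solve 2 (λ x y → y :- x :+ x := y) refl x y)
    (≤-respˡ-≈ (+-identityˡ x) (+-monoˡ-≤ x (≤-respʳ-≈ (sym eq) 0≤d)))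

  infixl 6 _⊕_
  infixl 7 _⊗_

  _⊕_ : ∀ {x y} → 0# ≤ x → 0# ≤ y → 0# ≤ x + y
  _⊕_ {x} {y} 0≤x 0≤y = ≤-trans 0≤y (lin 0≤x (solve 2 (λ x y → x :+ y :- y := x) refl x y))

  _⊗_ : ∀ {x y} → 0# ≤ x → 0# ≤ y → 0# ≤ x * y
  _⊗_ = *-nonneg

  0≤sq : ∀ x → 0# ≤ x * x
  0≤sq x with total 0# x
  ... | inj₁ 0≤x = 0≤x ⊗ 0≤x
  ... | inj₂ x≤0 = ≤-respʳ-≈ (solve 1 (λ x → (` 0 :- x) :* (` 0 :- x) := x :* x) refl x)
                     (0≤- x≤0 ⊗ 0≤- x≤0)

  0≤1 : 0# ≤ 1#
  0≤1 = ≤-respʳ-≈ (*-identityˡ 1#) (0≤sq 1#)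

  0≤num : ∀ n → 0# ≤ num n
  0≤num zero    = ≤-refl
  0≤num (suc n) = ≤-respʳ-≈ (sym (×-homo-+ 1# 1 n)) (0≤1 ⊕ 0≤num n)

  fromℕ≈ : ∀ n → fromℕ n ≈ num n
  fromℕ≈ n = ×ᵤ≈× n 1#

  +-mono-≤ : ∀ {a b c d} → a ≤ b → c ≤ d → a + c ≤ b + d
  +-mono-≤ {a} {b} {c} {d} a≤b c≤d = lin (0≤- a≤b ⊕ 0≤- c≤d)
    (solve 4 (λ a b c d → b :+ d :- (a :+ c) := b :- a :+ (d :- c)) refl a b c d)

  *-monoˡ-≤ : ∀ {c x y} → 0# ≤ c → x ≤ y → c * x ≤ c * y
  *-monoˡ-≤ {c} {x} {y} 0≤c x≤y = lin (0≤c ⊗ 0≤- x≤y)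
    (solve 3 (λ c x y → c :* y :- c :* x := c :* (y :- x)) refl c x y)

  *-monoʳ-≤ : ∀ {c x y} → 0# ≤ c → x ≤ y → x * c ≤ y * c
  *-monoʳ-≤ {c} {x} {y} 0≤c x≤y = lin (0≤- x≤y ⊗ 0≤c)
    (solve 3 (λ c x y → y :* c :- x :* c := (y :- x) :* c) refl c x y)

  *-mono-≤ : ∀ {a b c d} → 0# ≤ a → a ≤ b → 0# ≤ c → c ≤ d → a * c ≤ b * d
  *-mono-≤ 0≤a a≤b 0≤c c≤d =
    ≤-trans (*-monoʳ-≤ 0≤c a≤b) (*-monoˡ-≤ (≤-trans 0≤a a≤b) c≤d)

  neg-anti-≤ : ∀ {x y} → x ≤ y → - y ≤ - x
  neg-anti-≤ {x} {y} x≤y = lin (0≤- x≤y) (solve 2 (λ x y → :- x :- :- y := y :- x) refl x y)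

  ≤-<-connex : ∀ x y → x ≤ y ⊎ y < x
  ≤-<-connex x y with total x y | em {y ≈ x}
  ... | inj₁ x≤y | _       = inj₁ x≤y
  ... | inj₂ _   | yes y≈x = inj₁ (≈⇒≤ (sym y≈x))
  ... | inj₂ y≤x | no  y≉x = inj₂ (y≤x , y≉x)

  <⇒≱ : ∀ {x y} → x < y → ¬ (y ≤ x)
  <⇒≱ (x≤y , x≉y) y≤x = x≉y (antisym x≤y y≤x)

  ≰⇒> : ∀ {x y} → ¬ (x ≤ y) → y < x
  ≰⇒> {x} {y} x≰y with ≤-<-connex x y
  ... | inj₁ x≤y = ⊥-elim (x≰y x≤y)
  ... | inj₂ y<x = y<x

  <-≤-trans : ∀ {x y z} → x < y → y ≤ z → x < z
  <-≤-trans x<y y≤z = ≤-trans (proj₁ x<y) y≤z , λ x≈z → <⇒≱ x<y (≤-respʳ-≈ (sym x≈z) y≤z)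

  ≤-<-trans : ∀ {x y z} → x ≤ y → y < z → x < z
  ≤-<-trans x≤y y<z = ≤-trans x≤y (proj₁ y<z) , λ x≈z → <⇒≱ y<z (≤-respˡ-≈ x≈z x≤y)

  <-respʳ-≈ : ∀ {x y z} → y ≈ z → x < y → x < z
  <-respʳ-≈ y≈z (x≤y , x≉y) = ≤-respʳ-≈ y≈z x≤y , λ x≈z → x≉y (trans x≈z (sym y≈z))

  0<1 : 0# < 1#
  0<1 = 0≤1 , 0≉1

  0<⇒≉ : ∀ {x} → 0# < x → ¬ (x ≈ 0#)
  0<⇒≉ (_ , 0≉x) x≈0 = 0≉x (sym x≈0)

  0≤∧≉⇒0< : ∀ {x} → 0# ≤ x → ¬ (x ≈ 0#) → 0# < x
  0≤∧≉⇒0< 0≤x x≉0 = 0≤x , λ 0≈x → x≉0 (sym 0≈x)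

  ≈0? : ∀ x → x ≈ 0# ⊎ ¬ (x ≈ 0#)
  ≈0? x = toSum em

  *-cancelˡ-≈ : ∀ {c x y} → ¬ (c ≈ 0#) → c * x ≈ c * y → x ≈ y
  *-cancelˡ-≈ {c} {x} {y} c≉0 eq with inverse c≉0
  ... | d , cd≈1 = begin
    x           ≈⟨ trans (*-congʳ cd≈1) (*-identityˡ x) ⟨
    c * d * x   ≈⟨ solve 3 (λ c d x → c :* d :* x := d :* (c :* x)) refl c d x ⟩
    d * (c * x) ≈⟨ *-congˡ eq ⟩
    d * (c * y) ≈⟨ solve 3 (λ c d x → c :* d :* x := d :* (c :* x)) refl c d y ⟨
    c * d * y   ≈⟨ trans (*-congʳ cd≈1) (*-identityˡ y) ⟩
    y           ∎
    where open import Relation.Binary.Reasoning.Setoid setoid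

  *-≉0 : ∀ {x y} → ¬ (x ≈ 0#) → ¬ (y ≈ 0#) → ¬ (x * y ≈ 0#)
  *-≉0 x≉0 y≉0 xy≈0 = y≉0 (*-cancelˡ-≈ x≉0 (trans xy≈0 (sym (zeroʳ _))))

  0<* : ∀ {x y} → 0# < x → 0# < y → 0# < x * y
  0<* 0<x 0<y = 0≤∧≉⇒0< (proj₁ 0<x ⊗ proj₁ 0<y) (*-≉0 (0<⇒≉ 0<x) (0<⇒≉ 0<y))

  0<+ : ∀ {x y} → 0# < x → 0# ≤ y → 0# < x + y
  0<+ {x} {y} 0<x 0≤y = <-≤-trans 0<x (lin 0≤y (solve 2 (λ x y → x :+ y :- x := y) refl x y))

  0<2 : 0# < num 2
  0<2 = 0<+ 0<1 0≤1

  ⁻¹-inverseʳ : ∀ {x} → ¬ (x ≈ 0#) → x * x ⁻¹ ≈ 1#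
  ⁻¹-inverseʳ {x} x≉0 with em {x ≈ 0#}
  ... | yes x≈0 = ⊥-elim (x≉0 x≈0)
  ... | no  x≉0′ = proj₂ (inverse x≉0′)

  0⁻¹≈0 : ∀ {x} → x ≈ 0# → x ⁻¹ ≈ 0#
  0⁻¹≈0 {x} x≈0 with em {x ≈ 0#}
  ... | yes _   = refl
  ... | no  x≉0 = ⊥-elim (x≉0 x≈0)

  ⁻¹-≉0 : ∀ {x} → ¬ (x ≈ 0#) → ¬ (x ⁻¹ ≈ 0#)
  ⁻¹-≉0 x≉0 eq = 0≉1 (trans (sym (zeroʳ _)) (trans (*-congˡ (sym eq)) (⁻¹-inverseʳ x≉0)))

  ⁻¹-cong : ∀ {x y} → x ≈ y → x ⁻¹ ≈ y ⁻¹
  ⁻¹-cong {x} {y} x≈y with em {x ≈ 0#}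
  ... | yes x≈0 = sym (0⁻¹≈0 (trans (sym x≈y) x≈0))
  ... | no  x≉0 = *-cancelˡ-≈ x≉0 (trans (proj₂ (inverse x≉0))
    (sym (trans (*-congʳ x≈y) (⁻¹-inverseʳ (λ y≈0 → x≉0 (trans x≈y y≈0))))))

  0≤⁻¹ : ∀ {x} → 0# ≤ x → 0# ≤ x ⁻¹
  0≤⁻¹ {x} 0≤x with em {x ≈ 0#}
  ... | yes x≈0 = ≤-refl
  ... | no  x≉0 with inverse x≉0
  ... | y , xy≈1 with total 0# y
  ... | inj₁ 0≤y = 0≤y
  ... | inj₂ y≤0 = ⊥-elim (<⇒≱ 0<1 (≤-respˡ-≈ xy≈1 (≤-respʳ-≈ (zeroʳ x) (*-monoˡ-≤ 0≤x y≤0))))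

  0<⁻¹ : ∀ {x} → 0# < x → 0# < x ⁻¹
  0<⁻¹ 0<x = 0≤∧≉⇒0< (0≤⁻¹ (proj₁ 0<x)) (⁻¹-≉0 (0<⇒≉ 0<x))

  *-cancelˡ-≤ : ∀ {c x y} → 0# < c → c * x ≤ c * y → x ≤ y
  *-cancelˡ-≤ {c} {x} {y} 0<c cx≤cy =
    ≤-respˡ-≈ (lemma x) (≤-respʳ-≈ (lemma y) (*-monoˡ-≤ (0≤⁻¹ (proj₁ 0<c)) cx≤cy))
    where
    lemma : ∀ x → c ⁻¹ * (c * x) ≈ x
    lemma x = trans (solve 3 (λ c d x → d :* (c :* x) := c :* d :* x) refl c (c ⁻¹) x)
      (trans (*-congʳ (⁻¹-inverseʳ (0<⇒≉ 0<c))) (*-identityˡ x))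

  /-*-cancel : ∀ {x y} → ¬ (y ≈ 0#) → x / y * y ≈ x
  /-*-cancel {x} {y} y≉0 = trans (solve 3 (λ x y z → x :* z :* y := x :* (y :* z)) refl x y (y ⁻¹))
    (trans (*-congˡ (⁻¹-inverseʳ y≉0)) (*-identityʳ x))

  /-≤ : ∀ {x y z} → 0# < y → x ≤ z * y → x / y ≤ z
  /-≤ {x} {y} {z} 0<y x≤zy = *-cancelˡ-≤ 0<y
    (≤-respˡ-≈ (trans (sym (/-*-cancel (0<⇒≉ 0<y))) (*-comm _ _)) (≤-respʳ-≈ (*-comm _ _) x≤zy))

  ≤-/ : ∀ {x y z} → 0# < y → z * y ≤ x → z ≤ x / y
  ≤-/ {x} {y} {z} 0<y zy≤x = *-cancelˡ-≤ 0<y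
    (≤-respʳ-≈ (trans (sym (/-*-cancel (0<⇒≉ 0<y))) (*-comm _ _)) (≤-respˡ-≈ (*-comm _ _) zy≤x))

  ∣∣-cases : ∀ x → (0# ≤ x × ∣ x ∣ ≡ x) ⊎ (x ≤ 0# × ∣ x ∣ ≡ - x)
  ∣∣-cases x with total 0# x
  ... | inj₁ 0≤x = inj₁ (0≤x , ≡.refl)
  ... | inj₂ x≤0 = inj₂ (x≤0 , ≡.refl)

  0≤∣∣ : ∀ x → 0# ≤ ∣ x ∣
  0≤∣∣ x with total 0# x
  ... | inj₁ 0≤x = 0≤x
  ... | inj₂ x≤0 = ≤-respˡ-≈ ε⁻¹≈ε (neg-anti-≤ x≤0)

  ≤∣∣ : ∀ x → x ≤ ∣ x ∣
  ≤∣∣ x with total 0# x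
  ... | inj₁ 0≤x = ≤-refl
  ... | inj₂ x≤0 = ≤-trans x≤0 (≤-respˡ-≈ ε⁻¹≈ε (neg-anti-≤ x≤0))

  -≤∣∣ : ∀ x → - x ≤ ∣ x ∣
  -≤∣∣ x with total 0# x
  ... | inj₁ 0≤x = ≤-trans (≤-respʳ-≈ ε⁻¹≈ε (neg-anti-≤ 0≤x)) 0≤x
  ... | inj₂ x≤0 = ≤-refl

  ∣∣-least : ∀ {x b} → x ≤ b → - x ≤ b → ∣ x ∣ ≤ b
  ∣∣-least {x} x≤b -x≤b with total 0# x
  ... | inj₁ _ = x≤b
  ... | inj₂ _ = -x≤b

  ∣∣-cong : ∀ {x y} → x ≈ y → ∣ x ∣ ≈ ∣ y ∣
  ∣∣-cong x≈y = antisym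
    (∣∣-least (≤-respˡ-≈ (sym x≈y) (≤∣∣ _)) (≤-respˡ-≈ (-‿cong (sym x≈y)) (-≤∣∣ _)))
    (∣∣-least (≤-respˡ-≈ x≈y (≤∣∣ _)) (≤-respˡ-≈ (-‿cong x≈y) (-≤∣∣ _)))

  ∣∣-nonneg : ∀ {x} → 0# ≤ x → ∣ x ∣ ≈ x
  ∣∣-nonneg 0≤x = antisym (∣∣-least ≤-refl (≤-trans (≤-respʳ-≈ ε⁻¹≈ε (neg-anti-≤ 0≤x)) 0≤x)) (≤∣∣ _)

  ∣-∣ : ∀ x → ∣ - x ∣ ≈ ∣ x ∣
  ∣-∣ x = antisym (∣∣-least (-≤∣∣ x) (≤-respˡ-≈ (sym (⁻¹-involutive x)) (≤∣∣ x)))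
    (∣∣-least (≤-respˡ-≈ (⁻¹-involutive x) (-≤∣∣ (- x))) (≤∣∣ (- x)))

  ∣*∣ : ∀ x y → ∣ x * y ∣ ≈ ∣ x ∣ * ∣ y ∣
  ∣*∣ x y = trans (lemma (∣∣-cases x) (∣∣-cases y)) (∣∣-nonneg (0≤∣∣ x ⊗ 0≤∣∣ y))
    where
    step : ∀ {z w} → ∣ x ∣ ≡ z → ∣ y ∣ ≡ w → ∣ x * y ∣ ≈ ∣ z * w ∣ → ∣ x * y ∣ ≈ ∣ ∣ x ∣ * ∣ y ∣ ∣
    step ≡.refl ≡.refl eq = eq
    lemma : _ → _ → ∣ x * y ∣ ≈ ∣ ∣ x ∣ * ∣ y ∣ ∣
    lemma (inj₁ (_ , p)) (inj₁ (_ , q)) = step p q refl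
    lemma (inj₁ (_ , p)) (inj₂ (_ , q)) = step p q (trans (sym (∣-∣ _)) (∣∣-cong (-‿distribʳ-* x y)))
    lemma (inj₂ (_ , p)) (inj₁ (_ , q)) = step p q (trans (sym (∣-∣ _)) (∣∣-cong (-‿distribˡ-* x y)))
    lemma (inj₂ (_ , p)) (inj₂ (_ , q)) = step p q
      (∣∣-cong (solve 2 (λ x y → x :* y := (:- x) :* (:- y)) refl x y))

  -- If the naturals were bounded, the supremum `s` of the numbers below some natural could be
  -- lowered to `s - 1#`, because with `n` also `n + 1` lies below `s`.
  archimedean : ∀ x → ∃[ n ] (x ≤ fromℕ n)
  archimedean x with em {∃[ n ] (x ≤ fromℕ n)}
  ... | yes h = h
  ... | no  h = ⊥-elim (<⇒≱ 0<1 (lin (0≤- (proj₂ (proj₂ s) s-1-bound))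
      (solve 1 (λ s → ` 0 :- ` 1 := s :- ` 1 :- s) refl (proj₁ s))))
    where
    s = supremum (λ y → ∃[ n ] (y ≤ fromℕ n)) (0# , 0 , ≤-refl)
          (x , λ (n , y≤n) → ≤-trans y≤n (proj₁ (≰⇒> (λ x≤n → h (n , x≤n)))))
    s-1-bound : ∀ {y} → ∃[ n ] (y ≤ fromℕ n) → y ≤ proj₁ s - 1#
    s-1-bound {y} (n , y≤n) = lin (0≤- (proj₁ (proj₂ s) (suc n , ≤-refl)) ⊕ 0≤- y≤n)
      (solve 3 (λ s y n → s :- ` 1 :- y := s :- (` 1 :+ n) :+ (n :- y)) refl (proj₁ s) y (fromℕ n))


-- Laws of finite sums over inputs and message tuples.

module Summations (em : ExcludedMiddle 0ℓ) (ℝ : RealNumbers) where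

  open OrderedField em ℝ
  open MarginalInformation em ℝ using (∑ₘ)
  open import Algebra.Properties.CommutativeMonoid.Sum +-commutativeMonoid
    using (sum-cong-≋; ∑-distrib-+; ∑-comm)
  open import Algebra.Properties.Semiring.Sum semiring using (*-distribˡ-sum)

  -- Sums over x, over y and over message tuples obey the same laws, and products of index sets
  -- inherit them. Interchange is asked for with a sum over `Fin n`, since in each exchange one of
  -- the two sums runs over x or y.
  record Summation (A : Set) (∑ : (A → Carrier) → Carrier) : Set where
    field
      ∑-cong  : ∀ {g h} → (∀ a → g a ≈ h a) → ∑ g ≈ ∑ h
      ∑-+     : ∀ g h → ∑ (λ a → g a + h a) ≈ ∑ g + ∑ h
      ∑-*ˡ    : ∀ c g → ∑ (λ a → c * g a) ≈ c * ∑ g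
      0≤∑     : ∀ {g} → (∀ a → 0# ≤ g a) → 0# ≤ ∑ g
      term≤∑  : ∀ {g} → (∀ a → 0# ≤ g a) → ∀ a → g a ≤ ∑ g
      ∑-swap  : ∀ n (g : A → Fin n → Carrier) → ∑ (λ a → sum (g a)) ≈ sum (λ i → ∑ (λ a → g a i))

    ∑-*ʳ : ∀ c g → ∑ (λ a → g a * c) ≈ ∑ g * c
    ∑-*ʳ c g = trans (∑-cong (λ a → *-comm (g a) c)) (trans (∑-*ˡ c g) (*-comm c _))

    ∑-- : ∀ g h → ∑ (λ a → g a - h a) ≈ ∑ g - ∑ h
    ∑-- g h = trans (∑-+ g (λ a → - h a)) (+-congˡ (trans
      (∑-cong (λ a → solve 1 (λ z → :- z := (:- ` 1) :* z) refl (h a)))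
      (trans (∑-*ˡ (- 1#) h) (solve 1 (λ z → (:- ` 1) :* z := :- z) refl _))))

    ∑-mono : ∀ {g h} → (∀ a → g a ≤ h a) → ∑ g ≤ ∑ h
    ∑-mono {g} {h} g≤h = lin (0≤∑ (λ a → 0≤- (g≤h a))) (sym (∑-- h g))

    ∑-zero : ∀ {g} → (∀ a → g a ≈ 0#) → ∑ g ≈ 0#
    ∑-zero {g} g≈0 = trans (∑-cong (λ a → trans (g≈0 a) (sym (zeroˡ 0#))))
      (trans (∑-*ˡ 0# (λ _ → 0#)) (zeroˡ _))

  open Summation public

  ∑ᶠ : ∀ {n} → Summation (Fin n) sum
  ∑ᶠ .∑-cong = sum-cong-≋
  ∑ᶠ .∑-+    = ∑-distrib-+
  ∑ᶠ .∑-*ˡ c g = sym (*-distribˡ-sum c g)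
  ∑ᶠ .0≤∑ = nonneg
    where
    nonneg : ∀ {n} {g : Fin n → Carrier} → (∀ i → 0# ≤ g i) → 0# ≤ sum g
    nonneg {zero}  _   = ≤-refl
    nonneg {suc n} 0≤g = 0≤g zero ⊕ nonneg (λ i → 0≤g (suc i))
  ∑ᶠ .term≤∑ = term
    where
    term : ∀ {n} {g : Fin n → Carrier} → (∀ i → 0# ≤ g i) → ∀ i → g i ≤ sum g
    term {g = g} 0≤g zero = lin (∑ᶠ .0≤∑ (λ i → 0≤g (suc i)))
      (solve 2 (λ x y → x :+ y :- x := y) refl (g zero) _)
    term {g = g} 0≤g (suc i) = ≤-trans (term (λ j → 0≤g (suc j)) i)
      (lin (0≤g zero) (solve 2 (λ x y → x :+ y :- y := x) refl (g zero) _))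
  ∑ᶠ .∑-swap _ = ∑-comm

  ∑ᵐ : ∀ {ss} → Summation (Messages ss) ∑ₘ
  ∑ᵐ .∑-cong = cong
    where
    cong : ∀ {ss} {g h : Messages ss → Carrier} → (∀ m → g m ≈ h m) → ∑ₘ g ≈ ∑ₘ h
    cong {[]}     g≈h = g≈h []
    cong {s ∷ ss} g≈h = ∑-cong ∑ᶠ (λ a → cong (λ m → g≈h (a ∷ m)))
  ∑ᵐ .∑-+ = plus
    where
    plus : ∀ {ss} (g h : Messages ss → Carrier) → ∑ₘ (λ m → g m + h m) ≈ ∑ₘ g + ∑ₘ h
    plus {[]}     g h = refl
    plus {s ∷ ss} g h = trans (∑-cong ∑ᶠ (λ a → plus (λ m → g (a ∷ m)) (λ m → h (a ∷ m))))
      (∑-+ (∑ᶠ {s}) _ _)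
  ∑ᵐ .∑-*ˡ = times
    where
    times : ∀ {ss} c (g : Messages ss → Carrier) → ∑ₘ (λ m → c * g m) ≈ c * ∑ₘ g
    times {[]}     c g = refl
    times {s ∷ ss} c g = trans (∑-cong ∑ᶠ (λ a → times c (λ m → g (a ∷ m)))) (∑-*ˡ (∑ᶠ {s}) c _)
  ∑ᵐ .0≤∑ = nonneg
    where
    nonneg : ∀ {ss} {g : Messages ss → Carrier} → (∀ m → 0# ≤ g m) → 0# ≤ ∑ₘ g
    nonneg {[]}     0≤g = 0≤g []
    nonneg {s ∷ ss} 0≤g = 0≤∑ ∑ᶠ (λ a → nonneg (λ m → 0≤g (a ∷ m)))
  ∑ᵐ .term≤∑ = term
    where
    term : ∀ {ss} {g : Messages ss → Carrier} → (∀ m → 0# ≤ g m) → ∀ m → g m ≤ ∑ₘ g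
    term {[]}     0≤g []      = ≤-refl
    term {s ∷ ss} 0≤g (a ∷ m) = ≤-trans (term (λ m → 0≤g (a ∷ m)) m)
      (term≤∑ ∑ᶠ (λ b → 0≤∑ ∑ᵐ (λ m → 0≤g (b ∷ m))) a)
  ∑ᵐ .∑-swap n = swap
    where
    swap : ∀ {ss n} (g : Messages ss → Fin n → Carrier) →
           ∑ₘ (λ m → sum (g m)) ≈ sum (λ i → ∑ₘ (λ m → g m i))
    swap {[]}     g = refl
    swap {s ∷ ss} {n} g = trans (∑-cong ∑ᶠ (λ a → swap (λ m → g (a ∷ m)))) (∑-swap (∑ᶠ {s}) n _)

  infixr 7 _⊠_

  _⊠_ : ∀ {A B ∑₁ ∑₂} → Summation A ∑₁ → Summation B ∑₂ →
        Summation (A × B) (λ g → ∑₁ (λ a → ∑₂ (λ b → g (a , b))))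
  (S ⊠ T) .∑-cong g≈h = ∑-cong S (λ a → ∑-cong T (λ b → g≈h (a , b)))
  (S ⊠ T) .∑-+ g h = trans (∑-cong S (λ a → ∑-+ T _ _)) (∑-+ S _ _)
  (S ⊠ T) .∑-*ˡ c g = trans (∑-cong S (λ a → ∑-*ˡ T c _)) (∑-*ˡ S c _)
  (S ⊠ T) .0≤∑ 0≤g = 0≤∑ S (λ a → 0≤∑ T (λ b → 0≤g (a , b)))
  (S ⊠ T) .term≤∑ 0≤g (a , b) = ≤-trans (term≤∑ T (λ b → 0≤g (a , b)) b)
    (term≤∑ S (λ a → 0≤∑ T (λ b → 0≤g (a , b))) a)
  (S ⊠ T) .∑-swap n g = trans (∑-cong S (λ a → ∑-swap T n _)) (∑-swap S n _)


-- The exponential series, its functional equation, and the logarithm.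

module Exponential (em : ExcludedMiddle 0ℓ) (ℝ : RealNumbers) where

  open OrderedField em ℝ
  open Summations em ℝ
  open import Algebra.Properties.Semiring.Mult semiring using (×1-homo-*)

  private

    S : (ℕ → Carrier) → ℕ → Carrier
    S f n = ∑[ k < n ] f (toℕ k)

    S-snoc : ∀ f n → S f (suc n) ≈ S f n + f n
    S-snoc f zero    = +-comm _ _
    S-snoc f (suc n) = trans (+-congˡ (S-snoc (f ∘ suc) n)) (sym (+-assoc _ _ _))

    S-extend : ∀ {f} → (∀ k → 0# ≤ f k) → ∀ m k → S f m ≤ S f (k ℕ.+ m)
    S-extend 0≤f m zero    = ≤-refl
    S-extend {f} 0≤f m (suc k) = ≤-trans (S-extend 0≤f m k)
      (lin (0≤f (k ℕ.+ m)) (trans (+-congʳ (S-snoc f (k ℕ.+ m)))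
        (solve 2 (λ a b → a :+ b :- a := b) refl _ _)))

    conv : (f g : ℕ → Carrier) → ℕ → Carrier
    conv f g zero    = f 0 * g 0
    conv f g (suc n) = f 0 * g (suc n) + conv (f ∘ suc) g n

    conv-snoc : ∀ f g n → conv f g (suc n) ≈ conv f (g ∘ suc) n + f (suc n) * g 0
    conv-snoc f g zero    = refl
    conv-snoc f g (suc n) = trans (+-congˡ (conv-snoc (f ∘ suc) g n)) (sym (+-assoc _ _ _))

    conv-cong : ∀ {f f′ g g′} → (∀ k → f k ≈ f′ k) → (∀ k → g k ≈ g′ k) → ∀ n → conv f g n ≈ conv f′ g′ n
    conv-cong p q zero    = *-cong (p 0) (q 0)
    conv-cong p q (suc n) = +-cong (*-cong (p 0) (q (suc n))) (conv-cong (p ∘ suc) q n)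

    conv-+ : ∀ f f′ g n → conv (λ k → f k + f′ k) g n ≈ conv f g n + conv f′ g n
    conv-+ f f′ g zero    = distribʳ _ _ _
    conv-+ f f′ g (suc n) = trans (+-congˡ (conv-+ (f ∘ suc) (f′ ∘ suc) g n))
      (solve 5 (λ a b c d e → (a :+ b) :* c :+ (d :+ e) := a :* c :+ d :+ (b :* c :+ e)) refl _ _ _ _ _)

    conv-*ˡ : ∀ c f g n → conv (λ k → c * f k) g n ≈ c * conv f g n
    conv-*ˡ c f g zero    = *-assoc _ _ _
    conv-*ˡ c f g (suc n) = trans (+-congˡ (conv-*ˡ c (f ∘ suc) g n))
      (solve 4 (λ c a b d → c :* a :* b :+ c :* d := c :* (a :* b :+ d)) refl _ _ _ _)

    conv-*ʳ : ∀ c f g n → conv f (λ k → c * g k) n ≈ c * conv f g n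
    conv-*ʳ c f g zero    = solve 3 (λ c a b → a :* (c :* b) := c :* (a :* b)) refl _ _ _
    conv-*ʳ c f g (suc n) = trans (+-congˡ (conv-*ʳ c (f ∘ suc) g n))
      (solve 4 (λ c a b d → a :* (c :* b) :+ c :* d := c :* (a :* b :+ d)) refl _ _ _ _)

    θ : (ℕ → Carrier) → ℕ → Carrier
    θ f k = fromℕ k * f k

    -- θ is a derivation for the Cauchy product.
    conv-θ : ∀ f g n → fromℕ n * conv f g n ≈ conv (θ f) g n + conv f (θ g) n
    conv-θ f g zero    = solve 2 (λ a b → ` 0 :* (a :* b) := ` 0 :* a :* b :+ a :* (` 0 :* b)) refl _ _
    conv-θ f g (suc n) = begin
      (1# + N) * (f 0 * g (suc n) + c)
        ≈⟨ solve 4 (λ N a b c → (` 1 :+ N) :* (a :* b :+ c)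
             := ` 0 :* a :* b :+ (N :* c :+ c) :+ a :* ((` 1 :+ N) :* b)) refl N _ _ c ⟩
      0# * f 0 * g (suc n) + (N * c + c) + f 0 * θ g (suc n)
        ≈⟨ +-congʳ (+-congˡ (+-congʳ (conv-θ (f ∘ suc) g n))) ⟩
      0# * f 0 * g (suc n) + (conv (θ (f ∘ suc)) g n + d + c) + f 0 * θ g (suc n)
        ≈⟨ solve 5 (λ z c d e a → z :+ (e :+ d :+ c) :+ a := z :+ (e :+ c) :+ (a :+ d)) refl _ c d _ _ ⟩
      0# * f 0 * g (suc n) + (conv (θ (f ∘ suc)) g n + c) + (f 0 * θ g (suc n) + d)
        ≈⟨ +-congʳ (+-congˡ (conv-+ (θ (f ∘ suc)) (f ∘ suc) g n)) ⟨
      0# * f 0 * g (suc n) + conv (λ k → θ (f ∘ suc) k + f (suc k)) g n + (f 0 * θ g (suc n) + d)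
        ≈⟨ +-congʳ (+-congˡ (conv-cong (λ k → solve 2 (λ k a → k :* a :+ a := (` 1 :+ k) :* a)
             refl (fromℕ k) _) (λ _ → refl) n)) ⟩
      conv (θ f) g (suc n) + conv f (θ g) (suc n) ∎
      where
      open import Relation.Binary.Reasoning.Setoid setoid
      N = fromℕ n
      c = conv (f ∘ suc) g n
      d = conv (f ∘ suc) (θ g) n

    -- The sum of `f i * g j` over `i + j < n`. For nonnegative terms it lies below `S f n` times
    -- any bound on the sums of `g`, and at size `n + m` above `S f n * S g m`; this takes the place
    -- of a theorem on products of absolutely convergent series.
    triangle : (f g : ℕ → Carrier) → ℕ → Carrier
    triangle f g zero    = 0#
    triangle f g (suc n) = f 0 * S g (suc n) + triangle (f ∘ suc) g n

    S-conv : ∀ f g n → S (conv f g) n ≈ triangle f g n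
    S-conv f g zero    = refl
    S-conv f g (suc n) = begin
      f 0 * g 0 + S (conv f g ∘ suc) n
        ≈⟨ +-congˡ (∑-+ (∑ᶠ {n}) _ _) ⟩
      f 0 * g 0 + (∑[ k < n ] (f 0 * g (suc (toℕ k))) + S (conv (f ∘ suc) g) n)
        ≈⟨ +-congˡ (+-cong (∑-*ˡ (∑ᶠ {n}) (f 0) _) (S-conv (f ∘ suc) g n)) ⟩
      f 0 * g 0 + (f 0 * S (g ∘ suc) n + triangle (f ∘ suc) g n)
        ≈⟨ solve 4 (λ a b c d → a :* b :+ (a :* c :+ d) := a :* (b :+ c) :+ d) refl _ _ _ _ ⟩
      f 0 * S g (suc n) + triangle (f ∘ suc) g n ∎
      where open import Relation.Binary.Reasoning.Setoid setoid

    triangle-nonneg : ∀ {f g} → (∀ k → 0# ≤ f k) → (∀ k → 0# ≤ g k) → ∀ n → 0# ≤ triangle f g n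
    triangle-nonneg 0≤f 0≤g zero    = ≤-refl
    triangle-nonneg 0≤f 0≤g (suc n) =
      0≤f 0 ⊗ 0≤∑ (∑ᶠ {suc n}) (0≤g ∘ toℕ) ⊕ triangle-nonneg (0≤f ∘ suc) 0≤g n

    triangle-upper : ∀ {f g b} → (∀ k → 0# ≤ f k) → (∀ k → S g k ≤ b) → ∀ n → triangle f g n ≤ S f n * b
    triangle-upper 0≤f g≤b zero    = ≈⇒≤ (sym (zeroˡ _))
    triangle-upper 0≤f g≤b (suc n) = ≤-respʳ-≈ (sym (distribʳ _ _ _))
      (+-mono-≤ (*-monoˡ-≤ (0≤f 0) (g≤b (suc n))) (triangle-upper (0≤f ∘ suc) g≤b n))

    triangle-lower : ∀ {f g} → (∀ k → 0# ≤ f k) → (∀ k → 0# ≤ g k) → ∀ n m → S f n * S g m ≤ triangle f g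
        (n ℕ.+ m)
    triangle-lower 0≤f 0≤g zero    m = ≤-respˡ-≈ (sym (zeroˡ _)) (triangle-nonneg 0≤f 0≤g m)
    triangle-lower 0≤f 0≤g (suc n) m = ≤-respˡ-≈ (sym (distribʳ _ _ _))
      (+-mono-≤ (*-monoˡ-≤ (0≤f 0) (S-extend 0≤g m (suc n))) (triangle-lower (0≤f ∘ suc) 0≤g n m))

    geometric : ∀ {h} → h ≤ 1# → ∀ {f} → (∀ k → f (suc k) ≤ h * f k) → (∀ k → 0# ≤ f k) →
                ∀ n → (1# - h) * S f n ≤ f 0
    geometric h≤1 f≤ 0≤f zero    = ≤-respˡ-≈ (sym (zeroʳ _)) (0≤f 0)
    geometric {h} h≤1 {f} f≤ 0≤f (suc n) =
      lin (0≤- (geometric h≤1 (f≤ ∘ suc) (0≤f ∘ suc) n) ⊕ 0≤- (f≤ 0))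
        (solve 4 (λ h a b s → a :- (` 1 :- h) :* (a :+ s) := b :- (` 1 :- h) :* s :+ (h :* a :- b))
          refl h (f 0) (f 1) (S (f ∘ suc) n))

    0<fromℕ : ∀ n → 0# < fromℕ (suc n)
    0<fromℕ n = 0<+ 0<1 (≤-respʳ-≈ (sym (fromℕ≈ n)) (0≤num n))

    1≤! : ∀ n → ∃[ k ] (n ! ≡ suc k)
    1≤! zero    = 0 , ≡.refl
    1≤! (suc n) with n ! | 1≤! n
    ... | _ | k , ≡.refl = k ℕ.+ n ℕ.* suc k , ≡.refl

    0<fromℕ! : ∀ n → 0# < fromℕ (n !)
    0<fromℕ! n with n ! | 1≤! n
    ... | _ | k , ≡.refl = 0<fromℕ k

    e : Carrier → ℕ → Carrier
    e x k = x ^ k / fromℕ (k !)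

    e-zero : ∀ x → e x 0 ≈ 1#
    e-zero x = trans (*-congˡ (⁻¹-cong (+-identityʳ 1#))) (⁻¹-inverseʳ (0<⇒≉ 0<1))

    e-suc : ∀ x n → fromℕ (suc n) * e x (suc n) ≈ x * e x n
    e-suc x n = *-cancelˡ-≈ (0<⇒≉ (0<fromℕ! n)) (begin
      a * (b * e x (suc n))              ≈⟨ solve 3 (λ a b c → a :* (b :* c) := c :* (b :* a)) refl a b _ ⟩
      e x (suc n) * (b * a)              ≈⟨ *-congˡ (×1-homo-* (suc n) (n !)) ⟨
      e x (suc n) * fromℕ (suc n !)      ≈⟨ /-*-cancel (0<⇒≉ (0<fromℕ! (suc n))) ⟩
      x * x ^ n                          ≈⟨ *-congˡ (/-*-cancel (0<⇒≉ (0<fromℕ! n))) ⟨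
      x * (e x n * a)                    ≈⟨ solve 3 (λ a b c → b :* (c :* a) := a :* (b :* c)) refl a x _ ⟩
      a * (x * e x n)                    ∎)
      where
      open import Relation.Binary.Reasoning.Setoid setoid
      a = fromℕ (n !)
      b = fromℕ (suc n)

    -- Both sides start at 1 and satisfy the recurrence `(n + 1) c (n + 1) = (x + y) c n`, the left
    -- one by `conv-θ` and `e-suc`. No binomial coefficients appear.
    e-conv : ∀ x y n → conv (e x) (e y) n ≈ e (x + y) n
    e-conv x y zero    = trans (*-cong (e-zero x) (e-zero y))
        (trans (*-identityˡ 1#) (sym (e-zero (x + y))))
    e-conv x y (suc n) = *-cancelˡ-≈ (0<⇒≉ (0<fromℕ n)) (begin
      fromℕ (suc n) * conv (e x) (e y) (suc n)
        ≈⟨ conv-θ (e x) (e y) (suc n) ⟩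
      0# * e x 0 * e y (suc n) + conv (θ (e x) ∘ suc) (e y) n + conv (e x) (θ (e y)) (suc n)
        ≈⟨ +-cong (+-congˡ (trans (conv-cong (e-suc x) (λ _ → refl) n) (conv-*ˡ x (e x) (e y) n)))
             (trans (conv-snoc (e x) (θ (e y)) n)
               (+-congʳ (trans (conv-cong (λ _ → refl) (e-suc y) n) (conv-*ʳ y (e x) (e y) n)))) ⟩
      0# * e x 0 * e y (suc n) + x * c + (y * c + e x (suc n) * (0# * e y 0))
        ≈⟨ solve 7 (λ x y c p q r s → ` 0 :* p :* q :+ x :* c :+ (y :* c :+ r :* (` 0 :* s)) :=
            (x :+ y) :* c)
             refl x y c _ _ _ _ ⟩
      (x + y) * c                            ≈⟨ *-congˡ (e-conv x y n) ⟩
      (x + y) * e (x + y) n                  ≈⟨ e-suc (x + y) n ⟨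
      fromℕ (suc n) * e (x + y) (suc n)      ∎)
      where
      open import Relation.Binary.Reasoning.Setoid setoid
      c = conv (e x) (e y) n

    S-e-+ : ∀ x y n → S (e (x + y)) n ≈ triangle (e x) (e y) n
    S-e-+ x y n = trans (∑-cong (∑ᶠ {n}) (λ k → sym (e-conv x y (toℕ k)))) (S-conv (e x) (e y) n)

    ^-mono : ∀ {x y} → 0# ≤ x → x ≤ y → ∀ k → 0# ≤ x ^ k × x ^ k ≤ y ^ k
    ^-mono 0≤x x≤y zero    = 0≤1 , ≤-refl
    ^-mono 0≤x x≤y (suc k) with ^-mono 0≤x x≤y k
    ... | p , q = 0≤x ⊗ p , *-mono-≤ 0≤x x≤y p q

    e-nonneg : ∀ {x} → 0# ≤ x → ∀ k → 0# ≤ e x k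
    e-nonneg 0≤x k = proj₁ (^-mono 0≤x ≤-refl k) ⊗ 0≤⁻¹ (proj₁ (0<fromℕ! k))

    e-mono : ∀ {x y} → 0# ≤ x → x ≤ y → ∀ k → e x k ≤ e y k
    e-mono 0≤x x≤y k = *-monoʳ-≤ (0≤⁻¹ (proj₁ (0<fromℕ! k))) (proj₂ (^-mono 0≤x x≤y k))

    e-ratio : ∀ {h} → 0# ≤ h → ∀ k → e h (suc k) ≤ h * e h k
    e-ratio {h} 0≤h k = ≤-respʳ-≈ (e-suc h k)
      (lin (≤-respʳ-≈ (sym (fromℕ≈ k)) (0≤num k) ⊗ e-nonneg 0≤h (suc k))
        (solve 2 (λ k e → (` 1 :+ k) :* e :- e := k :* e) refl (fromℕ k) _))

    e-small : ∀ {h} → 0# ≤ h → h ≤ 1# → ∀ n → (1# - h) * S (e h) n ≤ 1#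
    e-small {h} 0≤h h≤1 n = ≤-respʳ-≈ (e-zero h) (geometric h≤1 (e-ratio 0≤h) (e-nonneg 0≤h) n)

    Bounded : Carrier → Set
    Bounded x = ∃[ b ] (∀ n → S (e x) n ≤ b)

    Bounded-+ : ∀ {x y} → 0# ≤ x → 0# ≤ y → Bounded x → Bounded y → Bounded (x + y)
    Bounded-+ 0≤x 0≤y (b , x≤b) (c , y≤c) = b * c , λ n →
      ≤-respˡ-≈ (sym (S-e-+ _ _ n)) (≤-trans (triangle-upper (e-nonneg 0≤x) y≤c n)
        (*-monoʳ-≤ (y≤c 0) (x≤b n)))

    ½ : Carrier
    ½ = (1# + 1#) ⁻¹

    ½+½ : ½ + ½ ≈ 1#
    ½+½ = trans (solve 1 (λ h → h :+ h := (` 1 :+ ` 1) :* h) refl ½) (⁻¹-inverseʳ (0<⇒≉ 0<2))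

    0≤½ : 0# ≤ ½
    0≤½ = 0≤⁻¹ (proj₁ 0<2)

    Bounded-½ : Bounded ½
    Bounded-½ = 1# + 1# , λ n → ≤-respˡ-≈ (lemma (S (e ½) n))
      (≤-respʳ-≈ (*-identityʳ _) (*-monoˡ-≤ (proj₁ 0<2)
        (e-small 0≤½ (lin 0≤½ (trans (+-congʳ (sym ½+½)) (solve 1 (λ h → h :+ h :- h := h) refl ½))) n)))
      where
      lemma : ∀ s → (1# + 1#) * ((1# - ½) * s) ≈ s
      lemma s = trans (*-congˡ (*-congʳ (+-congʳ (sym ½+½))))
        (trans (solve 2 (λ h s → (` 1 :+ ` 1) :* ((h :+ h :- h) :* s) := (h :+ h) :* s) refl ½ s)
          (trans (*-congʳ ½+½) (*-identityˡ s)))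

    Bounded-fromℕ : ∀ n → Bounded (fromℕ n * ½)
    Bounded-fromℕ zero    = 1# , λ n → ≤-respˡ-≈
      (solve 2 (λ h s → (` 1 :- ` 0 :* h) :* s := s) refl ½ (S (e (0# * ½)) n))
      (e-small (≈⇒≤ (sym (zeroˡ ½))) (≤-respˡ-≈ (sym (zeroˡ ½)) 0≤1) n)
    Bounded-fromℕ (suc n) = proj₁ b , λ k → ≤-respˡ-≈ (∑-cong (∑ᶠ {k}) (λ i → *-congʳ (^-cong (toℕ i))))
        (proj₂ b k)
      where
      b = Bounded-+ 0≤½ (≤-respʳ-≈ (sym (fromℕ≈ n)) (0≤num n) ⊗ 0≤½) Bounded-½ (Bounded-fromℕ n)
      ^-cong : ∀ k → (½ + fromℕ n * ½) ^ k ≈ ((1# + fromℕ n) * ½) ^ k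
      ^-cong zero    = refl
      ^-cong (suc k) = *-cong (solve 2 (λ n h → h :+ n :* h := (` 1 :+ n) :* h) refl (fromℕ n) ½) (^-cong k)

    -- Comparison with a geometric series works below 1 only. It is applied at `½`, and the addition
    -- law for partial sums carries boundedness to every multiple of `½`, one of which exceeds `x`.
    bounded : ∀ {x} → 0# ≤ x → Bounded x
    bounded {x} 0≤x with archimedean (x + x)
    ... | n , 2x≤n with Bounded-fromℕ n
    ... | b , ≤b = b , λ k → ≤-trans (∑-mono (∑ᶠ {k}) (λ i → e-mono 0≤x x≤n½ (toℕ i))) (≤b k)
      where
      x≤n½ : x ≤ fromℕ n * ½
      x≤n½ = ≤-respˡ-≈ (trans (solve 2 (λ x h → (x :+ x) :* h := x :* (h :+ h)) refl x ½)
        (trans (*-congˡ ½+½) (*-identityʳ x))) (*-monoʳ-≤ 0≤½ 2x≤n)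

  -- Under these hypotheses the supremum in `ℝ±` is finite, so that `toℝ` does not return a default
  -- value; both `exp₊` and `ln` are read off in this way.
  ⨆-finite : {A : Set} (g : A → Carrier) → A → ∀ {b} → (∀ i → g i ≤ b) →
             (∀ i → g i ≤ toℝ (⨆ (λ i → [ g i ]))) ×
             (∀ {c} → (∀ i → g i ≤ c) → toℝ (⨆ (λ i → [ g i ])) ≤ c)
  ⨆-finite {A} g a {b} g≤b = finite (⨆ (λ i → [ g i ])) (⨆-upper (λ i → [ g i ]))
      (λ g≤c → ⨆-least (λ i → [ g i ]) [ _ ] (λ i → [ g≤c i ]≤))
    where
    finite : ∀ s → (∀ i → [ g i ] ≤± s) → (∀ {c} → (∀ i → g i ≤ c) → s ≤± [ c ]) →
             (∀ i → g i ≤ toℝ s) × (∀ {c} → (∀ i → g i ≤ c) → toℝ s ≤ c)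
    finite ⊥±    upper least with upper a
    ... | AddSupremum.[_] ()
    finite [ s ] upper least = (λ i → [≤]-injective (upper i)) , (λ g≤c → [≤]-injective (least g≤c))
    finite ⊤±    upper least with least g≤b
    ... | ()

  private

    module Limit {x} (0≤x : 0# ≤ x) where
      upper : ∀ n → S (e x) n ≤ exp₊ x
      upper = proj₁ (⨆-finite (S (e x)) 0 (proj₂ (bounded 0≤x)))
      least : ∀ {c} → (∀ n → S (e x) n ≤ c) → exp₊ x ≤ c
      least = proj₂ (⨆-finite (S (e x)) 0 (proj₂ (bounded 0≤x)))

    open Limit

    0≤S : ∀ {x} → 0# ≤ x → ∀ n → 0# ≤ S (e x) n
    0≤S 0≤x n = 0≤∑ (∑ᶠ {n}) (λ k → e-nonneg 0≤x (toℕ k))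

    1≤exp₊ : ∀ {x} → 0# ≤ x → 1# ≤ exp₊ x
    1≤exp₊ {x} 0≤x = ≤-trans (≈⇒≤ (trans (sym (e-zero x)) (sym (+-identityʳ _)))) (upper 0≤x 1)

    0<exp₊ : ∀ {x} → 0# ≤ x → 0# < exp₊ x
    0<exp₊ 0≤x = <-≤-trans 0<1 (1≤exp₊ 0≤x)

    -- For products of suprema: the supremum in one factor is taken after division by the other, and
    -- this division has to be undone also when the other factor is 0.
    ≤-absorb : ∀ {b c d} → 0# ≤ b → (0# < b → c ≤ d / b) → 0# ≤ d → c * b ≤ d
    ≤-absorb {b} 0≤b c≤d/b 0≤d with ≈0? b
    ... | inj₁ b≈0 = ≤-respˡ-≈ (sym (trans (*-congˡ b≈0) (zeroʳ _))) 0≤d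
    ... | inj₂ b≉0 = ≤-respʳ-≈ (/-*-cancel b≉0) (*-monoʳ-≤ 0≤b (c≤d/b (0≤∧≉⇒0< 0≤b b≉0)))

    exp₊-+ : ∀ {x y} → 0# ≤ x → 0# ≤ y → exp₊ (x + y) ≈ exp₊ x * exp₊ y
    exp₊-+ {x} {y} 0≤x 0≤y = antisym
      (least 0≤x+y λ n → ≤-respˡ-≈ (sym (S-e-+ x y n))
        (≤-trans (triangle-upper (e-nonneg 0≤x) (upper 0≤y) n)
          (*-monoʳ-≤ (proj₁ (0<exp₊ 0≤y)) (upper 0≤x n))))
      (≤-absorb (proj₁ (0<exp₊ 0≤y))
        (λ 0<y → least 0≤x λ n → ≤-/ 0<y (≤-respˡ-≈ (*-comm _ _)
          (≤-absorb (0≤S 0≤x n)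
            (λ 0<Sn → least 0≤y λ m → ≤-/ 0<Sn (≤-respˡ-≈ (*-comm _ _) (product≤ n m)))
            (proj₁ (0<exp₊ 0≤x+y)))))
        (proj₁ (0<exp₊ 0≤x+y)))
      where
      0≤x+y = 0≤x ⊕ 0≤y
      product≤ : ∀ n m → S (e x) n * S (e y) m ≤ exp₊ (x + y)
      product≤ n m = ≤-trans (triangle-lower (e-nonneg 0≤x) (e-nonneg 0≤y) n m)
        (≤-respˡ-≈ (S-e-+ x y (n ℕ.+ m)) (upper 0≤x+y (n ℕ.+ m)))

    ^-cong : ∀ {x y} → x ≈ y → ∀ k → x ^ k ≈ y ^ k
    ^-cong x≈y zero    = refl
    ^-cong x≈y (suc k) = *-cong x≈y (^-cong x≈y k)

    exp₊-cong : ∀ {x y} → 0# ≤ x → x ≈ y → exp₊ x ≈ exp₊ y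
    exp₊-cong {x} {y} 0≤x x≈y = antisym
      (least 0≤x (λ n → ≤-respˡ-≈ (S-cong n) (upper 0≤y n)))
      (least 0≤y (λ n → ≤-respˡ-≈ (sym (S-cong n)) (upper 0≤x n)))
      where
      0≤y = ≤-respʳ-≈ x≈y 0≤x
      S-cong : ∀ n → S (e y) n ≈ S (e x) n
      S-cong n = ∑-cong (∑ᶠ {n}) (λ k → *-congʳ (^-cong (sym x≈y) (toℕ k)))

    exp-difference : ∀ {x a b} → 0# ≤ a → 0# ≤ b → x + b ≈ a → exp x * exp₊ b ≈ exp₊ a
    exp-difference {x} {a} {b} 0≤a 0≤b x+b≈a with total 0# x
    ... | inj₁ 0≤x = trans (sym (exp₊-+ 0≤x 0≤b)) (exp₊-cong (0≤x ⊕ 0≤b) x+b≈a)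
    ... | inj₂ x≤0 = begin
      exp₊ (- x) ⁻¹ * exp₊ b                  ≈⟨ *-congˡ (exp₊-cong 0≤b b≈a-x) ⟩
      exp₊ (- x) ⁻¹ * exp₊ (a + - x)          ≈⟨ *-congˡ (exp₊-+ 0≤a 0≤-x) ⟩
      exp₊ (- x) ⁻¹ * (exp₊ a * exp₊ (- x))   ≈⟨ solve 3 (λ i a x → i :* (a :* x) := x :* i :* a) refl _ _
          _ ⟩
      exp₊ (- x) * exp₊ (- x) ⁻¹ * exp₊ a     ≈⟨ *-congʳ (⁻¹-inverseʳ (0<⇒≉ (0<exp₊ 0≤-x))) ⟩
      1# * exp₊ a                             ≈⟨ *-identityˡ _ ⟩
      exp₊ a                                  ∎
      where
      open import Relation.Binary.Reasoning.Setoid setoid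
      0≤-x : 0# ≤ - x
      0≤-x = ≤-respʳ-≈ (+-identityˡ _) (0≤- x≤0)
      b≈a-x : b ≈ a + - x
      b≈a-x = trans (solve 2 (λ x b → b := x :+ b :- x) refl x b) (+-congʳ x+b≈a)

    -- With exp-difference this reduces the laws of exp to those of exp₊, whatever the signs.
    split : ∀ x → ∃[ a ] ∃[ b ] (0# ≤ a × 0# ≤ b × x + b ≈ a)
    split x with total 0# x
    ... | inj₁ 0≤x = x , 0# , 0≤x , ≤-refl , +-identityʳ x
    ... | inj₂ x≤0 = 0# , - x , ≤-refl , ≤-respʳ-≈ (+-identityˡ _) (0≤- x≤0) , -‿inverseʳ x

  exp-+ : ∀ x y → exp (x + y) ≈ exp x * exp y
  exp-+ x y with split x | split y
  ... | a , b , 0≤a , 0≤b , p | c , d , 0≤c , 0≤d , q = *-cancelˡ-≈ (0<⇒≉ (0<exp₊ (0≤b ⊕ 0≤d))) (begin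
    exp₊ (b + d) * exp (x + y)          ≈⟨ *-comm _ _ ⟩
    exp (x + y) * exp₊ (b + d)          ≈⟨ exp-difference (0≤a ⊕ 0≤c) (0≤b ⊕ 0≤d)
                                             (trans (solve 4 (λ x y b d → x :+ y :+ (b :+ d) := x :+ b :+
                                                 (y :+ d))
                                               refl x y b d) (+-cong p q)) ⟩
    exp₊ (a + c)                        ≈⟨ exp₊-+ 0≤a 0≤c ⟩
    exp₊ a * exp₊ c                     ≈⟨ *-cong (exp-difference 0≤a 0≤b p) (exp-difference 0≤c 0≤d q) ⟨
    exp x * exp₊ b * (exp y * exp₊ d)   ≈⟨ solve 4 (λ x b y d → x :* b :* (y :* d) := b :* d :* (x :* y))
        refl _ _ _ _ ⟩
    exp₊ b * exp₊ d * (exp x * exp y)   ≈⟨ *-congʳ (exp₊-+ 0≤b 0≤d) ⟨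
    exp₊ (b + d) * (exp x * exp y)      ∎)
    where open import Relation.Binary.Reasoning.Setoid setoid

  exp-cong : ∀ {x y} → x ≈ y → exp x ≈ exp y
  exp-cong {x} {y} x≈y with split x
  ... | a , b , 0≤a , 0≤b , p = *-cancelˡ-≈ (0<⇒≉ (0<exp₊ 0≤b)) (trans (*-comm _ _) (trans
    (trans (exp-difference 0≤a 0≤b p) (sym (exp-difference 0≤a 0≤b (trans (+-congʳ (sym x≈y)) p))))
        (*-comm _ _)))

  private

    exp₊0 : exp₊ 0# ≈ 1#
    exp₊0 = *-cancelˡ-≈ (0<⇒≉ (0<exp₊ ≤-refl)) (trans (sym (exp₊-+ ≤-refl ≤-refl))
      (trans (exp₊-cong (≤-refl ⊕ ≤-refl) (+-identityʳ 0#)) (sym (*-identityʳ _))))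

    exp≈exp₊ : ∀ {x} → 0# ≤ x → exp x ≈ exp₊ x
    exp≈exp₊ {x} 0≤x = trans (sym (trans (*-congˡ exp₊0) (*-identityʳ _)))
      (exp-difference 0≤x ≤-refl (+-identityʳ x))

  exp-0 : exp 0# ≈ 1#
  exp-0 = trans (exp≈exp₊ ≤-refl) exp₊0

  exp-inverse : ∀ x → exp x * exp (- x) ≈ 1#
  exp-inverse x = trans (sym (exp-+ x (- x))) (trans (exp-cong (-‿inverseʳ x)) exp-0)

  exp-≉0 : ∀ x → ¬ (exp x ≈ 0#)
  exp-≉0 x eq = 0≉1 (trans (sym (zeroˡ _)) (trans (*-congʳ (sym eq)) (exp-inverse x)))

  0<exp : ∀ x → 0# < exp x
  0<exp x = 0≤∧≉⇒0< (nonneg (total 0# x)) (exp-≉0 x)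
    where
    nonneg : 0# ≤ x ⊎ x ≤ 0# → 0# ≤ exp x
    nonneg (inj₁ 0≤x) = ≤-respʳ-≈ (sym (exp≈exp₊ 0≤x)) (proj₁ (0<exp₊ 0≤x))
    nonneg (inj₂ x≤0) = *-cancelˡ-≤ (<-respʳ-≈ (sym (exp≈exp₊ 0≤-x)) (0<exp₊ 0≤-x))
      (≤-respˡ-≈ (sym (zeroʳ _)) (≤-respʳ-≈ (sym (trans (*-comm _ _) (exp-inverse x))) 0≤1))
      where
      0≤-x : 0# ≤ - x
      0≤-x = ≤-respʳ-≈ (+-identityˡ _) (0≤- x≤0)

  0≤exp : ∀ x → 0# ≤ exp x
  0≤exp x = proj₁ (0<exp x)

  -- Together with the addition law this yields monotonicity, injectivity and `exp-ln`, without
  -- continuity. For x between -1 and 0 it says `(1 - h) * exp h ≤ 1` with `h = - x`, which is the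
  -- comparison with a geometric series.
  1+x≤exp : ∀ x → 1# + x ≤ exp x
  1+x≤exp x = case (total 0# x) (total 0# (1# + x))
    where
    1+x≤exp-nonneg : 0# ≤ x → 1# + x ≤ exp x
    1+x≤exp-nonneg 0≤x = ≤-trans (≈⇒≤ S≈) (≤-respʳ-≈ (sym (exp≈exp₊ 0≤x)) (upper 0≤x 2))
      where
      S≈ : 1# + x ≈ S (e x) 2
      S≈ = +-cong (sym (e-zero x)) (trans (trans (trans
          (trans (sym (*-identityʳ x)) (*-congˡ (sym (e-zero x))))
        (sym (e-suc x 0))) (trans (*-congʳ (+-identityʳ 1#)) (*-identityˡ _))) (sym (+-identityʳ _)))

    1+x≤exp-nonpos : x ≤ 0# → 0# ≤ 1# + x → 1# + x ≤ exp x
    1+x≤exp-nonpos x≤0 0≤1+x = *-cancelˡ-≤ (0<exp (- x)) (begin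
      exp (- x) * (1# + x)    ≈⟨ *-congʳ (exp≈exp₊ 0≤-x) ⟩
      exp₊ (- x) * (1# + x)   ≤⟨ ≤-absorb 0≤1+x (λ 0<1+x → least 0≤-x λ n → ≤-/ 0<1+x (≤-respˡ-≈ (lemma n)
                                   (e-small 0≤-x (lin 0≤1+x (solve 1 (λ x → ` 1 :- :- x := ` 1 :+ x) refl
                                       x)) n))) 0≤1 ⟩
      1#                      ≈⟨ trans (*-comm _ _) (exp-inverse x) ⟨
      exp (- x) * exp x       ∎)
      where
      open ≤-Reasoning
      0≤-x : 0# ≤ - x
      0≤-x = ≤-respʳ-≈ (+-identityˡ _) (0≤- x≤0)
      lemma : ∀ n → (1# - - x) * S (e (- x)) n ≈ S (e (- x)) n * (1# + x)
      lemma n = solve 2 (λ x s → (` 1 :- :- x) :* s := s :* (` 1 :+ x)) refl x _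

    case : 0# ≤ x ⊎ x ≤ 0# → 0# ≤ 1# + x ⊎ 1# + x ≤ 0# → 1# + x ≤ exp x
    case (inj₁ 0≤x) _            = 1+x≤exp-nonneg 0≤x
    case (inj₂ x≤0) (inj₁ 0≤1+x) = 1+x≤exp-nonpos x≤0 0≤1+x
    case (inj₂ x≤0) (inj₂ 1+x≤0) = ≤-trans 1+x≤0 (0≤exp x)

  exp-mono : ∀ {x y} → x ≤ y → exp x ≤ exp y
  exp-mono {x} {y} x≤y = begin
    exp x                  ≈⟨ *-identityʳ _ ⟨
    exp x * 1#             ≤⟨ *-monoˡ-≤ (0≤exp x) (≤-trans 1≤ (1+x≤exp (y - x))) ⟩
    exp x * exp (y - x)    ≈⟨ exp-+ x (y - x) ⟨
    exp (x + (y - x))      ≈⟨ exp-cong (solve 2 (λ x y → x :+ (y :- x) := y) refl x y) ⟩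
    exp y                  ∎
    where
    open ≤-Reasoning
    1≤ : 1# ≤ 1# + (y - x)
    1≤ = lin (0≤- x≤y) (solve 2 (λ x y → ` 1 :+ (y :- x) :- ` 1 := y :- x) refl x y)

  exp-injective : ∀ {x y} → exp x ≈ exp y → x ≈ y
  exp-injective eq = antisym (le eq) (le (sym eq))
    where
    le : ∀ {x y} → exp x ≈ exp y → x ≤ y
    le {x} {y} eq = lin (0≤- (≤-respʳ-≈ exp≈1 (1+x≤exp (x - y))))
      (solve 2 (λ x y → y :- x := ` 1 :- (` 1 :+ (x :- y))) refl x y)
      where
      exp≈1 : exp (x - y) ≈ 1#
      exp≈1 = trans (exp-+ x (- y)) (trans (*-congʳ eq) (exp-inverse y))

  exp-cancel-≤ : ∀ {x y} → exp x ≤ exp y → x ≤ y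
  exp-cancel-≤ {x} {y} le with total x y
  ... | inj₁ x≤y = x≤y
  ... | inj₂ y≤x = ≈⇒≤ (exp-injective (antisym le (exp-mono y≤x)))

  exp-ln : ∀ {z} → 0# < z → exp (ln z) ≈ z
  exp-ln {z} 0<z = antisym (≮⇒≥′ not-above) (≮⇒≥′ not-below)
    where
    below : ∃[ x ] (exp x ≤ z)
    -- A point of the set whose supremum is `ln z`: `exp (- 1/z) ≤ z` is another form of
    -- `1/z ≤ exp (1/z)`.
    below = - (z ⁻¹) , *-cancelˡ-≤ (0<⁻¹ 0<z) (begin
      z ⁻¹ * exp (- (z ⁻¹))          ≤⟨ *-monoʳ-≤ (0≤exp _) (≤-trans
                                          (lin 0≤1 (solve 1 (λ a → ` 1 :+ a :- a := ` 1) refl (z ⁻¹)))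
                                              (1+x≤exp (z ⁻¹))) ⟩
      exp (z ⁻¹) * exp (- (z ⁻¹))    ≈⟨ exp-inverse (z ⁻¹) ⟩
      1#                             ≈⟨ trans (*-comm _ _) (⁻¹-inverseʳ (0<⇒≉ 0<z)) ⟨
      z ⁻¹ * z                       ∎)
      where open ≤-Reasoning
    sup = ⨆-finite proj₁ below {z} (λ (x , exp-x≤z) →
      ≤-trans (lin 0≤1 (solve 1 (λ x → ` 1 :+ x :- x := ` 1) refl x)) (≤-trans (1+x≤exp x) exp-x≤z))
    s = ln z
    E = exp s

    ≮⇒≥′ : ∀ {x y} → ¬ (y < x) → x ≤ y
    ≮⇒≥′ {x} {y} y≮x with ≤-<-connex x y
    ... | inj₁ x≤y = x≤y
    ... | inj₂ y<x = ⊥-elim (y≮x y<x)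

    0<1-/ : ∀ {x y} → 0# < y → x < y → 0# < 1# - x / y
    0<1-/ {x} {y} 0<y x<y = ≰⇒> λ le → <⇒≱ x<y (≤-respʳ-≈ (/-*-cancel (0<⇒≉ 0<y))
      (≤-respˡ-≈ (*-identityˡ y) (*-monoʳ-≤ (proj₁ 0<y)
        (lin (0≤- le) (solve 1 (λ q → q :- ` 1 := ` 0 :- (` 1 :- q)) refl _)))))

    not-above : ¬ (z < E)
    -- With `h = 1 - z / E` the estimate `exp (s - h) ≥ E * (1 - h) = z` makes `s - h` an upper
    -- bound smaller than the least one.
    not-above z<E = <⇒≱ 0<h (lin (0≤- (proj₂ sup (λ (x , exp-x≤z) → exp-cancel-≤ (≤-trans exp-x≤z z≤))))
      (solve 2 (λ s h → ` 0 :- h := s :- h :- s) refl s h))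
      where
      h = 1# - z / E
      0<h = 0<1-/ (0<exp s) z<E
      z≤ : z ≤ exp (s - h)
      z≤ = begin
        z                   ≈⟨ /-*-cancel (exp-≉0 s) ⟨
        z / E * E           ≈⟨ solve 2 (λ q E → q :* E := E :* (` 1 :+ :- (` 1 :- q))) refl (z / E) E ⟩
        E * (1# + - h)      ≤⟨ *-monoˡ-≤ (0≤exp s) (1+x≤exp (- h)) ⟩
        E * exp (- h)       ≈⟨ exp-+ s (- h) ⟨
        exp (s - h)         ∎
        where open ≤-Reasoning

    not-below : ¬ (E < z)
    -- With `h = 1 - E / z` the estimate `exp (- h) ≥ 1 - h = E / z` gives `exp (s + h) ≤ z`, so
    -- that `s + h` belongs to the set but exceeds its supremum.
    not-below E<z = <⇒≱ 0<h (lin (0≤- (proj₁ sup (s + h , ≤z)))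
      (solve 2 (λ s h → ` 0 :- h := s :- (s :+ h)) refl s h))
      where
      h = 1# - E / z
      0<h = 0<1-/ 0<z E<z
      1-h : 1# + - h ≈ E / z
      1-h = solve 1 (λ q → ` 1 :+ :- (` 1 :- q) := q) refl (E / z)
      0<q : 0# < E / z
      0<q = 0<* (0<exp s) (0<⁻¹ 0<z)
      ≤z : exp (s + h) ≤ z
      ≤z = *-cancelˡ-≤ 0<q (begin
        E / z * exp (s + h)           ≤⟨ *-monoʳ-≤ (0≤exp _) (≤-respˡ-≈ 1-h (1+x≤exp (- h))) ⟩
        exp (- h) * exp (s + h)       ≈⟨ exp-+ (- h) (s + h) ⟨
        exp (- h + (s + h))           ≈⟨ exp-cong (solve 2 (λ s h → :- h :+ (s :+ h) := s) refl s h) ⟩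
        E                             ≈⟨ /-*-cancel (0<⇒≉ 0<z) ⟨
        E / z * z                     ∎)
        where open ≤-Reasoning

  sqrt : ∀ {z} → 0# < z → ∃[ r ] (0# < r × r * r ≈ z)
  sqrt {z} 0<z = exp (½ * ln z) , 0<exp _ , trans (sym (exp-+ _ _)) (trans
    (exp-cong (trans (solve 2 (λ h l → h :* l :+ h :* l := (h :+ h) :* l) refl ½ (ln z))
      (trans (*-congʳ ½+½) (*-identityˡ _)))) (exp-ln 0<z))


-- Choosing signs one rank-one term at a time.

module RankOneSums (em : ExcludedMiddle 0ℓ) (ℝ : RealNumbers) where

  open OrderedField em ℝ
  open Summations em ℝ
  open import Algebra.Construct.NaturalChoice.Min totalOrder
    using (_⊓_; ⊓-glb; x⊓y≤x; x⊓y≤y)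

  ⊓-unique : ∀ {x y z} → z ≤ x → z ≤ y → z ≈ x ⊎ z ≈ y → x ⊓ y ≈ z
  ⊓-unique {x} {y} {z} z≤x z≤y eq = antisym (le eq) (⊓-glb z≤x z≤y)
    where
    le : z ≈ x ⊎ z ≈ y → x ⊓ y ≤ z
    le (inj₁ z≈x) = ≤-respʳ-≈ (sym z≈x) (x⊓y≤x x y)
    le (inj₂ z≈y) = ≤-respʳ-≈ (sym z≈y) (x⊓y≤y x y)

  -- E (a + ξ)⁴ = a⁴ + 6 a² S + 3 S² for a centred Gaussian ξ of variance S.
  quartic : Carrier → Carrier → Carrier
  quartic a S = a * a * (a * a) + (num 6 * (a * a * S) + num 3 * (S * S))

  quartic-cong : ∀ {a S S′} → S ≈ S′ → quartic a S ≈ quartic a S′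
  quartic-cong p = +-congˡ (+-cong (*-congˡ (*-congˡ p)) (*-congˡ (*-cong p p)))

  quartic-mono : ∀ {a S S′} → 0# ≤ S → S ≤ S′ → quartic a S ≤ quartic a S′
  quartic-mono {a} 0≤S S≤S′ = +-mono-≤ ≤-refl (+-mono-≤
    (*-monoˡ-≤ (0≤num 6) (*-monoˡ-≤ (0≤sq a) S≤S′))
    (*-monoˡ-≤ (0≤num 3) (*-mono-≤ 0≤S S≤S′ 0≤S S≤S′)))

  -- A random sign has the second moment of a standard Gaussian but fourth moment 1 instead of 3, so
  -- the sides differ by exactly `4 u⁴`.
  quartic-average : ∀ a u S → quartic (a + u) S + quartic (a - u) S ≤ num 2 * quartic a (S + u * u)
  quartic-average a u S = lin (0≤num 4 ⊗ (0≤sq u ⊗ 0≤sq u))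
    (solve 3 (λ a u S →
       let Q = λ a S → a :* a :* (a :* a) :+ (` 6 :* (a :* a :* S) :+ ` 3 :* (S :* S))
       in ` 2 :* Q a (S :+ u :* u) :- (Q (a :+ u) S :+ Q (a :- u) S) := ` 4 :* (u :* u :* (u :* u)))
     refl a u S)

  module Correlation {nX nY : ℕ} (μ : Fin nX → Fin nY → Carrier) (0≤μ : ∀ x y → 0# ≤ μ x y)
           (f : Fin nX → Fin nY → Bool) where

    private
      X = Fin nX
      Y = Fin nY

    ∑² : (X → Y → Carrier) → Carrier
    ∑² g = ∑[ x < nX ] ∑[ y < nY ] g x y

    private

      Σ² : Summation (X × Y) (λ g → ∑² (λ x y → g (x , y)))
      Σ² = ∑ᶠ ⊠ ∑ᶠ

      uncurry : {A : Set} → (X → Y → A) → X × Y → A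
      uncurry g (x , y) = g x y

    ∑²-cong : ∀ {g h} → (∀ x y → g x y ≈ h x y) → ∑² g ≈ ∑² h
    ∑²-cong {g} {h} p = ∑-cong Σ² {uncurry g} {uncurry h} (λ (x , y) → p x y)

    ∑²-mono : ∀ {g h} → (∀ x y → g x y ≤ h x y) → ∑² g ≤ ∑² h
    ∑²-mono {g} {h} p = ∑-mono Σ² {uncurry g} {uncurry h} (λ (x , y) → p x y)

    ∑²-+ : ∀ g h → ∑² (λ x y → g x y + h x y) ≈ ∑² g + ∑² h
    ∑²-+ g h = ∑-+ Σ² (uncurry g) (uncurry h)

    ∑²-*ˡ : ∀ c g → ∑² (λ x y → c * g x y) ≈ c * ∑² g
    ∑²-*ˡ c g = ∑-*ˡ Σ² c (uncurry g)

    correlate : (X → Y → Carrier) → Carrier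
    correlate W = ∑² (λ x y → μ x y * (sign (f x y) * W x y))

    correlate-cong : ∀ {V W} → (∀ x y → V x y ≈ W x y) → correlate V ≈ correlate W
    correlate-cong p = ∑²-cong (λ x y → *-congˡ (*-congˡ (p x y)))

    correlate-+ : ∀ V W → correlate (λ x y → V x y + W x y) ≈ correlate V + correlate W
    correlate-+ V W = trans (∑²-cong (λ x y →
      solve 4 (λ m s v w → m :* (s :* (v :+ w)) := m :* (s :* v) :+ m :* (s :* w))
        refl (μ x y) (sign (f x y)) (V x y) (W x y))) (∑²-+ _ _)

    module Potential (κ : Carrier) (0≤κ : 0# ≤ κ) where

      -- A pessimistic estimator: `a` and `b` carry the signs fixed so far, `S` and `R` the variance
      -- still to come. The quartic terms prepay the loss by clipping, with future fourth moments
      -- replaced by their Gaussian upper bounds.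
      potential : (X → Carrier) → (Y → Carrier) → (X → Carrier) → (Y → Carrier) → Carrier
      potential a b S R = ∑² (λ x y →
        μ x y * (sign (f x y) * (a x * b y) - κ * (quartic (a x) (S x) + quartic (b y) (R y))))

      potential-anti : ∀ {a b S S′ R R′} → (∀ x → 0# ≤ S x) → (∀ x → S x ≤ S′ x) →
                       (∀ y → 0# ≤ R y) → (∀ y → R y ≤ R′ y) → potential a b S′ R′ ≤ potential a b S R
      potential-anti 0≤S S≤S′ 0≤R R≤R′ = ∑²-mono λ x y → *-monoˡ-≤ (0≤μ x y)
        (+-mono-≤ ≤-refl (neg-anti-≤ (*-monoˡ-≤ 0≤κ
          (+-mono-≤ (quartic-mono (0≤S x) (S≤S′ x)) (quartic-mono (0≤R y) (R≤R′ y))))))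

      potential-cong : ∀ {a b S S′ R R′} → (∀ x → S x ≈ S′ x) → (∀ y → R y ≈ R′ y) →
                       potential a b S R ≈ potential a b S′ R′
      potential-cong S≈ R≈ = ∑²-cong λ x y → *-congˡ (+-congˡ (-‿cong (*-congˡ
        (+-cong (quartic-cong (S≈ x)) (quartic-cong (R≈ y))))))

      -- W = ∑ᵢ uᵢ ⊗ vᵢ with ∑ᵢ uᵢ² ≤ S and ∑ᵢ vᵢ² ≤ R, seen through what it is needed for:
      -- some choice of signs in a + ∑ᵢ ±uᵢ and b + ∑ᵢ ±vᵢ is at least as good as the average,
      -- with the fourth moments estimated by the Gaussian ones.
      record Decomposition (W : X → Y → Carrier) (S : X → Carrier) (R : Y → Carrier) : Set where
        field
          0≤S    : ∀ x → 0# ≤ S x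
          0≤R    : ∀ y → 0# ≤ R y
          extend : ∀ a b {S′ R′} → (∀ x → 0# ≤ S′ x) → (∀ y → 0# ≤ R′ y) →
                   ∃[ a′ ] ∃[ b′ ] (potential a b (λ x → S′ x + S x) (λ y → R′ y + R y) + correlate W
                                    ≤ potential a′ b′ S′ R′)

      open Decomposition

      decomposition-weaken : ∀ {V W S S′ R R′} → (∀ x y → V x y ≈ W x y) →
        (∀ x → S x ≤ S′ x) → (∀ y → R y ≤ R′ y) → Decomposition V S R → Decomposition W S′ R′
      decomposition-weaken V≈W S≤S′ R≤R′ D = record
        { 0≤S    = λ x → ≤-trans (0≤S D x) (S≤S′ x)
        ; 0≤R    = λ y → ≤-trans (0≤R D y) (R≤R′ y)
        ; extend = λ a b 0≤T 0≤Q → let a′ , b′ , le = extend D a b 0≤T 0≤Q in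
            a′ , b′ , ≤-trans (+-mono-≤ (potential-anti
                (λ x → 0≤T x ⊕ 0≤S D x) (λ x → +-mono-≤ ≤-refl (S≤S′ x))
                (λ y → 0≤Q y ⊕ 0≤R D y) (λ y → +-mono-≤ ≤-refl (R≤R′ y)))
              (≈⇒≤ (sym (correlate-cong V≈W)))) le
        }

      decomposition-0 : Decomposition (λ _ _ → 0#) (λ _ → 0#) (λ _ → 0#)
      decomposition-0 = record
        { 0≤S    = λ _ → ≤-refl
        ; 0≤R    = λ _ → ≤-refl
        ; extend = λ a b 0≤T 0≤Q → a , b , ≈⇒≤ (trans (+-cong
            (potential-cong (λ _ → +-identityʳ _) (λ _ → +-identityʳ _))
            (∑-zero Σ² (λ (x , y) → solve 2 (λ m s → m :* (s :* ` 0) := ` 0) refl (μ x y) (sign (f x y)))))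
            (+-identityʳ _))
        }

      decomposition-+ : ∀ {V W S S′ R R′} → Decomposition V S R → Decomposition W S′ R′ →
        Decomposition (λ x y → V x y + W x y) (λ x → S x + S′ x) (λ y → R y + R′ y)
      decomposition-+ {V} {W} {S} {S′} {R} {R′} D D′ = record
        { 0≤S    = λ x → 0≤S D x ⊕ 0≤S D′ x
        ; 0≤R    = λ y → 0≤R D y ⊕ 0≤R D′ y
        ; extend = ext
        }
        where
        ext : ∀ a b {T Q} → (∀ x → 0# ≤ T x) → (∀ y → 0# ≤ Q y) → ∃[ a′ ] ∃[ b′ ]
              (potential a b (λ x → T x + (S x + S′ x)) (λ y → Q y + (R y + R′ y)) +
               correlate (λ x y → V x y + W x y) ≤ potential a′ b′ T Q)
        ext a b {T} {Q} 0≤T 0≤Q =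
          -- The signs of `D` are chosen while the variance of `D′` is still outstanding; this is
          -- why `extend` admits arbitrary remainders `S′` and `R′`.
          let a₁ , b₁ , le₁ = extend D a b (λ x → 0≤T x ⊕ 0≤S D′ x) (λ y → 0≤Q y ⊕ 0≤R D′ y)
              a₂ , b₂ , le₂ = extend D′ a₁ b₁ 0≤T 0≤Q
          in a₂ , b₂ , (begin
            potential a b (λ x → T x + (S x + S′ x)) (λ y → Q y + (R y + R′ y)) + correlate
                (λ x y → V x y + W x y)
              ≈⟨ +-cong (potential-cong (λ x → rearrange (T x) (S x) (S′ x))
                  (λ y → rearrange (Q y) (R y) (R′ y)))
                        (correlate-+ V W) ⟩
            potential a b (λ x → T x + S′ x + S x) (λ y → Q y + R′ y + R y) + (correlate V + correlate W)
              ≈⟨ +-assoc _ _ _ ⟨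
            potential a b (λ x → T x + S′ x + S x) (λ y → Q y + R′ y + R y) + correlate V + correlate W
              ≤⟨ +-mono-≤ le₁ ≤-refl ⟩
            potential a₁ b₁ (λ x → T x + S′ x) (λ y → Q y + R′ y) + correlate W
              ≤⟨ le₂ ⟩
            potential a₂ b₂ T Q ∎)
          where
          open ≤-Reasoning
          rearrange : ∀ t s s′ → t + (s + s′) ≈ t + s′ + s
          rearrange = solve 3 (λ t s s′ → t :+ (s :+ s′) := t :+ s′ :+ s) refl

      -- One common sign moves `(a , b)` to `(a + u , b + v)` or `(a - u , b - v)`. In the average
      -- of the products the mixed terms cancel and `a b + u v` remains; the better of the two signs
      -- is at least as good as the average.
      decomposition-⊗ : ∀ (u : X → Carrier) (v : Y → Carrier) →
        Decomposition (λ x y → u x * v y) (λ x → u x * u x) (λ y → v y * v y)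
      decomposition-⊗ u v = record
        { 0≤S    = λ x → 0≤sq (u x)
        ; 0≤R    = λ y → 0≤sq (v y)
        ; extend = λ a b {T} {Q} _ _ → choose a b T Q
        }
        where
        module _ (a : X → Carrier) (b : Y → Carrier) (T : X → Carrier) (Q : Y → Carrier) where
          term : (X → Carrier) → (Y → Carrier) → (X → Carrier) → (Y → Carrier) → X → Y → Carrier
          term a b S R x y = sign (f x y) * (a x * b y) - κ * (quartic (a x) (S x) + quartic (b y) (R y))

          a₊ a₋ T′ : X → Carrier
          a₊ x = a x + u x
          a₋ x = a x - u x
          T′ x = T x + u x * u x

          b₊ b₋ Q′ : Y → Carrier
          b₊ y = b y + v y
          b₋ y = b y - v y
          Q′ y = Q y + v y * v y

          average plus minus : Carrier
          average = potential a b T′ Q′ + correlate (λ x y → u x * v y)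
          plus    = potential a₊ b₊ T Q
          minus   = potential a₋ b₋ T Q

          pointwise : ∀ x y → num 2 * (term a b T′ Q′ x y + sign (f x y) * (u x * v y))
                              ≤ term a₊ b₊ T Q x y + term a₋ b₋ T Q x y
          pointwise x y = lin
            (0≤κ ⊗ (0≤- (quartic-average (a x) (u x) (T x)) ⊕ 0≤- (quartic-average (b y) (v y) (Q y))))
            (solve 12 (λ s a u b v κ q q₊ q₋ r r₊ r₋ →
                (s :* ((a :+ u) :* (b :+ v)) :- κ :* (q₊ :+ r₊) :+
                    (s :* ((a :- u) :* (b :- v)) :- κ :* (q₋ :+ r₋)))
                :- ` 2 :* (s :* (a :* b) :- κ :* (q :+ r) :+ s :* (u :* v))
                := κ :* (` 2 :* q :- (q₊ :+ q₋) :+ (` 2 :* r :- (r₊ :+ r₋))))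
              refl (sign (f x y)) (a x) (u x) (b y) (v y) κ
              (quartic (a x) (T′ x)) (quartic (a₊ x) (T x)) (quartic (a₋ x) (T x))
              (quartic (b y) (Q′ y)) (quartic (b₊ y) (Q y)) (quartic (b₋ y) (Q y)))

          2average≤ : num 2 * average ≤ plus + minus
          2average≤ = begin
            num 2 * average
              ≈⟨ *-congˡ (∑²-+ _ _) ⟨
            num 2 * ∑² (λ x y → μ x y * term a b T′ Q′ x y + μ x y * (sign (f x y) * (u x * v y)))
              ≈⟨ ∑²-*ˡ (num 2) _ ⟨
            ∑² (λ x y → num 2 * (μ x y * term a b T′ Q′ x y + μ x y * (sign (f x y) * (u x * v y))))
              ≤⟨ ∑²-mono (λ x y → ≤-respˡ-≈
                   (solve 4 (λ m t p q → m :* (t :* (p :+ q)) := t :* (m :* p :+ m :* q))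
                     refl (μ x y) (num 2) _ _)
                   (≤-respʳ-≈ (distribˡ (μ x y) _ _) (*-monoˡ-≤ (0≤μ x y) (pointwise x y)))) ⟩
            ∑² (λ x y → μ x y * term a₊ b₊ T Q x y + μ x y * term a₋ b₋ T Q x y)
              ≈⟨ ∑²-+ _ _ ⟩
            plus + minus ∎
            where open ≤-Reasoning

          choose : ∃[ a′ ] ∃[ b′ ] (average ≤ potential a′ b′ T Q)
          choose with total minus plus
          ... | inj₁ m≤p = _ , _ , *-cancelˡ-≤ 0<2 (≤-trans 2average≤ (lin (0≤- m≤p)
                (solve 2 (λ m p → ` 2 :* p :- (p :+ m) := p :- m) refl minus plus)))
          ... | inj₂ p≤m = _ , _ , *-cancelˡ-≤ 0<2 (≤-trans 2average≤ (lin (0≤- p≤m)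
                (solve 2 (λ m p → ` 2 :* m :- (p :+ m) := m :- p) refl minus plus)))


-- The kernel `s ⊓ t` as a sum of products.

module MinKernel (em : ExcludedMiddle 0ℓ) (ℝ : RealNumbers) where

  open OrderedField em ℝ
  open Exponential em ℝ
  open RankOneSums em ℝ
  open MarginalInformation em ℝ using (∑ₘ)
  open import Algebra.Construct.NaturalChoice.Min totalOrder
    using (_⊓_; x⊓y≤x; x⊓y≤y; ⊓-glb)
  open import Data.List.Extrema totalOrder using (argmin; f[argmin]≤f[⊤]; f[argmin]≤f[xs]; argmin-sel)

  -- Cutting at c the functions s and t, where s has no value strictly between 0 and c,
  -- splits off the lower part of the kernel s ⊓ t as a product.
  ⊓-peel : ∀ {s t c j} → 0# ≤ t → 0# ≤ c → c * j ≈ 1# → s ≈ 0# ⊎ c ≤ s →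
           (s ⊓ c) * (t ⊓ c) * j + (s - s ⊓ c) ⊓ (t - t ⊓ c) ≈ s ⊓ t
  ⊓-peel {s} {t} {c} {j} 0≤t 0≤c cj≈1 (inj₁ s≈0) = begin
    (s ⊓ c) * (t ⊓ c) * j + (s - s ⊓ c) ⊓ (t - t ⊓ c)
      ≈⟨ +-cong (*-congʳ (*-congʳ s⊓c≈0)) (⊓-unique (≈⇒≤ (sym s-s⊓c≈0)) (0≤- (x⊓y≤x t c))
          (inj₁ (sym s-s⊓c≈0))) ⟩
    0# * (t ⊓ c) * j + 0#      ≈⟨ solve 2 (λ t j → ` 0 :* t :* j :+ ` 0 := ` 0) refl (t ⊓ c) j ⟩
    0#                         ≈⟨ ⊓-unique (≈⇒≤ (sym s≈0)) 0≤t (inj₁ (sym s≈0)) ⟨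
    s ⊓ t                      ∎
    where
    open import Relation.Binary.Reasoning.Setoid setoid
    s⊓c≈0 : s ⊓ c ≈ 0#
    s⊓c≈0 = ⊓-unique (≈⇒≤ (sym s≈0)) 0≤c (inj₁ (sym s≈0))
    s-s⊓c≈0 : s - s ⊓ c ≈ 0#
    s-s⊓c≈0 = trans (+-cong s≈0 (-‿cong s⊓c≈0)) (-‿inverseʳ 0#)
  ⊓-peel {s} {t} {c} {j} 0≤t 0≤c cj≈1 (inj₂ c≤s) = begin
    (s ⊓ c) * (t ⊓ c) * j + (s - s ⊓ c) ⊓ (t - t ⊓ c)
      ≈⟨ +-cong (trans (*-congʳ (*-congʳ s⊓c≈c)) (trans
          (solve 3 (λ c t j → c :* t :* j := c :* j :* t) refl c (t ⊓ c) j)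
           (trans (*-congʳ cj≈1) (*-identityˡ _)))) refl ⟩
    (t ⊓ c) + (s - s ⊓ c) ⊓ (t - t ⊓ c)
      ≈⟨ ⊓-unique
           (lin (0≤- (≤-trans (x⊓y≤x _ (t - t ⊓ c)) (≈⇒≤ (+-congˡ (-‿cong s⊓c≈c)))) ⊕ 0≤- (x⊓y≤y t c))
             (solve 4 (λ s c t m → s :- (t :+ m) := s :- c :- m :+ (c :- t)) refl s c (t ⊓ c) _))
           (lin (0≤- (x⊓y≤y (s - s ⊓ c) (t - t ⊓ c)))
             (solve 3 (λ t d m → t :- (d :+ m) := t :- d :- m) refl t (t ⊓ c) _))
           (attained (total t c) (total s t)) ⟨
    s ⊓ t ∎
    where
    open import Relation.Binary.Reasoning.Setoid setoid
    s⊓c≈c : s ⊓ c ≈ c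
    s⊓c≈c = ⊓-unique c≤s ≤-refl (inj₂ refl)
    attained : t ≤ c ⊎ c ≤ t → s ≤ t ⊎ t ≤ s →
      t ⊓ c + (s - s ⊓ c) ⊓ (t - t ⊓ c) ≈ s ⊎ t ⊓ c + (s - s ⊓ c) ⊓ (t - t ⊓ c) ≈ t
    attained (inj₁ t≤c) _ = inj₂ (trans (+-cong t⊓c≈t (⊓-unique (0≤- (x⊓y≤x s c)) (0≤- (x⊓y≤x t c))
        (inj₂ (sym (trans (+-congˡ (-‿cong t⊓c≈t)) (-‿inverseʳ t)))))) (+-identityʳ t))
      where
      t⊓c≈t : t ⊓ c ≈ t
      t⊓c≈t = ⊓-unique ≤-refl t≤c (inj₁ refl)
    attained (inj₂ c≤t) (inj₁ s≤t) = inj₁ (trans (+-cong t⊓c≈c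
        (⊓-unique (≈⇒≤ (+-congˡ (-‿cong (sym s⊓c≈c))))
        (≤-trans (+-mono-≤ s≤t ≤-refl) (≈⇒≤ (+-congˡ (-‿cong (sym t⊓c≈c)))))
            (inj₁ (+-congˡ (-‿cong (sym s⊓c≈c))))))
        (solve 2 (λ s c → c :+ (s :- c) := s) refl s c))
      where
      t⊓c≈c : t ⊓ c ≈ c
      t⊓c≈c = ⊓-unique c≤t ≤-refl (inj₂ refl)
    attained (inj₂ c≤t) (inj₂ t≤s) = inj₂ (trans (+-cong t⊓c≈c (⊓-unique
        (≤-trans (+-mono-≤ t≤s ≤-refl) (≈⇒≤ (+-congˡ (-‿cong (sym s⊓c≈c)))))
        (≈⇒≤ (+-congˡ (-‿cong (sym t⊓c≈c)))) (inj₂ (+-congˡ (-‿cong (sym t⊓c≈c))))))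
        (solve 2 (λ s c → c :+ (s :- c) := s) refl t c))
      where
      t⊓c≈c : t ⊓ c ≈ c
      t⊓c≈c = ⊓-unique c≤t ≤-refl (inj₂ refl)

  module _ {nX nY : ℕ} (μ : Fin nX → Fin nY → Carrier) (0≤μ : ∀ x y → 0# ≤ μ x y)
           (f : Fin nX → Fin nY → Bool) (κ : Carrier) (0≤κ : 0# ≤ κ) where

    open Correlation μ 0≤μ f
    open Potential κ 0≤κ
    open Decomposition

    private
      X = Fin nX
      Y = Fin nY

    decomposition-∑ : ∀ {n} {W : Fin n → X → Y → Carrier} {S : Fin n → X → Carrier}
        {R : Fin n → Y → Carrier} →
      (∀ i → Decomposition (W i) (S i) (R i)) →
      Decomposition (λ x y → ∑[ i < n ] W i x y) (λ x → ∑[ i < n ] S i x) (λ y → ∑[ i < n ] R i y)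
    decomposition-∑ {zero}  D = decomposition-0
    decomposition-∑ {suc n} {W} {S} {R} D = decomposition-+ (D zero)
      (decomposition-∑ {n} {λ i → W (suc i)} {λ i → S (suc i)} {λ i → R (suc i)} (λ i → D (suc i)))

    decomposition-∑ₘ : ∀ {ss} {W : Messages ss → X → Y → Carrier}
      {S : Messages ss → X → Carrier} {R : Messages ss → Y → Carrier} →
      (∀ m → Decomposition (W m) (S m) (R m)) →
      Decomposition (λ x y → ∑ₘ (λ m → W m x y)) (λ x → ∑ₘ (λ m → S m x)) (λ y → ∑ₘ (λ m → R m y))
    decomposition-∑ₘ {[]}     D = D []
    decomposition-∑ₘ {s ∷ ss} {W} {S} {R} D = decomposition-∑
      {s} {λ a x y → ∑ₘ {ss} (λ m → W (a ∷ m) x y)} {λ a x → ∑ₘ {ss} (λ m → S (a ∷ m) x)}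
          {λ a y → ∑ₘ {ss} (λ m → R (a ∷ m) y)}
      (λ a → decomposition-∑ₘ {ss} {λ m → W (a ∷ m)} {λ m → S (a ∷ m)} {λ m → R (a ∷ m)} (λ m → D (a ∷ m)))

    module _ (u : X → Carrier) (v : Y → Carrier) where

      private

        -- Here `i` is a square root of `1 / c`. As `s ⊓ c ≤ c`, the square of the piece split off
        -- is at most `w² (s ⊓ c)`, just the length that is freed when `s` is lowered by `s ⊓ c`.
        square≤ : ∀ {s c i} → 0# ≤ s → 0# < c → c * (i * i) ≈ 1# → ∀ w →
                  w * (s ⊓ c) * i * (w * (s ⊓ c) * i) + w * w * (s - s ⊓ c) ≤ w * w * s
        square≤ {s} {c} {i} 0≤s 0<c ci²≈1 w = lin (0≤sq w ⊗ 0≤- p≤)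
          (solve 4 (λ w p i s → w :* w :* s :- (w :* p :* i :* (w :* p :* i) :+ w :* w :* (s :- p))
             := w :* w :* (p :- p :* p :* (i :* i))) refl w p i s)
          where
          p = s ⊓ c
          0≤p : 0# ≤ p
          0≤p = ⊓-glb 0≤s (proj₁ 0<c)
          p≤ : p * p * (i * i) ≤ p
          p≤ = ≤-trans (*-monoʳ-≤ (0≤sq i) (*-monoˡ-≤ 0≤p (x⊓y≤y s c)))
            (≈⇒≤ (trans (*-assoc p c (i * i)) (trans (*-congˡ ci²≈1) (*-identityʳ p))))

        factor : ∀ u v p q i m → u * p * i * (v * q * i) + u * v * m ≈ u * v * (p * q * (i * i) + m)
        factor = solve 6 (λ u v p q i m →
          u :* p :* i :* (v :* q :* i) :+ u :* v :* m := u :* v :* (p :* q :* (i :* i) :+ m)) refl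

        MinDecomposition : (X → Carrier) → (Y → Carrier) → Set
        MinDecomposition s t = Decomposition
          (λ x y → u x * v y * (s x ⊓ t y)) (λ x → u x * u x * s x) (λ y → v y * v y * t y)

        peel : ∀ {s : X → Carrier} {t : Y → Carrier} c → (∀ x → 0# ≤ s x) → (∀ y → 0# ≤ t y) → 0# < c →
          (∀ x → s x ≈ 0# ⊎ c ≤ s x) → MinDecomposition (λ x → s x - s x ⊓ c) (λ y → t y - t y ⊓ c) →
          MinDecomposition s t
        peel {s} {t} c 0≤s 0≤t 0<c gap D = go (sqrt (0<⁻¹ 0<c))
          where
          go : ∃[ i ] (0# < i × i * i ≈ c ⁻¹) → MinDecomposition s t
          go (i , _ , i²≈1/c) = decomposition-weaken
            (λ x y → trans (factor (u x) (v y) (s x ⊓ c) (t y ⊓ c) i ((s x - s x ⊓ c) ⊓ (t y - t y ⊓ c)))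
                       (*-congˡ (⊓-peel (0≤t y) (proj₁ 0<c) ci²≈1 (gap x))))
            (λ x → square≤ (0≤s x) 0<c ci²≈1 (u x))
            (λ y → square≤ (0≤t y) 0<c ci²≈1 (v y))
            (decomposition-+ (decomposition-⊗ (λ x → u x * (s x ⊓ c) * i) (λ y → v y * (t y ⊓ c) * i)) D)
            where
            ci²≈1 : c * (i * i) ≈ 1#
            ci²≈1 = trans (*-congˡ i²≈1/c) (⁻¹-inverseʳ (0<⇒≉ 0<c))

        -- Induction on the size of the support of `s`, which `l` lists. Cutting at the least
        -- positive value of `s` meets the gap condition of `peel` and removes the minimiser from
        -- the support. The bound `n` is there because the filtered list is not a sublist by
        -- structure.
        kernel : ∀ n (l : List X) → length l ℕ.≤ n → ∀ {s : X → Carrier} {t : Y → Carrier} →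
            (∀ x → 0# ≤ s x) → (∀ y → 0# ≤ t y) →
          All (λ x → 0# < s x) l → (∀ x → 0# < s x → x ∈ l) → MinDecomposition s t
        kernel n [] _ {s} {t} 0≤s 0≤t _ ∈l = decomposition-weaken
          (λ x y → sym (trans (*-congˡ (⊓-unique (≈⇒≤ (sym (s≈0 x))) (0≤t y) (inj₁ (sym (s≈0 x)))))
              (zeroʳ _)))
          (λ x → 0≤sq (u x) ⊗ 0≤s x) (λ y → 0≤sq (v y) ⊗ 0≤t y) decomposition-0
          where
          s≈0 : ∀ x → s x ≈ 0#
          s≈0 x with ≈0? (s x)
          ... | inj₁ eq = eq
          ... | inj₂ ne with ∈l x (0≤∧≉⇒0< (0≤s x) ne)
          ...   | ()
        kernel (suc n) l@(x₁ ∷ xs) len {s} {t} 0≤s 0≤t pos ∈l = peel c 0≤s 0≤t 0<c gap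
          (kernel n (filter 0<s′? l) (ℕ.≤-pred (ℕ.≤-trans shorter len))
            (λ x → 0≤- (x⊓y≤x (s x) c)) (λ y → 0≤- (x⊓y≤x (t y) c)) (all-filter 0<s′? l)
            (λ x 0<s′ → ∈-filter⁺ 0<s′? (∈l x (<-≤-trans 0<s′ (s′≤s x))) 0<s′))
          where
          x₀ = argmin s x₁ xs
          c  = s x₀

          x₀∈l : x₀ ∈ l
          x₀∈l with argmin-sel s x₁ xs
          ... | inj₁ eq = here eq
          ... | inj₂ x₀∈xs = there x₀∈xs

          0<c : 0# < c
          0<c = All.lookup pos x₀∈l

          c≤ : All (λ x → c ≤ s x) l
          c≤ = f[argmin]≤f[⊤] {f = s} x₁ xs ∷ f[argmin]≤f[xs] {f = s} x₁ xs

          gap : ∀ x → s x ≈ 0# ⊎ c ≤ s x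
          gap x with ≈0? (s x)
          ... | inj₁ eq = inj₁ eq
          ... | inj₂ ne = inj₂ (All.lookup c≤ (∈l x (0≤∧≉⇒0< (0≤s x) ne)))

          s′ : X → Carrier
          s′ x = s x - s x ⊓ c

          s′≤s : ∀ x → s′ x ≤ s x
          s′≤s x = lin (⊓-glb (0≤s x) (proj₁ 0<c))
              (solve 2 (λ s p → s :- (s :- p) := p) refl (s x) (s x ⊓ c))

          0<s′? : Decidable (λ x → 0# < s′ x)
          0<s′? x = em

          shorter : length (filter 0<s′? l) ℕ.< length l
          shorter = filter-notAll 0<s′? l (lose x₀∈l λ 0<s′ → proj₂ 0<s′
            (sym (trans (+-congˡ (-‿cong (⊓-unique ≤-refl ≤-refl (inj₁ refl)))) (-‿inverseʳ c))))

      -- A discrete form of `s ⊓ t = ∫ 1[c ≤ s] 1[c ≤ t] dc`. The squares of the two families of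
      -- indicators integrate to `s` and `t`, whence the squared lengths.
      decomposition-⊓ : ∀ {s : X → Carrier} {t : Y → Carrier} → (∀ x → 0# ≤ s x) → (∀ y → 0# ≤ t y) →
        Decomposition (λ x y → u x * v y * (s x ⊓ t y)) (λ x → u x * u x * s x) (λ y → v y * v y * t y)
      decomposition-⊓ {s} 0≤s 0≤t = kernel _ (filter 0<s? (allFin nX)) ℕ.≤-refl 0≤s 0≤t
        (all-filter 0<s? (allFin nX)) (λ x 0<s → ∈-filter⁺ 0<s? (∈-allFin x) 0<s)
        where
        0<s? : Decidable (λ x → 0# < s x)
        0<s? x = em


-- Clipping and rounding to signs.

module Rounding (em : ExcludedMiddle 0ℓ) (ℝ : RealNumbers) where

  open OrderedField em ℝ
  open Summations em ℝ
  open RankOneSums em ℝ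

  Within : Carrier → Carrier → Set
  Within M a = - M ≤ a × a ≤ M

  -- Clipping is expressed by a factor in [0 , 1], so that a product of clipped values is a fraction
  -- of the original product. The last component keeps the reason for a factor other than 1.
  clip : ∀ {M} → 0# < M → ∀ a → ∃[ θ ] (0# ≤ θ × θ ≤ 1# × Within M (θ * a) × (θ ≈ 1# ⊎ M * M ≤ a * a))
  clip {M} 0<M a with ≤-<-connex a M | ≤-<-connex (- a) M
  ... | inj₁ a≤M | inj₁ -a≤M = 1# , 0≤1 , ≤-refl ,
    (lin (0≤- -a≤M) (solve 2 (λ a M → ` 1 :* a :- :- M := M :- :- a) refl a M) ,
     lin (0≤- a≤M) (solve 2 (λ a M → M :- ` 1 :* a := M :- a) refl a M)) , inj₁ refl
  ... | inj₂ M<a | _ = M / a , proj₁ 0<M ⊗ 0≤⁻¹ (proj₁ 0<a) ,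
      /-≤ 0<a (≤-respʳ-≈ (sym (*-identityˡ a)) (proj₁ M<a)) ,
      (≤-respʳ-≈ (sym eq) (lin (proj₁ 0<M ⊕ proj₁ 0<M) (solve 1 (λ M → M :- :- M := M :+ M) refl M)) ,
          ≈⇒≤ eq) ,
      inj₂ (*-mono-≤ (proj₁ 0<M) (proj₁ M<a) (proj₁ 0<M) (proj₁ M<a))
    where
    0<a : 0# < a
    0<a = ≤-<-trans (proj₁ 0<M) M<a
    eq : M / a * a ≈ M
    eq = /-*-cancel (0<⇒≉ 0<a)
  ... | inj₁ _ | inj₂ M<-a = M / (- a) , proj₁ 0<M ⊗ 0≤⁻¹ (proj₁ 0<-a) ,
      /-≤ 0<-a (≤-respʳ-≈ (sym (*-identityˡ (- a))) (proj₁ M<-a)) ,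
      (≈⇒≤ (sym eq) , ≤-respˡ-≈ (sym eq) (lin (proj₁ 0<M ⊕ proj₁ 0<M)
          (solve 1 (λ M → M :- :- M := M :+ M) refl M))) ,
      inj₂ (≤-respʳ-≈ (solve 1 (λ a → (:- a) :* (:- a) := a :* a) refl a)
        (*-mono-≤ (proj₁ 0<M) (proj₁ M<-a) (proj₁ 0<M) (proj₁ M<-a)))
    where
    0<-a : 0# < - a
    0<-a = ≤-<-trans (proj₁ 0<M) M<-a
    eq : M / (- a) * a ≈ - M
    eq = trans (solve 2 (λ q a → q :* a := :- (q :* (:- a))) refl (M / (- a)) a)
        (-‿cong (/-*-cancel (0<⇒≉ 0<-a)))

  2ab≤a²+b² : ∀ c a b → num 2 * (sign c * (a * b)) ≤ a * a + b * b
  2ab≤a²+b² false a b = lin (0≤sq (a - b))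
    (solve 2 (λ a b → a :* a :+ b :* b :- ` 2 :* (` 1 :* (a :* b)) := (a :- b) :* (a :- b)) refl a b)
  2ab≤a²+b² true  a b = lin (0≤sq (a + b))
    (solve 2 (λ a b → a :* a :+ b :* b :- ` 2 :* ((:- ` 1) :* (a :* b)) := (a :+ b) :* (a :+ b)) refl a b)

  -- If neither factor is clipped, only nonnegative terms are dropped. Otherwise `N ≤ a² + b²`, and
  -- then `κ (a⁴ + b⁴) ≥ κ (a² + b²)² / 2 ≥ (a² + b²) / 2 ≥ ∣ a b ∣` pays for the entire product.
  clip-loss : ∀ {κ N} → 0# ≤ κ → κ * N ≈ 1# → ∀ c a b {θ φ} → 0# ≤ θ → θ ≤ 1# → 0# ≤ φ → φ ≤ 1# →
    θ ≈ 1# ⊎ N ≤ a * a → φ ≈ 1# ⊎ N ≤ b * b →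
    sign c * (a * b) - κ * (quartic a 0# + quartic b 0#) ≤ sign c * (θ * a * (φ * b))
  clip-loss {κ} {N} 0≤κ κN≈1 c a b {θ} {φ} 0≤θ θ≤1 0≤φ φ≤1 θ-case φ-case = begin
    p - κ * (quartic a 0# + quartic b 0#)   ≈⟨ solve 4 (λ p κ a b →
                                                 let Q = λ a → a :* a :* (a :* a) :+ (` 6 :* (a :* a :* ` 0) :+ ` 3 :* (` 0 :* ` 0))
                                                 in p :- κ :* (Q a :+ Q b) := p :- κ :*
                                                     (a :* a :* (a :* a) :+ b :* b :* (b :* b)))
                                                 refl p κ a b ⟩
    p - κ * (A * A + B * B)                 ≤⟨ loss θ-case φ-case ⟩
    θ * φ * p                               ≈⟨ solve 5
        (λ θ φ s a b → θ :* φ :* (s :* (a :* b)) := s :* (θ :* a :* (φ :* b)))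
                                                 refl θ φ (sign c) a b ⟩
    sign c * (θ * a * (φ * b))              ∎
    where
    open ≤-Reasoning
    A B p K z : Carrier
    A = a * a
    B = b * b
    p = sign c * (a * b)
    K = κ * (A * A + B * B)
    z = θ * φ
    z≤1 : z ≤ 1#
    z≤1 = ≤-respʳ-≈ (*-identityʳ 1#) (*-mono-≤ 0≤θ θ≤1 0≤φ φ≤1)
    large : N ≤ A + B → p - K ≤ z * p
    large N≤A+B = *-cancelˡ-≤ 0<2 (lin
      (0≤- z≤1 ⊗ 0≤- (2ab≤a²+b² c a b) ⊕ (0≤θ ⊗ 0≤φ) ⊗ (0≤sq a ⊕ 0≤sq b) ⊕ 0≤- A+B≤2K)
      (solve 5 (λ p K z A B → ` 2 :* (z :* p) :- ` 2 :* (p :- K)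
         := (` 1 :- z) :* (A :+ B :- ` 2 :* p) :+ z :* (A :+ B) :+ (` 2 :* K :- (A :+ B))) refl p K z A B))
      where
      A+B≤2K : A + B ≤ num 2 * K
      A+B≤2K = ≤-respˡ-≈ (trans (*-congʳ κN≈1) (*-identityˡ (A + B)))
        (lin (0≤κ ⊗ (0≤sq (A - B) ⊕ (0≤sq a ⊕ 0≤sq b) ⊗ 0≤- N≤A+B))
          (solve 4 (λ κ N A B → ` 2 :* (κ :* (A :* A :+ B :* B)) :- κ :* N :* (A :+ B)
            := κ :* ((A :- B) :* (A :- B) :+ (A :+ B) :* (A :+ B :- N))) refl κ N A B))
    loss : θ ≈ 1# ⊎ N ≤ A → φ ≈ 1# ⊎ N ≤ B → p - K ≤ z * p
    loss (inj₂ N≤A) _          = large (≤-trans N≤A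
        (lin (0≤sq b) (solve 2 (λ A B → A :+ B :- A := B) refl A B)))
    loss (inj₁ _)   (inj₂ N≤B) = large (≤-trans N≤B
        (lin (0≤sq a) (solve 2 (λ A B → A :+ B :- B := A) refl A B)))
    loss (inj₁ θ≈1) (inj₁ φ≈1) = lin (0≤κ ⊗ (0≤sq A ⊕ 0≤sq B))
      (trans (+-congʳ (trans (*-congʳ (trans (*-cong θ≈1 φ≈1) (*-identityˡ 1#))) (*-identityˡ p)))
        (solve 2 (λ p K → p :- (p :- K) := K) refl p K))

  -- A linear form on a cube is largest at a vertex, and the signs of the coefficients alone
  -- determine which one.
  extremal-signs : ∀ {n} (v : Fin n → Carrier) → ∃[ σ ]
      (∀ {M} {w : Fin n → Carrier} → (∀ i → Within M (w i)) →
    ∑[ i < n ] (w i * v i) ≤ M * (∑[ i < n ] (sign (σ i) * v i)))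
  extremal-signs {n} v = (λ i → proj₁ (best i)) , λ {M} {w} within →
    ≤-respʳ-≈ (∑-*ˡ (∑ᶠ {n}) M _) (∑-mono (∑ᶠ {n}) (λ i → proj₂ (best i) (within i)))
    where
    best : ∀ i → ∃[ σ ] (∀ {M w} → Within M w → w * v i ≤ M * (sign σ * v i))
    best i with total 0# (v i)
    ... | inj₁ 0≤v = false , λ {M} {w} (_ , w≤M) → lin (0≤- w≤M ⊗ 0≤v)
          (solve 3 (λ M w v → M :* (` 1 :* v) :- w :* v := (M :- w) :* v) refl M w (v i))
    ... | inj₂ v≤0 = true , λ {M} {w} (-M≤w , _) → lin (0≤- -M≤w ⊗ 0≤- v≤0)
          (solve 3 (λ M w v → M :* ((:- ` 1) :* v) :- w :* v := (w :- :- M) :* (` 0 :- v)) refl M w (v i))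

  module _ {nX nY : ℕ} (μ : Fin nX → Fin nY → Carrier) (0≤μ : ∀ x y → 0# ≤ μ x y)
           (f : Fin nX → Fin nY → Bool) where

    open Correlation μ 0≤μ f

    RoundedTo : Carrier → Carrier → Set
    RoundedTo M c = Σ (Fin nX → Bool) λ σ → Σ (Fin nY → Bool) λ τ →
      c ≤ M * M * correlate (λ x y → sign (σ x) * sign (τ y))

    -- The form is linear in either argument: `a` is rounded with `b` held fixed, and then `b` with
    -- the signs that replace `a` held fixed. Each rounding contributes one factor `M`.
    round-bilinear : ∀ {M} {a : Fin nX → Carrier} {b : Fin nY → Carrier} → 0# ≤ M →
      (∀ x → Within M (a x)) → (∀ y → Within M (b y)) → RoundedTo M (correlate (λ x y → a x * b y))
    round-bilinear {M} {a} {b} 0≤M a≤M b≤M = σ , τ , (begin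
      correlate (λ x y → a x * b y)                       ≈⟨ by-rows a b ⟩
      ∑[ x < nX ] (a x * row x)                           ≤⟨ proj₂ σ-signs a≤M ⟩
      M * (∑[ x < nX ] (sign (σ x) * row x))
          ≈⟨ *-congˡ (trans (sym (by-rows (λ x → sign (σ x)) b)) (by-columns b)) ⟩
      M * (∑[ y < nY ] (b y * column y))                  ≤⟨ *-monoˡ-≤ 0≤M (proj₂ τ-signs b≤M) ⟩
      M * (M * (∑[ y < nY ] (sign (τ y) * column y)))
          ≈⟨ *-congˡ (*-congˡ (by-columns (λ y → sign (τ y)))) ⟨
      M * (M * correlate (λ x y → sign (σ x) * sign (τ y))) ≈⟨ *-assoc M M _ ⟨
      M * M * correlate (λ x y → sign (σ x) * sign (τ y)) ∎)
      where
      open ≤-Reasoning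
      row : Fin nX → Carrier
      row x = ∑[ y < nY ] (μ x y * (sign (f x y) * b y))
      σ-signs = extremal-signs row
      σ = proj₁ σ-signs
      column : Fin nY → Carrier
      column y = ∑[ x < nX ] (μ x y * (sign (f x y) * sign (σ x)))
      τ-signs = extremal-signs column
      τ = proj₁ τ-signs
      by-rows : ∀ (a : Fin nX → Carrier) (b : Fin nY → Carrier) →
        correlate (λ x y → a x * b y) ≈ ∑[ x < nX ] (a x * (∑[ y < nY ] (μ x y * (sign (f x y) * b y))))
      by-rows a b = ∑-cong ∑ᶠ (λ x → trans
        (∑-cong ∑ᶠ (λ y → solve 4 (λ m s a b → m :* (s :* (a :* b)) := a :* (m :* (s :* b))) refl (μ x y)
            (sign (f x y)) (a x) (b y)))
        (∑-*ˡ (∑ᶠ {nY}) (a x) _))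
      by-columns : ∀ (b : Fin nY → Carrier) →
        correlate (λ x y → sign (σ x) * b y) ≈ ∑[ y < nY ] (b y * column y)
      by-columns b = trans (∑-swap (∑ᶠ {nX}) nY (λ x y → μ x y * (sign (f x y) * (sign (σ x) * b y))))
          (∑-cong ∑ᶠ (λ y → trans
        (∑-cong ∑ᶠ (λ x → solve 4 (λ m s a b → m :* (s :* (a :* b)) := b :* (m :* (s :* a))) refl (μ x y)
            (sign (f x y)) (sign (σ x)) (b y)))
        (∑-*ˡ (∑ᶠ {nX}) (b y) _)))

    module _ (κ : Carrier) (0≤κ : 0# ≤ κ) where

      open Potential κ 0≤κ
      open Decomposition

      -- The choice of signs starts at `a = b = 0` with all the variance outstanding, where each of
      -- the two quartic terms is at most `3 L²`; this is the loss `6 κ L²`. Once no variance is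
      -- left, the remaining penalty covers the clipping at `M`.
      round-decomposition : ∀ {W} {S : Fin nX → Carrier} {R : Fin nY → Carrier} {L M} →
          Decomposition W S R → (∀ x → S x ≤ L) → (∀ y → R y ≤ L) →
        ∑² μ ≤ 1# → 0# < M → κ * (M * M) ≈ 1# →
        RoundedTo M (correlate W - κ * (num 6 * (L * L)))
      round-decomposition {W} {S} {R} {L} {M} D S≤L R≤L ∑μ≤1 0<M κM²≈1
        with extend D (λ _ → 0#) (λ _ → 0#) {λ _ → 0#} {λ _ → 0#} (λ _ → ≤-refl) (λ _ → ≤-refl)
      ... | a , b , le = proj₁ signs , proj₁ (proj₂ signs) , (begin
        correlate W - E                            ≤⟨ lin (0≤- initial ⊕ 0≤- le)
                                                        (solve 4 (λ w e p q → q :- (w :- e)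
                                                            := p :- :- e :+ (q :- (p :+ w)))
                                                          refl (correlate W) E _ (potential a b (λ _ → 0#)
                                                              (λ _ → 0#))) ⟩
        potential a b (λ _ → 0#) (λ _ → 0#)        ≤⟨ ∑²-mono (λ x y → *-monoˡ-≤ (0≤μ x y)
                                                        (clip-loss 0≤κ κM²≈1 (f x y) (a x) (b y)
                                                          (nonneg (a x)) (≤one (a x)) (nonneg (b y))
                                                              (≤one (b y)) (unclipped (a x))
                                                                  (unclipped (b y)))) ⟩
        correlate (λ x y → clipped (a x) * clipped (b y))  ≤⟨ proj₂ (proj₂ signs) ⟩
        M * M * correlate (λ x y → sign (proj₁ signs x) * sign (proj₁ (proj₂ signs) y)) ∎)
        where
        open ≤-Reasoning
        E = κ * (num 6 * (L * L))

        θ : Carrier → Carrier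
        θ a = proj₁ (clip 0<M a)
        clipped : Carrier → Carrier
        clipped a = θ a * a
        nonneg : ∀ a → 0# ≤ θ a
        nonneg a = proj₁ (proj₂ (clip 0<M a))
        ≤one : ∀ a → θ a ≤ 1#
        ≤one a = proj₁ (proj₂ (proj₂ (clip 0<M a)))
        within : ∀ a → Within M (clipped a)
        within a = proj₁ (proj₂ (proj₂ (proj₂ (clip 0<M a))))
        unclipped : ∀ a → θ a ≈ 1# ⊎ M * M ≤ a * a
        unclipped a = proj₂ (proj₂ (proj₂ (proj₂ (clip 0<M a))))

        signs : RoundedTo M (correlate (λ x y → clipped (a x) * clipped (b y)))
        signs = round-bilinear {M} {λ x → clipped (a x)} {λ y → clipped (b y)}
                  (proj₁ 0<M) (λ x → within (a x)) (λ y → within (b y))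

        quartic≤ : ∀ {S} → 0# ≤ S → S ≤ L → quartic 0# (0# + S) ≤ num 3 * (L * L)
        quartic≤ {S} 0≤S S≤L = ≤-trans (quartic-mono (≤-respʳ-≈ (sym (+-identityˡ S)) 0≤S)
            (≤-respˡ-≈ (sym (+-identityˡ S)) S≤L))
          (≈⇒≤ (solve 1 (λ L → ` 0 :* ` 0 :* (` 0 :* ` 0) :+ (` 6 :* (` 0 :* ` 0 :* L) :+ ` 3 :* (L :* L))
              := ` 3 :* (L :* L)) refl L))

        initial : - E ≤ potential (λ _ → 0#) (λ _ → 0#) (λ x → 0# + S x) (λ y → 0# + R y)
        initial = begin
          - E                            ≤⟨ lin ((0≤κ ⊗ (0≤num 6 ⊗ 0≤sq L)) ⊗ 0≤- ∑μ≤1)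
                                              (solve 2 (λ E m → (:- E) :* m :- :- E := E :* (` 1 :- m))
                                                  refl E (∑² μ)) ⟩
          - E * ∑² μ                     ≈⟨ ∑²-*ˡ (- E) μ ⟨
          ∑² (λ x y → - E * μ x y)       ≤⟨ ∑²-mono (λ x y → lin
                                              (0≤μ x y ⊗ (0≤κ ⊗ (0≤- (quartic≤ (0≤S D x) (S≤L x)) ⊕ 0≤-
                                                  (quartic≤ (0≤R D y) (R≤L y)))))
                                              (solve 6 (λ m s κ q r L → m :*
                                                  (s :* (` 0 :* ` 0) :- κ :* (q :+ r)) :-
                                                      (:- (κ :* (` 6 :* (L :* L)))) :* m
                                                  := m :* (κ :* (` 3 :* (L :* L) :- q :+
                                                      (` 3 :* (L :* L) :- r))))
                                                refl (μ x y) (sign (f x y)) κ _ _ L)) ⟩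
          potential (λ _ → 0#) (λ _ → 0#) (λ x → 0# + S x) (λ y → 0# + R y) ∎


-- Truncation of a product `A ⊗ B` into short vectors.

module ProductKernel (em : ExcludedMiddle 0ℓ) (ℝ : RealNumbers) where

  open OrderedField em ℝ
  open RankOneSums em ℝ
  open MinKernel em ℝ
  open import Algebra.Construct.NaturalChoice.Min totalOrder using (_⊓_; x⊓y≤y; ⊓-glb)

  -- As an inequality the cancellation survives `x = 0`, where the left side is 0. Upper bounds on
  -- lengths can thus ignore vanishing denominators.
  *-/-≤ : ∀ {x y} → 0# ≤ y → x * (y / x) ≤ y
  *-/-≤ {x} {y} 0≤y with ≈0? x
  ... | inj₁ x≈0 = ≤-respˡ-≈ (sym (trans (*-congʳ x≈0) (zeroˡ _))) 0≤y
  ... | inj₂ x≉0 = ≈⇒≤ (trans (*-comm _ _) (/-*-cancel x≉0))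

  *-⁻¹-≤1 : ∀ x → x * x ⁻¹ ≤ 1#
  *-⁻¹-≤1 x = ≤-respˡ-≈ (*-congˡ (*-identityˡ _)) (*-/-≤ 0≤1)

  sign² : ∀ b → sign b * sign b ≈ 1#
  sign² false = *-identityˡ 1#
  sign² true  = solve 0 ((:- ` 1) :* (:- ` 1) := ` 1) refl

  module _ {nX nY : ℕ} (μ : Fin nX → Fin nY → Carrier) (0≤μ : ∀ x y → 0# ≤ μ x y)
           (f : Fin nX → Fin nY → Bool) (κ : Carrier) (0≤κ : 0# ≤ κ) where

    open Correlation μ 0≤μ f
    open Potential κ 0≤κ

    -- The factor min 1 (g h / (A B)²) of A ⊗ B makes the vectors short, and is 1 where A B ≤ √(g h).
    module TruncatedProduct
      {A : Fin nX → Carrier} {B : Fin nY → Carrier} {g : Fin nX → Carrier} {h : Fin nY → Carrier}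
      (0≤A : ∀ x → 0# ≤ A x) (0≤B : ∀ y → 0# ≤ B y) (0≤g : ∀ x → 0# ≤ g x) (0≤h : ∀ y → 0# ≤ h y) where

      private
        s : Fin nX → Carrier
        s x = g x / (A x * A x)

        t : Fin nY → Carrier
        t y = B y * B y / h y

        0≤s : ∀ x → 0# ≤ s x
        0≤s x = 0≤g x ⊗ 0≤⁻¹ (0≤sq (A x))

        0≤t : ∀ y → 0# ≤ t y
        0≤t y = 0≤sq (B y) ⊗ 0≤⁻¹ (0≤h y)

      -- For nonzero denominators this is `A B` where `t ≤ s` and `g h / (A B)` where `s ≤ t`. The
      -- splitting into `A` and `h / B` is chosen so that the squared lengths become `A² s = g` and
      -- `(h / B)² t = h`.
      truncated : Fin nX → Fin nY → Carrier
      truncated x y = A x * (h y / B y) * (s x ⊓ t y)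

      private
        ht/B : ∀ y → h y / B y * t y ≤ B y
        ht/B y = begin
          h y / B y * t y              ≈⟨ solve 3 (λ h i t → h :* i :* t := h :* t :* i) refl (h y)
              (B y ⁻¹) (t y) ⟩
          h y * t y * B y ⁻¹           ≤⟨ *-monoʳ-≤ (0≤⁻¹ (0≤B y)) (*-/-≤ (0≤sq (B y))) ⟩
          B y * B y * B y ⁻¹           ≈⟨ *-assoc _ _ _ ⟩
          B y * (B y / B y)            ≤⟨ *-/-≤ (0≤B y) ⟩
          B y                          ∎
          where open ≤-Reasoning

      0≤truncated : ∀ x y → 0# ≤ truncated x y
      0≤truncated x y = 0≤A x ⊗ (0≤h y ⊗ 0≤⁻¹ (0≤B y)) ⊗ ⊓-glb (0≤s x) (0≤t y)

      truncated≤ : ∀ x y → truncated x y ≤ A x * B y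
      truncated≤ x y = begin
        A x * (h y / B y) * (s x ⊓ t y)   ≤⟨ *-monoˡ-≤ (0≤A x ⊗ (0≤h y ⊗ 0≤⁻¹ (0≤B y)))
            (x⊓y≤y (s x) (t y)) ⟩
        A x * (h y / B y) * t y           ≈⟨ *-assoc _ _ _ ⟩
        A x * (h y / B y * t y)           ≤⟨ *-monoˡ-≤ (0≤A x) (ht/B y) ⟩
        A x * B y                         ∎
        where open ≤-Reasoning

      truncated≈ : ∀ {x y} → A x * B y * (A x * B y) ≤ g x * h y → truncated x y ≈ A x * B y
      truncated≈ {x} {y} AB²≤gh with ≈0? (A x * B y)
      ... | inj₁ AB≈0 = antisym (truncated≤ x y) (≤-respˡ-≈ (sym AB≈0) (0≤truncated x y))
      ... | inj₂ AB≉0 = begin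
        A x * (h y / B y) * (s x ⊓ t y)   ≈⟨ *-congˡ (⊓-unique t≤s ≤-refl (inj₂ refl)) ⟩
        A x * (h y / B y) * t y           ≈⟨ solve 5
            (λ a h i b j → a :* (h :* i) :* (b :* b :* j) := a :* b :* (b :* i) :* (h :* j))
                                               refl (A x) (h y) (B y ⁻¹) (B y) (h y ⁻¹) ⟩
        A x * B y * (B y / B y) * (h y / h y) ≈⟨ *-cong (*-congˡ (⁻¹-inverseʳ B≉0)) (⁻¹-inverseʳ h≉0) ⟩
        A x * B y * 1# * 1#               ≈⟨ trans (*-identityʳ _) (*-identityʳ _) ⟩
        A x * B y                         ∎
        where
        open import Relation.Binary.Reasoning.Setoid setoid
        A≉0 : ¬ (A x ≈ 0#)
        A≉0 A≈0 = AB≉0 (trans (*-congʳ A≈0) (zeroˡ _))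
        B≉0 : ¬ (B y ≈ 0#)
        B≉0 B≈0 = AB≉0 (trans (*-congˡ B≈0) (zeroʳ _))
        h≉0 : ¬ (h y ≈ 0#)
        h≉0 h≈0 = *-≉0 AB≉0 AB≉0 (antisym (≤-respʳ-≈ (trans (*-congˡ h≈0) (zeroʳ _)) AB²≤gh) (0≤sq _))
        A²≉0 : ¬ (A x * A x ≈ 0#)
        A²≉0 = *-≉0 A≉0 A≉0
        t≤s : t y ≤ s x
        t≤s = /-≤ (0≤∧≉⇒0< (0≤h y) h≉0) (*-cancelˡ-≤ (0≤∧≉⇒0< (0≤sq (A x)) A²≉0)
          (≤-respˡ-≈ (solve 2 (λ a b → a :* b :* (a :* b) := a :* a :* (b :* b)) refl (A x) (B y))
            (≤-respʳ-≈ (trans (*-congʳ (sym (/-*-cancel A²≉0)))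
              (solve 3 (λ r a h → r :* a :* h := a :* (r :* h)) refl (s x) (A x * A x) (h y))) AB²≤gh)))

      decomposition-truncated : ∀ σ → Decomposition (λ x y → sign σ * truncated x y) g h
      decomposition-truncated σ = decomposition-weaken
        (λ x y → solve 5 (λ a c h i m → a :* (c :* (h :* i)) :* m := c :* (a :* (h :* i) :* m))
          refl (A x) (sign σ) (h y) (B y ⁻¹) (s x ⊓ t y))
        (λ x → *-/-≤ (0≤g x))
        v²t≤h
        (decomposition-⊓ μ 0≤μ f κ 0≤κ A (λ y → sign σ * (h y / B y)) 0≤s 0≤t)
        where
        v²t≤h : ∀ y → sign σ * (h y / B y) * (sign σ * (h y / B y)) * t y ≤ h y
        v²t≤h y = begin
          sign σ * (h y / B y) * (sign σ * (h y / B y)) * t y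
            ≈⟨ solve 4 (λ c h i t → c :* (h :* i) :* (c :* (h :* i)) :* t := c :* c :*
                (h :* i :* t :* (h :* i)))
                 refl (sign σ) (h y) (B y ⁻¹) (t y) ⟩
          sign σ * sign σ * (h y / B y * t y * (h y / B y))
            ≈⟨ trans (*-congʳ (sign² σ)) (*-identityˡ _) ⟩
          h y / B y * t y * (h y / B y)
            ≤⟨ *-monoʳ-≤ (0≤h y ⊗ 0≤⁻¹ (0≤B y)) (ht/B y) ⟩
          B y * (h y / B y)
            ≤⟨ *-/-≤ (0≤h y) ⟩
          h y ∎
          where open ≤-Reasoning

-- The two-bit protocol that multiplies two signs.

module SignProtocol (em : ExcludedMiddle 0ℓ) (ℝ : RealNumbers) where

  open OrderedField em ℝ
  open RankOneSums em ℝ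
  open Communication em ℝ

  sign-xor : ∀ a b → sign (a xor b) ≈ sign a * sign b
  sign-xor false b     = sym (*-identityˡ _)
  sign-xor true  false = sym (*-identityʳ _)
  sign-xor true  true  = solve 0 (` 1 := (:- ` 1) :* (:- ` 1)) refl

  exchange-bits : ∀ {X Y : Set} → (X → Bool) → (Y → Bool) → Protocol X Y
  exchange-bits σ τ = record
    { nPub = 1 ; nA = 1 ; nB = 1
    ; ρPub = λ _ → 1# ; ρA = λ _ → 1# ; ρB = λ _ → 1#
    ; ρPub-isDist = certain ; ρA-isDist = certain ; ρB-isDist = certain
    ; tree = λ _ → alice (λ (x , _) → σ x) λ a → bob (λ (y , _) → τ y) λ b → output (a xor b)
    }
    where
    certain = (λ _ → 0≤1) , +-identityʳ 1#

  module _ {nX nY : ℕ} (μ : Fin nX → Fin nY → Carrier) (0≤μ : ∀ x y → 0# ≤ μ x y)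
           (f : Fin nX → Fin nY → Bool) where

    open Correlation μ 0≤μ f

    correlate-signs≤adv : ∀ {T} (σ : Fin nX → Bool) (τ : Fin nY → Bool) → fromℕ 2 ≤ T →
      [ correlate (λ x y → sign (σ x) * sign (τ y)) ] ≤± adv μ T f
    correlate-signs≤adv σ τ 2≤T = ≤±-trans ≤-trans [ ≈⇒≤ (sym (∑²-cong advantage≈)) ]≤
      (⨆-upper (λ (π , _) → [ advantage μ π f ]) (exchange-bits σ τ , 2≤T))
      where
      advantage≈ : ∀ x y → μ x y * 1# * 1# * 1# * sign ((σ x xor τ y) xor f x y) + 0# + 0# + 0#
                           ≈ μ x y * (sign (f x y) * (sign (σ x) * sign (τ y)))
      advantage≈ x y = trans
        (solve 2 (λ m r → m :* ` 1 :* ` 1 :* ` 1 :* r :+ ` 0 :+ ` 0 :+ ` 0 := m :* r) refl (μ x y) _)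
        (*-congˡ (trans (trans (sign-xor (σ x xor τ y) (f x y)) (*-congʳ (sign-xor (σ x) (τ y))))
            (*-comm _ _)))


-- What a bounded cost says about a single triple `x y m`.

module CostBounds (em : ExcludedMiddle 0ℓ) (ℝ : RealNumbers) where

  open OrderedField em ℝ
  open Summations em ℝ
  open Exponential em ℝ
  open MarginalInformation em ℝ

  exp-mono-ln : ∀ {u z} → 0# < z → exp u ≤ z → u ≤ ln z
  exp-mono-ln 0<z le = exp-cancel-≤ (≤-respʳ-≈ (sym (exp-ln 0<z)) le)

  exp-ln-≤ : ∀ {u z} → 0# < z → ln z ≤ u → z ≤ exp u
  exp-ln-≤ 0<z le = ≤-respˡ-≈ (exp-ln 0<z) (exp-mono le)

  ln2 : Carrier
  ln2 = ln (fromℕ 2)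

  0<fromℕ2 : 0# < fromℕ 2
  0<fromℕ2 = <-respʳ-≈ (sym (fromℕ≈ 2)) 0<2

  0<ln2 : 0# < ln2
  0<ln2 = ≰⇒> λ ln2≤0 → <⇒≱ 0<1 (lin (0≤- (begin
    num 2      ≈⟨ fromℕ≈ 2 ⟨
    fromℕ 2    ≈⟨ exp-ln 0<fromℕ2 ⟨
    exp ln2    ≤⟨ exp-mono ln2≤0 ⟩
    exp 0#     ≈⟨ exp-0 ⟩
    1#         ∎)) (solve 0 (` 0 :- ` 1 := ` 1 :- ` 2) refl))
    where open ≤-Reasoning

  -- The passage to natural logarithms, in which all further estimates are made; it is the origin of
  -- the factor `ln2` in `ℓ`.
  log₂-product≤ : ∀ {r₁ r₂ r k I e c} → 0# < r₁ → 0# < r₂ → 0# < r → 0# < k →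
    log₂ (r₁ * r₂ * r ^ᴿ I * k ^ᴿ e) ≤ c → ln r₁ + ln r₂ + I * ln r + e * ln k ≤ c * ln2
  log₂-product≤ {r₁} {r₂} {r} {k} {I} {e} {c} 0<r₁ 0<r₂ 0<r 0<k le = exp-cancel-≤ (begin
    exp (ln r₁ + ln r₂ + I * ln r + e * ln k)
      ≈⟨ trans (exp-+ _ _) (*-congʳ (trans (exp-+ _ _)
          (*-congʳ (trans (exp-+ _ _) (*-cong (exp-ln 0<r₁) (exp-ln 0<r₂)))))) ⟩
    P                                    ≈⟨ exp-ln 0<P ⟨
    exp (ln P)                           ≈⟨ exp-cong (/-*-cancel (0<⇒≉ 0<ln2)) ⟨
    exp (log₂ P * ln2)                   ≤⟨ exp-mono (*-monoʳ-≤ (proj₁ 0<ln2) le) ⟩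
    exp (c * ln2)                        ∎)
    where
    open ≤-Reasoning
    P = r₁ * r₂ * r ^ᴿ I * k ^ᴿ e
    0<P : 0# < P
    0<P = 0<* (0<* (0<* 0<r₁ 0<r₂) (0<exp _)) (0<exp _)

  -- With λ₁, λ₂ and λ₃ the logarithms of the three ratios in the cost, and γ minus that of the correlation.
  log-bounds : ∀ {I ℓ λ₁ λ₂ λ₃ γ} → 1# ≤ I → 0# ≤ ℓ → let t = ℓ + num 80 in
    - t ≤ λ₁ → - t ≤ λ₂ → - t ≤ λ₃ → 0# ≤ γ → λ₁ + λ₂ + I * λ₃ + num 180 * I * γ ≤ I * ℓ →
    λ₃ ≤ ℓ + (t + t) × λ₁ + λ₂ ≤ I * (ℓ + t) × γ ≤ t - num 20
  log-bounds {I} {ℓ} {λ₁} {λ₂} {λ₃} {γ} 1≤I 0≤ℓ l₁ l₂ l₃ 0≤γ le =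
    -- The first two ratios enter the cost without the factor `I`, so they contribute
    -- `2 t / I ≤ 2 t` here. Hence `K` does not depend on `I`.
    *-cancelˡ-≤ 0<I (lin (0≤- le ⊕ 0≤180Iγ ⊕ 0≤- l₁ ⊕ 0≤- l₂ ⊕ 0≤- 1≤I ⊗ (0≤t ⊕ 0≤t))
      (solve 7 (λ I ℓ t a b c g → I :* (ℓ :+ (t :+ t)) :- I :* c
        := I :* ℓ :- (a :+ b :+ I :* c :+ g) :+ g :+ (a :- :- t) :+ (b :- :- t) :+ (I :- ` 1) :* (t :+ t))
        refl I ℓ t λ₁ λ₂ λ₃ (num 180 * I * γ))) ,
    lin (0≤- le ⊕ 0≤180Iγ ⊕ 0≤I ⊗ 0≤- l₃)
      (solve 7 (λ I ℓ t a b c g → I :* (ℓ :+ t) :- (a :+ b)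
        := I :* ℓ :- (a :+ b :+ I :* c :+ g) :+ g :+ I :* (c :- :- t))
        refl I ℓ t λ₁ λ₂ λ₃ (num 180 * I * γ)) ,
    -- The lower bounds leave `180 γ ≤ ℓ + 3 t`, and `t = ℓ + 80` turns the right side into
    -- `4 (t - 20)`. Weakening `180 γ` to `4 γ` accounts for the coefficient 176.
    *-cancelˡ-≤ 0<4 (*-cancelˡ-≤ 0<I (lin
      (0≤- le ⊕ 0≤num 176 ⊗ 0≤I ⊗ 0≤γ ⊕ 0≤- l₁ ⊕ 0≤- l₂ ⊕ 0≤I ⊗ 0≤- l₃ ⊕ 0≤- 1≤I ⊗ (0≤t ⊕ 0≤t))
      (solve 6 (λ I ℓ a b c γ → let t = ℓ :+ ` 80 in
        I :* (` 4 :* (t :- ` 20)) :- I :* (` 4 :* γ)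
        := I :* ℓ :- (a :+ b :+ I :* c :+ ` 180 :* I :* γ) :+ ` 176 :* I :* γ :+ (a :- :- t) :+ (b :- :- t)
           :+ I :* (c :- :- t) :+ (I :- ` 1) :* (t :+ t))
        refl I ℓ λ₁ λ₂ λ₃ γ)))
    where
    t = ℓ + num 80
    0≤t : 0# ≤ t
    0≤t = 0≤ℓ ⊕ 0≤num 80
    0<I : 0# < I
    0<I = <-≤-trans 0<1 1≤I
    0≤I = proj₁ 0<I
    0<4 : 0# < num 4
    0<4 = 0<+ (0<+ 0<2 0≤1) 0≤1
    0≤180Iγ : 0# ≤ num 180 * I * γ
    0≤180Iγ = 0≤num 180 ⊗ 0≤I ⊗ 0≤γ

  -- T is the Markov threshold. It is so large that the correlation of a typical message is at least
  -- 20 / T, against a loss of 15 / T by truncation. K bounds q / p, and exp (I * θ) the squared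
  -- lengths of the vectors in the decomposition.
  module Constants (α : Carrier) where

    ℓ t T⁻¹ K θ Δ : Carrier
    ℓ   = (α + 1#) * ln2
    t   = ℓ + num 80
    T⁻¹ = exp (- t)
    K   = exp (ℓ + (t + t))
    θ   = num 3 * ℓ + num 5 * t + num 4
    Δ   = num 2 * θ + num 3 * t + num 25

  module Typical {nX nY : ℕ} (f : Fin nX → Fin nY → Bool) {ss : List ℕ}
    (p q : Fin nX → Fin nY → Messages ss → Carrier)
    (0≤p : ∀ x y m → 0# ≤ p x y m) (0≤q : ∀ x y m → 0# ≤ q x y m)
    {I α : Carrier} (1≤I : 1# ≤ I) (0≤α : 0# ≤ α) where

    private
      module P = Joint p
      module Q = Joint q

    open Constants α

    Z : Carrier
    Z = exp (I * (ℓ + t))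

    0≤ℓ : 0# ≤ ℓ
    0≤ℓ = (0≤α ⊕ 0≤1) ⊗ proj₁ 0<ln2

    signed : Messages ss → Carrier
    signed m = ∑[ x < nX ] ∑[ y < nY ] (q x y m * sign (f x y))

    q≤ℙ[xm] : ∀ x y m → q x y m ≤ Q.ℙ[xm] x m
    q≤ℙ[xm] x y m = term≤∑ ∑ᶠ (λ y → 0≤q x y m) y

    q≤ℙ[ym] : ∀ x y m → q x y m ≤ Q.ℙ[ym] y m
    q≤ℙ[ym] x y m = term≤∑ ∑ᶠ (λ x → 0≤q x y m) x

    0≤ℙ[xm] : ∀ x m → 0# ≤ Q.ℙ[xm] x m
    0≤ℙ[xm] x m = 0≤∑ ∑ᶠ (λ y → 0≤q x y m)

    q≤ℙ[m] : ∀ x y m → q x y m ≤ Q.ℙ[m] m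
    q≤ℙ[m] x y m = ≤-trans (q≤ℙ[xm] x y m) (term≤∑ ∑ᶠ (λ x → 0≤ℙ[xm] x m) x)

    0≤ℙ[xy] : ∀ x y → 0# ≤ P.ℙ[xy] x y
    0≤ℙ[xy] x y = 0≤∑ ∑ᵐ (0≤p x y)

    ℙ[xy]≤ℙ[x] : ∀ x y → P.ℙ[xy] x y ≤ P.ℙ[x] x
    ℙ[xy]≤ℙ[x] x y = term≤∑ ∑ᶠ (0≤ℙ[xy] x) y

    ℙ[xy]≤ℙ[y] : ∀ x y → P.ℙ[xy] x y ≤ P.ℙ[y] y
    ℙ[xy]≤ℙ[y] x y = term≤∑ ∑ᶠ (λ x → 0≤ℙ[xy] x y) x

    correlation≈ : ∀ m → 0# < Q.ℙ[m] m → correlation f q m * Q.ℙ[m] m ≈ signed m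
    correlation≈ m 0<qm = begin
      correlation f q m * Q.ℙ[m] m
        ≈⟨ ∑-*ʳ (∑ᶠ {nX}) (Q.ℙ[m] m) (λ x → ∑[ y < nY ] (Q.ℙ[xy∣m] x y m * sign (f x y))) ⟨
      ∑[ x < nX ] ((∑[ y < nY ] (Q.ℙ[xy∣m] x y m * sign (f x y))) * Q.ℙ[m] m)
        ≈⟨ ∑-cong (∑ᶠ {nX}) (λ x → trans
             (sym (∑-*ʳ (∑ᶠ {nY}) (Q.ℙ[m] m) (λ y → Q.ℙ[xy∣m] x y m * sign (f x y))))
             (∑-cong (∑ᶠ {nY}) (λ y → cancel (q x y m) (sign (f x y))))) ⟩
      signed m ∎
      where
      open import Relation.Binary.Reasoning.Setoid setoid
      cancel : ∀ a s → a / Q.ℙ[m] m * s * Q.ℙ[m] m ≈ a * s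
      cancel a s = trans
        (solve 4 (λ a i s r → a :* i :* s :* r := a :* s :* (r :* i)) refl a (Q.ℙ[m] m ⁻¹) s (Q.ℙ[m] m))
        (trans (*-congˡ (⁻¹-inverseʳ (0<⇒≉ 0<qm))) (*-identityʳ _))

    -- Bounds the correlation by 1, so that minus its logarithm can serve as the nonnegative `γ` of
    -- `log-bounds`.
    ∣signed∣≤ : ∀ m → ∣ signed m ∣ ≤ Q.ℙ[m] m
    ∣signed∣≤ m = ∣∣-least (∑-mono (∑ᶠ {nX}) (λ x → ∑-mono
        (∑ᶠ {nY}) (λ y → proj₁ (term (f x y) (0≤q x y m)))))
      (lin (0≤- (≤-respʳ-≈ (trans (∑-cong (∑ᶠ {nX}) (λ x → ∑-+ (∑ᶠ {nY}) _ _)) (∑-+ (∑ᶠ {nX}) _ _))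
             (≤-respˡ-≈ (∑-zero (∑ᶠ {nX}) (λ x → ∑-zero (∑ᶠ {nY}) (λ y → refl)))
               (∑-mono (∑ᶠ {nX}) (λ x → ∑-mono (∑ᶠ {nY}) (λ y → proj₂ (term (f x y) (0≤q x y m))))))))
        (solve 2 (λ a b → a :- :- b := a :+ b :- ` 0) refl (Q.ℙ[m] m) (signed m)))
      where
      term : ∀ c {r} → 0# ≤ r → r * sign c ≤ r × 0# ≤ r + r * sign c
      term false {r} 0≤r = ≈⇒≤ (*-identityʳ r) , 0≤r ⊕ (0≤r ⊗ 0≤1)
      term true  {r} 0≤r = lin (0≤r ⊕ 0≤r) (solve 1 (λ r → r :- r :* (:- ` 1) := r :+ r) refl r) ,
                           ≈⇒≤ (solve 1 (λ r → ` 0 := r :+ r :* (:- ` 1)) refl r)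

    module _ {x : Fin nX} {y : Fin nY} {m : Messages ss} where

      -- A finite bound rules out the degenerate cases in which `cost` is `⊤±`; the positivity of
      -- `p x y m`, of `p(xy)` and of the absolute correlation all come from here.
      unpack-cost : ∀ {c} → cost f I p q x y m ≤± [ c ] →
        (¬ (P.ℙ[x∣y] x y ≈ 0#) × ¬ (P.ℙ[y∣x] y x ≈ 0#) × ¬ (p x y m ≈ 0#) × ¬ (correlation f q m ≈ 0#)) ×
        log₂ (Q.ℙ[x∣ym] x y m / P.ℙ[x∣y] x y * (Q.ℙ[y∣xm] y x m / P.ℙ[y∣x] y x) *
              (q x y m / p x y m) ^ᴿ I * ∣ correlation f q m ∣ ^ᴿ (- (fromℕ 12 * I / δ))) ≤ c
      unpack-cost with em {(P.ℙ[x∣y] x y ≈ 0#) ⊎ (P.ℙ[y∣x] y x ≈ 0#) ⊎ (p x y m ≈ 0#) ⊎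
          (correlation f q m ≈ 0#)}
      ... | yes _ = λ ()
      ... | no  h = λ le → ((λ z → h (inj₁ z)) , (λ z → h (inj₂ (inj₁ z))) ,
          (λ z → h (inj₂ (inj₂ (inj₁ z)))) ,
                            (λ z → h (inj₂ (inj₂ (inj₂ z))))) , [≤]-injective le

      -- With denominators cleared: the ratio `q / p` is at most `K`, the product of the two ratios
      -- of conditionals is at most `Z`, and the correlation of `m` is at least 20/T in absolute
      -- value.
      record Bounds : Set where
        field
          q≤Kp      : q x y m ≤ K * p x y m
          q²≤       : q x y m * q x y m * (P.ℙ[x] x * P.ℙ[y] y) ≤
                      Z * (Q.ℙ[xm] x m * Q.ℙ[ym] y m * (P.ℙ[xy] x y * P.ℙ[xy] x y))
          ℙ[m]≤     : num 20 * T⁻¹ * Q.ℙ[m] m ≤ ∣ signed m ∣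

      bounds : 0# < q x y m → cost f I p q x y m ≤± [ (α + 1#) * I ] →
        T⁻¹ * (Q.ℙ[ym] y m * P.ℙ[xy] x y) ≤ q x y m * P.ℙ[y] y →
        T⁻¹ * (Q.ℙ[xm] x m * P.ℙ[xy] x y) ≤ q x y m * P.ℙ[x] x →
        T⁻¹ * p x y m ≤ q x y m → Bounds
      bounds 0<q cost≤ E₁ E₂ E₃ = record { q≤Kp = bound-a ; q²≤ = bound-b ; ℙ[m]≤ = bound-c }
        where
        qm qxm qym px py pxy k r₁ r₂ r : Carrier
        qm  = Q.ℙ[m] m
        qxm = Q.ℙ[xm] x m
        qym = Q.ℙ[ym] y m
        px  = P.ℙ[x] x
        py  = P.ℙ[y] y
        pxy = P.ℙ[xy] x y
        k   = ∣ correlation f q m ∣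
        r₁  = Q.ℙ[x∣ym] x y m / P.ℙ[x∣y] x y
        r₂  = Q.ℙ[y∣xm] y x m / P.ℙ[y∣x] y x
        r   = q x y m / p x y m

        support = proj₁ (unpack-cost cost≤)

        0<qm : 0# < qm
        0<qm = <-≤-trans 0<q (q≤ℙ[m] x y m)
        0<qxm : 0# < qxm
        0<qxm = <-≤-trans 0<q (q≤ℙ[xm] x y m)
        0<qym : 0# < qym
        0<qym = <-≤-trans 0<q (q≤ℙ[ym] x y m)
        0<pxy : 0# < pxy
        0<pxy = 0≤∧≉⇒0< (0≤ℙ[xy] x y) (λ eq → proj₁ support (trans (*-congʳ eq) (zeroˡ _)))
        0<px : 0# < px
        0<px = <-≤-trans 0<pxy (ℙ[xy]≤ℙ[x] x y)
        0<py : 0# < py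
        0<py = <-≤-trans 0<pxy (ℙ[xy]≤ℙ[y] x y)
        0<p : 0# < p x y m
        0<p = 0≤∧≉⇒0< (0≤p x y m) (proj₁ (proj₂ (proj₂ support)))
        0<k : 0# < k
        0<k = 0≤∧≉⇒0< (0≤∣∣ _) (λ k≈0 → proj₂ (proj₂ (proj₂ support)) (antisym
          (≤-trans (≤∣∣ _) (≈⇒≤ k≈0))
          (lin (0≤- (≤-trans (-≤∣∣ _) (≈⇒≤ k≈0))) (solve 1 (λ c → c :- ` 0 := ` 0 :- :- c) refl _))))
        0<r₁ : 0# < r₁
        0<r₁ = 0<* (0<* 0<q (0<⁻¹ 0<qym)) (0<⁻¹ (0<* 0<pxy (0<⁻¹ 0<py)))
        0<r₂ : 0# < r₂
        0<r₂ = 0<* (0<* 0<q (0<⁻¹ 0<qxm)) (0<⁻¹ (0<* 0<pxy (0<⁻¹ 0<px)))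
        0<r : 0# < r
        0<r = 0<* 0<q (0<⁻¹ 0<p)

        ratio : ∀ {a b c d} → ¬ (b ≈ 0#) → ¬ (c ≈ 0#) → ¬ (d ≈ 0#) → a / b / (c / d) * (b * c) ≈ a * d
        ratio {a} {b} {c} {d} b≉0 c≉0 d≉0 = begin
          a / b / (c / d) * (b * c)                ≈⟨ *-congˡ (*-congˡ (/-*-cancel d≉0)) ⟨
          a / b / (c / d) * (b * (c / d * d))
              ≈⟨ solve 6 (λ a i j b e d → a :* i :* j :* (b :* (e :* d)) := a :* d :* (b :* i) :* (e :* j))
                                                        refl a (b ⁻¹) ((c / d) ⁻¹) b (c / d) d ⟩
          a * d * (b / b) * (c / d * (c / d) ⁻¹)
              ≈⟨ *-cong (*-congˡ (⁻¹-inverseʳ b≉0)) (⁻¹-inverseʳ (*-≉0 c≉0 (⁻¹-≉0 d≉0))) ⟩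
          a * d * 1# * 1#                          ≈⟨ trans (*-identityʳ _) (*-identityʳ _) ⟩
          a * d                                    ∎
          where open import Relation.Binary.Reasoning.Setoid setoid

        r₁≈ : r₁ * (qym * pxy) ≈ q x y m * py
        r₁≈ = ratio (0<⇒≉ 0<qym) (0<⇒≉ 0<pxy) (0<⇒≉ 0<py)
        r₂≈ : r₂ * (qxm * pxy) ≈ q x y m * px
        r₂≈ = ratio (0<⇒≉ 0<qxm) (0<⇒≉ 0<pxy) (0<⇒≉ 0<px)
        r≈ : r * p x y m ≈ q x y m
        r≈ = /-*-cancel (0<⇒≉ 0<p)

        above : ∀ {r a b} → 0# < r → 0# < a → r * a ≈ b → T⁻¹ * a ≤ b → - t ≤ ln r
        above 0<r 0<a eq le = exp-mono-ln 0<r (*-cancelˡ-≤ 0<a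
          (≤-respˡ-≈ (*-comm _ _) (≤-respʳ-≈ (trans (sym eq) (*-comm _ _)) le)))

        k*qm≈ : k * qm ≈ ∣ signed m ∣
        k*qm≈ = trans (*-congˡ (sym (∣∣-nonneg (proj₁ 0<qm))))
            (trans (sym (∣*∣ _ _)) (∣∣-cong (correlation≈ m 0<qm)))

        k≤1 : k ≤ 1#
        k≤1 = *-cancelˡ-≤ 0<qm (≤-respˡ-≈ (trans (sym k*qm≈) (*-comm _ _))
            (≤-respʳ-≈ (sym (*-identityʳ qm)) (∣signed∣≤ m)))

        0≤-lnk : 0# ≤ - ln k
        0≤-lnk = ≤-respʳ-≈ (+-identityˡ _) (0≤- (exp-cancel-≤ (begin
          exp (ln k)  ≈⟨ exp-ln 0<k ⟩
          k           ≤⟨ k≤1 ⟩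
          1#          ≈⟨ exp-0 ⟨
          exp 0#      ∎)))
          where open ≤-Reasoning

        12/δ≈180 : fromℕ 12 * I / δ ≈ num 180 * I
        12/δ≈180 = begin
          fromℕ 12 * I * (1# / fromℕ 15) ⁻¹        ≈⟨ *-cong (*-congʳ (fromℕ≈ 12)) δ⁻¹ ⟩
          num 12 * I * num 15
              ≈⟨ solve 1 (λ I → ` 12 :* I :* ` 15 := ` 180 :* I) refl I ⟩
          num 180 * I                              ∎
          where
          open import Relation.Binary.Reasoning.Setoid setoid
          15≉0 : ¬ (fromℕ 15 ≈ 0#)
          15≉0 = 0<⇒≉ (<-respʳ-≈ refl (0<+ 0<1 (≤-respʳ-≈ (sym (fromℕ≈ 14)) (0≤num 14))))
          δ≉0 : ¬ (δ ≈ 0#)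
          δ≉0 = *-≉0 (0<⇒≉ 0<1) (⁻¹-≉0 15≉0)
          δ⁻¹ : δ ⁻¹ ≈ num 15
          δ⁻¹ = *-cancelˡ-≈ δ≉0 (trans (⁻¹-inverseʳ δ≉0)
              (sym (trans (*-congˡ (sym (fromℕ≈ 15))) (/-*-cancel 15≉0))))

        logs = log-bounds 1≤I 0≤ℓ
          (above 0<r₁ (0<* 0<qym 0<pxy) r₁≈ E₁) (above 0<r₂ (0<* 0<qxm 0<pxy) r₂≈ E₂)
              (above 0<r 0<p r≈ E₃) 0≤-lnk
          (≤-respˡ-≈ (+-congˡ (trans (*-congʳ (-‿cong 12/δ≈180))
                       (solve 3 (λ n I l → :- (n :* I) :* l := n :* I :* :- l) refl (num 180) I (ln k))))
            (≤-respʳ-≈ (solve 3 (λ a I l → a :* I :* l := I :* (a :* l)) refl (α + 1#) I ln2)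
              (log₂-product≤ 0<r₁ 0<r₂ 0<r 0<k (proj₂ (unpack-cost cost≤)))))

        bound-a : q x y m ≤ K * p x y m
        bound-a = ≤-respˡ-≈ r≈ (*-monoʳ-≤ (0≤p x y m) (exp-ln-≤ 0<r (proj₁ logs)))

        bound-b : q x y m * q x y m * (px * py) ≤ Z * (qxm * qym * (pxy * pxy))
        bound-b = begin
          q x y m * q x y m * (px * py)
              ≈⟨ solve 3 (λ q a b → q :* q :* (a :* b) := q :* b :* (q :* a)) refl (q x y m) px py ⟩
          q x y m * py * (q x y m * px)                ≈⟨ *-cong r₁≈ r₂≈ ⟨
          r₁ * (qym * pxy) * (r₂ * (qxm * pxy))
              ≈⟨ solve 5 (λ r₁ r₂ a b c → r₁ :* (a :* c) :* (r₂ :* (b :* c)) := r₁ :* r₂ :*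
                  (b :* a :* (c :* c)))
                                                            refl r₁ r₂ qym qxm pxy ⟩
          r₁ * r₂ * (qxm * qym * (pxy * pxy))
              ≤⟨ *-monoʳ-≤ ((proj₁ 0<qxm ⊗ proj₁ 0<qym) ⊗ 0≤sq pxy) r₁r₂≤Z ⟩
          Z * (qxm * qym * (pxy * pxy))                ∎
          where
          open ≤-Reasoning
          r₁r₂≤Z : r₁ * r₂ ≤ Z
          r₁r₂≤Z = begin
            r₁ * r₂                        ≈⟨ *-cong (exp-ln 0<r₁) (exp-ln 0<r₂) ⟨
            exp (ln r₁) * exp (ln r₂)      ≈⟨ exp-+ _ _ ⟨
            exp (ln r₁ + ln r₂)            ≤⟨ exp-mono (proj₁ (proj₂ logs)) ⟩
            Z                              ∎

        bound-c : num 20 * T⁻¹ * qm ≤ ∣ signed m ∣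
        -- From `- ln k ≤ t - 20` follows `k ≥ exp 20 / T`, and `exp 20 ≥ 20` is all that is kept.
        bound-c = ≤-respʳ-≈ k*qm≈ (*-monoʳ-≤ (proj₁ 0<qm) (begin
          num 20 * T⁻¹            ≤⟨ *-monoʳ-≤ (0≤exp _) (≤-trans
                                       (lin 0≤1 (solve 0 (` 1 :+ ` 20 :- ` 20 := ` 1) refl))
                                           (1+x≤exp (num 20))) ⟩
          exp (num 20) * T⁻¹      ≈⟨ exp-+ _ _ ⟨
          exp (num 20 - t)        ≤⟨ exp-mono (lin (0≤- (proj₂ (proj₂ logs)))
                                       (solve 3 (λ l t c → l :- (c :- t) := t :- c :- :- l) refl (ln k) t
                                           (num 20))) ⟩
          exp (ln k)              ≈⟨ exp-ln 0<k ⟩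
          k                       ∎))
          where open ≤-Reasoning


-- The mass of `q` outside the typical part.

module Truncation (em : ExcludedMiddle 0ℓ) (ℝ : RealNumbers) where

  open OrderedField em ℝ
  open Summations em ℝ
  open Exponential em ℝ
  open ProductKernel em ℝ
  open CostBounds em ℝ
  open MarginalInformation em ℝ

  𝟙 : Set → Carrier
  𝟙 A with em {A}
  ... | yes _ = 1#
  ... | no  _ = 0#

  𝟙-cases : ∀ A → (A × 𝟙 A ≈ 1#) ⊎ (¬ A × 𝟙 A ≈ 0#)
  𝟙-cases A with em {A}
  ... | yes a = inj₁ (a , refl)
  ... | no ¬a = inj₂ (¬a , refl)

  0≤𝟙 : ∀ A → 0# ≤ 𝟙 A
  0≤𝟙 A with em {A}
  ... | yes _ = 0≤1
  ... | no  _ = ≤-refl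

  module _ {nX nY : ℕ} {ss : List ℕ} where

    ∑³ : (Fin nX → Fin nY → Messages ss → Carrier) → Carrier
    ∑³ g = ∑[ x < nX ] ∑[ y < nY ] ∑ₘ (λ m → g x y m)

    private
      Σ³ : Summation (Fin nX × Fin nY × Messages ss) (λ g → ∑³ (λ x y m → g (x , y , m)))
      Σ³ = ∑ᶠ ⊠ ∑ᶠ ⊠ ∑ᵐ

      uncurry³ : (Fin nX → Fin nY → Messages ss → Carrier) → Fin nX × Fin nY × Messages ss → Carrier
      uncurry³ g (x , y , m) = g x y m

    ∑³-mono : ∀ {g h} → (∀ x y m → g x y m ≤ h x y m) → ∑³ g ≤ ∑³ h
    ∑³-mono {g} {h} p = ∑-mono Σ³ {uncurry³ g} {uncurry³ h} (λ (x , y , m) → p x y m)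

    ∑³-+ : ∀ g h → ∑³ (λ x y m → g x y m + h x y m) ≈ ∑³ g + ∑³ h
    ∑³-+ g h = ∑-+ Σ³ (uncurry³ g) (uncurry³ h)

    ∑³-- : ∀ g h → ∑³ (λ x y m → g x y m - h x y m) ≈ ∑³ g - ∑³ h
    ∑³-- g h = ∑-- Σ³ (uncurry³ g) (uncurry³ h)

    ∑³-*ˡ : ∀ c g → ∑³ (λ x y m → c * g x y m) ≈ c * ∑³ g
    ∑³-*ˡ c g = ∑-*ˡ Σ³ c (uncurry³ g)

    ∑³-by-x : ∀ g → ∑³ g ≈ ∑[ x < nX ] ∑ₘ (λ m → ∑[ y < nY ] g x y m)
    ∑³-by-x g = ∑-cong (∑ᶠ {nX}) (λ x → sym (∑-swap ∑ᵐ nY (λ m y → g x y m)))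

    ∑³-by-y : ∀ g → ∑³ g ≈ ∑[ y < nY ] ∑ₘ (λ m → ∑[ x < nX ] g x y m)
    ∑³-by-y g = trans (∑-swap (∑ᶠ {nX}) nY (λ x y → ∑ₘ (λ m → g x y m)))
      (∑-cong (∑ᶠ {nY}) (λ y → sym (∑-swap ∑ᵐ nX (λ m x → g x y m))))

    ∑³-by-m : ∀ g → ∑³ g ≈ ∑ₘ (λ m → ∑[ x < nX ] ∑[ y < nY ] g x y m)
    ∑³-by-m g = trans (∑³-by-x g) (sym (∑-swap ∑ᵐ nX (λ m x → ∑[ y < nY ] g x y m)))

  module Estimates {nX nY : ℕ} (f : Fin nX → Fin nY → Bool) {ss : List ℕ}
    {p q : Fin nX → Fin nY → Messages ss → Carrier}
    (p-dist : Joint.IsJointDistribution p) (q-dist : Joint.IsJointDistribution q)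
    {I α : Carrier} (1≤I : 1# ≤ I) (0≤α : 0# ≤ α)
    (cost≤ : ∀ x y m → 0# < q x y m → cost f I p q x y m ≤± [ (α + 1#) * I ]) where

    private
      module P = Joint p
      module Q = Joint q

      X = Fin nX
      Y = Fin nY
      V = Messages ss

      0≤p = proj₁ p-dist
      0≤q = proj₁ q-dist

    open Constants α
    open Typical f p q 0≤p 0≤q 1≤I 0≤α

    0≤ℙ[ym] : ∀ y m → 0# ≤ Q.ℙ[ym] y m
    0≤ℙ[ym] y m = 0≤∑ (∑ᶠ {nX}) (λ x → 0≤q x y m)

    0≤ℙ[x] : ∀ x → 0# ≤ P.ℙ[x] x
    0≤ℙ[x] x = 0≤∑ (∑ᶠ {nY}) (0≤ℙ[xy] x)

    0≤ℙ[y] : ∀ y → 0# ≤ P.ℙ[y] y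
    0≤ℙ[y] y = 0≤∑ (∑ᶠ {nX}) (λ x → 0≤ℙ[xy] x y)

    0≤T⁻¹ : 0# ≤ T⁻¹
    0≤T⁻¹ = 0≤exp _

    E₁ E₂ E₃ : X → Y → V → Set
    E₁ x y m = T⁻¹ * (Q.ℙ[ym] y m * P.ℙ[xy] x y) ≤ q x y m * P.ℙ[y] y
    E₂ x y m = T⁻¹ * (Q.ℙ[xm] x m * P.ℙ[xy] x y) ≤ q x y m * P.ℙ[x] x
    E₃ x y m = T⁻¹ * p x y m ≤ q x y m

    Good : X → Y → V → Set
    Good x y m = 0# < q x y m × E₁ x y m × E₂ x y m × E₃ x y m

    good-bounds : ∀ {x y m} → Good x y m → Bounds {x} {y} {m}
    good-bounds (0<q , e₁ , e₂ , e₃) = bounds 0<q (cost≤ _ _ _ 0<q) e₁ e₂ e₃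

    bad : X → Y → V → Carrier
    bad x y m = 𝟙 (¬ Good x y m) * q x y m

    0≤bad : ∀ x y m → 0# ≤ bad x y m
    0≤bad x y m = 0≤𝟙 _ ⊗ 0≤q x y m

    bad-cases : ∀ x y m → Good x y m ⊎ bad x y m ≈ q x y m
    bad-cases x y m = cases (𝟙-cases (¬ Good x y m))
      where
      cases : _ ⊎ _ → Good x y m ⊎ bad x y m ≈ q x y m
      cases (inj₁ (_ , 𝟙≈1))  = inj₂ (trans (*-congʳ 𝟙≈1) (*-identityˡ _))
      cases (inj₂ (¬¬g , _)) = inj₁ (decidable-stable em ¬¬g)

    -- The reciprocals of the three ratios in the cost have expectation at most 1 under q,
    -- so that the mass of bad is controlled by Markov's inequality.
    weight : X → Y → V → Carrier
    weight x y m = Q.ℙ[ym] y m * (P.ℙ[xy] x y / P.ℙ[y] y) + Q.ℙ[xm] x m * (P.ℙ[xy] x y / P.ℙ[x] x) + p x y m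

    private
      -- Failure of the inequality forces `d > 0`: for `d = 0` also `c = 0`, and both of its sides
      -- would vanish. The convention `c / 0 = 0` is therefore never met.
      conditional≤ : ∀ {v a b c d} → 0# ≤ v → 0# ≤ c → c ≤ d → ¬ (v * (a * c) ≤ b * d) → 0# ≤ b →
                     b ≤ v * (a * (c / d))
      conditional≤ {v} {a} {b} {c} {d} 0≤v 0≤c c≤d ¬E 0≤b = ≤-respʳ-≈
        (solve 4 (λ v a c i → v :* (a :* c) :* i := v :* (a :* (c :* i))) refl v a c (d ⁻¹))
        (≤-/ 0<d (proj₁ (≰⇒> ¬E)))
        where
        0<d : 0# < d
        0<d = 0≤∧≉⇒0< (≤-trans 0≤c c≤d) λ d≈0 → ¬E (≤-respˡ-≈
          (sym (trans (*-congˡ (trans (*-congˡ (antisym (≤-trans c≤d (≈⇒≤ d≈0)) 0≤c)) (zeroʳ _)))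
              (zeroʳ _)))
          (0≤b ⊗ ≤-trans 0≤c c≤d))

    bad≤ : ∀ x y m → bad x y m ≤ T⁻¹ * weight x y m
    bad≤ x y m = cases (𝟙-cases (¬ Good x y m))
      where
      w₁ w₂ : Carrier
      w₁ = Q.ℙ[ym] y m * (P.ℙ[xy] x y / P.ℙ[y] y)
      w₂ = Q.ℙ[xm] x m * (P.ℙ[xy] x y / P.ℙ[x] x)
      0≤w₁ : 0# ≤ w₁
      0≤w₁ = 0≤ℙ[ym] y m ⊗ (0≤ℙ[xy] x y ⊗ 0≤⁻¹ (0≤ℙ[y] y))
      0≤w₂ : 0# ≤ w₂
      0≤w₂ = 0≤ℙ[xm] x m ⊗ (0≤ℙ[xy] x y ⊗ 0≤⁻¹ (0≤ℙ[x] x))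
      0≤weight : 0# ≤ T⁻¹ * weight x y m
      0≤weight = 0≤T⁻¹ ⊗ (0≤w₁ ⊕ 0≤w₂ ⊕ 0≤p x y m)
      q≤ : ¬ Good x y m → (0# < q x y m ⊎ ¬ (0# < q x y m)) → E₁ x y m ⊎ ¬ E₁ x y m → E₂ x y m
          ⊎ ¬ E₂ x y m →
           E₃ x y m ⊎ ¬ E₃ x y m → q x y m ≤ T⁻¹ * weight x y m
      q≤ ¬g (inj₂ q≯0) _ _ _ = ≤-trans (≈⇒≤ (antisym (decidable-stable em (λ q≰0 → q≯0 (≰⇒> q≰0)))
          (0≤q x y m))) 0≤weight
      q≤ ¬g _ (inj₂ ¬e) _ _ = ≤-trans (conditional≤ 0≤T⁻¹ (0≤ℙ[xy] x y) (ℙ[xy]≤ℙ[y] x y) ¬e (0≤q x y m))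
        (*-monoˡ-≤ 0≤T⁻¹ (lin (0≤w₂ ⊕ 0≤p x y m) (solve 3 (λ a b c → a :+ b :+ c :- a := b :+ c) refl w₁
            w₂ (p x y m))))
      q≤ ¬g _ _ (inj₂ ¬e) _ = ≤-trans (conditional≤ 0≤T⁻¹ (0≤ℙ[xy] x y) (ℙ[xy]≤ℙ[x] x y) ¬e (0≤q x y m))
        (*-monoˡ-≤ 0≤T⁻¹ (lin (0≤w₁ ⊕ 0≤p x y m) (solve 3 (λ a b c → a :+ b :+ c :- b := a :+ c) refl w₁
            w₂ (p x y m))))
      q≤ ¬g _ _ _ (inj₂ ¬e) = ≤-trans (proj₁ (≰⇒> ¬e))
        (*-monoˡ-≤ 0≤T⁻¹ (lin (0≤w₁ ⊕ 0≤w₂) (solve 3 (λ a b c → a :+ b :+ c :- c := a :+ b) refl w₁ w₂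
            (p x y m))))
      q≤ ¬g (inj₁ 0<q) (inj₁ e₁) (inj₁ e₂) (inj₁ e₃) = ⊥-elim (¬g (0<q , e₁ , e₂ , e₃))
      cases : _ ⊎ _ → bad x y m ≤ T⁻¹ * weight x y m
      cases (inj₂ (_ , 𝟙≈0))  = ≤-respˡ-≈ (sym (trans (*-congʳ 𝟙≈0) (zeroˡ _))) 0≤weight
      cases (inj₁ (¬g , 𝟙≈1)) = ≤-respˡ-≈ (sym (trans (*-congʳ 𝟙≈1) (*-identityˡ _)))
        (q≤ ¬g (toSum em) (toSum em) (toSum em) (toSum em))

    ∑weight≤3 : ∑³ weight ≤ num 3
    ∑weight≤3 = begin
      ∑³ weight
        ≈⟨ trans (∑³-+ (λ x y m → w₁ x y m + w₂ x y m) p) (+-congʳ (∑³-+ w₁ w₂)) ⟩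
      ∑³ w₁ + ∑³ w₂ + ∑³ p
        ≤⟨ +-mono-≤ (+-mono-≤ ∑w₁≤1 ∑w₂≤1) (≈⇒≤ (proj₂ p-dist)) ⟩
      num 3 ∎
      where
      open ≤-Reasoning
      w₁ w₂ : X → Y → V → Carrier
      w₁ x y m = Q.ℙ[ym] y m * (P.ℙ[xy] x y / P.ℙ[y] y)
      w₂ x y m = Q.ℙ[xm] x m * (P.ℙ[xy] x y / P.ℙ[x] x)
      ∑w₁≤1 : ∑³ w₁ ≤ 1#
      ∑w₁≤1 = begin
        ∑³ w₁
          ≈⟨ ∑³-by-y w₁ ⟩
        ∑[ y < nY ] ∑ₘ (λ m → ∑[ x < nX ] w₁ x y m)
          ≤⟨ ∑-mono (∑ᶠ {nY}) (λ y → ∑-mono ∑ᵐ (λ m → sum≤ y m)) ⟩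
        ∑[ y < nY ] ∑ₘ (λ m → Q.ℙ[ym] y m)
          ≈⟨ trans (sym (∑³-by-y q)) (proj₂ q-dist) ⟩
        1# ∎
        where
        sum≤ : ∀ y m → ∑[ x < nX ] w₁ x y m ≤ Q.ℙ[ym] y m
        sum≤ y m = ≤-respˡ-≈ (sym (trans (∑-*ˡ (∑ᶠ {nX}) (Q.ℙ[ym] y m) _)
            (*-congˡ (∑-*ʳ (∑ᶠ {nX}) (P.ℙ[y] y ⁻¹) _))))
          (≤-respʳ-≈ (*-identityʳ _) (*-monoˡ-≤ (0≤ℙ[ym] y m) (*-⁻¹-≤1 (P.ℙ[y] y))))
      ∑w₂≤1 : ∑³ w₂ ≤ 1#
      ∑w₂≤1 = begin
        ∑³ w₂
          ≈⟨ ∑³-by-x w₂ ⟩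
        ∑[ x < nX ] ∑ₘ (λ m → ∑[ y < nY ] w₂ x y m)
          ≤⟨ ∑-mono (∑ᶠ {nX}) (λ x → ∑-mono ∑ᵐ (λ m → sum≤ x m)) ⟩
        ∑[ x < nX ] ∑ₘ (λ m → Q.ℙ[xm] x m)
          ≈⟨ trans (sym (∑³-by-x q)) (proj₂ q-dist) ⟩
        1# ∎
        where
        sum≤ : ∀ x m → ∑[ y < nY ] w₂ x y m ≤ Q.ℙ[xm] x m
        sum≤ x m = ≤-respˡ-≈ (sym (trans (∑-*ˡ (∑ᶠ {nY}) (Q.ℙ[xm] x m) _)
            (*-congˡ (∑-*ʳ (∑ᶠ {nY}) (P.ℙ[x] x ⁻¹) _))))
          (≤-respʳ-≈ (*-identityʳ _) (*-monoˡ-≤ (0≤ℙ[xm] x m) (*-⁻¹-≤1 (P.ℙ[x] x))))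

    ∑bad≤ : ∑³ bad ≤ T⁻¹ * num 3
    ∑bad≤ = ≤-trans (∑³-mono bad≤) (≤-respˡ-≈ (sym (∑³-*ˡ T⁻¹ weight)) (*-monoˡ-≤ 0≤T⁻¹ ∑weight≤3))

    q≤Kp+bad : ∀ x y m → q x y m ≤ K * p x y m + bad x y m
    q≤Kp+bad x y m = cases (bad-cases x y m)
      where
      cases : Good x y m ⊎ bad x y m ≈ q x y m → q x y m ≤ K * p x y m + bad x y m
      cases (inj₁ g)  = ≤-trans (Bounds.q≤Kp (good-bounds g))
          (lin (0≤bad x y m) (solve 2 (λ a b → a :+ b :- a := b) refl _ _))
      cases (inj₂ eq) = ≤-trans (≈⇒≤ (sym eq)) (lin (0≤exp _ ⊗ 0≤p x y m)
          (solve 2 (λ a b → a :+ b :- b := a) refl (K * p x y m) (bad x y m)))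

    -- As q ≤ K p outside bad, at most twice the mass of bad violates Fx, and likewise Fy.
    Fx : X → V → Set
    Fx x m = Q.ℙ[xm] x m ≤ num 2 * K * P.ℙ[xm] x m

    Fy : Y → V → Set
    Fy y m = Q.ℙ[ym] y m ≤ num 2 * K * P.ℙ[ym] y m

    private
      -- Where `F` fails, `b` makes up at most half of `a`, so at least half of `a` is due to `c`.
      overweight≤ : ∀ {a b c} → a ≤ b + c → 0# ≤ c → (F : Set) → (¬ F → num 2 * b ≤ a) → 𝟙 (¬ F) * a
          ≤ num 2 * c
      overweight≤ {a} {b} {c} a≤b+c 0≤c F ¬F⇒ = cases (𝟙-cases (¬ F))
        where
        cases : _ ⊎ _ → 𝟙 (¬ F) * a ≤ num 2 * c
        cases (inj₂ (_ , 𝟙≈0)) = ≤-respˡ-≈ (sym (trans (*-congʳ 𝟙≈0) (zeroˡ _))) (0≤num 2 ⊗ 0≤c)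
        cases (inj₁ (¬F , 𝟙≈1)) = ≤-respˡ-≈ (sym (trans (*-congʳ 𝟙≈1) (*-identityˡ _)))
          (lin (0≤num 2 ⊗ 0≤- a≤b+c ⊕ 0≤- (¬F⇒ ¬F))
            (solve 3 (λ a b c → ` 2 :* c :- a := ` 2 :* (b :+ c :- a) :+ (a :- ` 2 :* b)) refl a b c))

    overweight-x : ∀ x m → 𝟙 (¬ Fx x m) * Q.ℙ[xm] x m ≤ num 2 * (∑[ y < nY ] bad x y m)
    overweight-x x m = overweight≤
      (≤-respʳ-≈ (trans (∑-+ (∑ᶠ {nY}) _ _) (+-congʳ (∑-*ˡ (∑ᶠ {nY}) K _)))
          (∑-mono (∑ᶠ {nY}) (λ y → q≤Kp+bad x y m)))
      (0≤∑ (∑ᶠ {nY}) (λ y → 0≤bad x y m)) (Fx x m) (λ ¬F → ≤-respˡ-≈ (*-assoc _ _ _) (proj₁ (≰⇒> ¬F)))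

    overweight-y : ∀ y m → 𝟙 (¬ Fy y m) * Q.ℙ[ym] y m ≤ num 2 * (∑[ x < nX ] bad x y m)
    overweight-y y m = overweight≤
      (≤-respʳ-≈ (trans (∑-+ (∑ᶠ {nX}) _ _) (+-congʳ (∑-*ˡ (∑ᶠ {nX}) K _)))
          (∑-mono (∑ᶠ {nX}) (λ x → q≤Kp+bad x y m)))
      (0≤∑ (∑ᶠ {nX}) (λ x → 0≤bad x y m)) (Fy y m) (λ ¬F → ≤-respˡ-≈ (*-assoc _ _ _) (proj₁ (≰⇒> ¬F)))

    loss loss-x loss-y : X → Y → V → Carrier
    loss-x x y m = 𝟙 (¬ Fx x m) * q x y m
    loss-y x y m = 𝟙 (¬ Fy y m) * q x y m
    loss x y m   = bad x y m + loss-x x y m + loss-y x y m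

    0≤loss-x : ∀ x y m → 0# ≤ loss-x x y m
    0≤loss-x x y m = 0≤𝟙 _ ⊗ 0≤q x y m

    0≤loss-y : ∀ x y m → 0# ≤ loss-y x y m
    0≤loss-y x y m = 0≤𝟙 _ ⊗ 0≤q x y m

    loss-cases : ∀ x y m → (Good x y m × Fx x m × Fy y m) ⊎ q x y m ≤ loss x y m
    loss-cases x y m = cases (bad-cases x y m) (𝟙-cases (¬ Fx x m)) (𝟙-cases (¬ Fy y m))
      where
      u v w : Carrier
      u = bad x y m
      v = loss-x x y m
      w = loss-y x y m
      cases : Good x y m ⊎ u ≈ q x y m → _ ⊎ _ → _ ⊎ _ → (Good x y m × Fx x m × Fy y m) ⊎ q x y m
          ≤ loss x y m
      cases (inj₂ eq) _ _ = inj₂ (≤-respˡ-≈ eq (lin (0≤loss-x x y m ⊕ 0≤loss-y x y m)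
          (solve 3 (λ u v w → u :+ v :+ w :- u := v :+ w) refl u v w)))
      cases _ (inj₁ (_ , eq)) _ = inj₂ (≤-respˡ-≈ (trans (*-congʳ eq) (*-identityˡ _))
        (lin (0≤bad x y m ⊕ 0≤loss-y x y m) (solve 3 (λ u v w → u :+ v :+ w :- v := u :+ w) refl u v w)))
      cases _ _ (inj₁ (_ , eq)) = inj₂ (≤-respˡ-≈ (trans (*-congʳ eq) (*-identityˡ _))
        (lin (0≤bad x y m ⊕ 0≤loss-x x y m) (solve 3 (λ u v w → u :+ v :+ w :- w := u :+ v) refl u v w)))
      cases (inj₁ g) (inj₂ (¬¬a , _)) (inj₂ (¬¬b , _)) = inj₁
          (g , decidable-stable em ¬¬a , decidable-stable em ¬¬b)

    -- The 5 consists of 1 for `bad` itself and 2 for each of the two overweight marginals.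
    ∑loss≤ : ∑³ loss ≤ num 5 * ∑³ bad
    ∑loss≤ = begin
      ∑³ loss
        ≈⟨ trans (∑³-+ (λ x y m → bad x y m + loss-x x y m) loss-y) (+-congʳ (∑³-+ bad loss-x)) ⟩
      ∑³ bad + ∑³ loss-x + ∑³ loss-y
        ≤⟨ +-mono-≤ (+-mono-≤ ≤-refl ∑loss-x≤) ∑loss-y≤ ⟩
      ∑³ bad + num 2 * ∑³ bad + num 2 * ∑³ bad
        ≈⟨ solve 1 (λ b → b :+ ` 2 :* b :+ ` 2 :* b := ` 5 :* b) refl (∑³ bad) ⟩
      num 5 * ∑³ bad ∎
      where
      open ≤-Reasoning
      ∑loss-x≤ : ∑³ loss-x ≤ num 2 * ∑³ bad
      ∑loss-x≤ = begin
        ∑³ loss-x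
          ≈⟨ ∑³-by-x loss-x ⟩
        ∑[ x < nX ] ∑ₘ (λ m → ∑[ y < nY ] loss-x x y m)
          ≤⟨ ∑-mono (∑ᶠ {nX}) (λ x → ∑-mono ∑ᵐ (λ m → ≤-respˡ-≈ (sym (∑-*ˡ (∑ᶠ {nY}) (𝟙 (¬ Fx x m)) _))
               (≤-respʳ-≈ (sym (∑-*ˡ (∑ᶠ {nY}) (num 2) _)) (overweight-x x m)))) ⟩
        ∑[ x < nX ] ∑ₘ (λ m → ∑[ y < nY ] (num 2 * bad x y m))
          ≈⟨ trans (sym (∑³-by-x (λ x y m → num 2 * bad x y m))) (∑³-*ˡ (num 2) bad) ⟩
        num 2 * ∑³ bad ∎
      ∑loss-y≤ : ∑³ loss-y ≤ num 2 * ∑³ bad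
      ∑loss-y≤ = begin
        ∑³ loss-y
          ≈⟨ ∑³-by-y loss-y ⟩
        ∑[ y < nY ] ∑ₘ (λ m → ∑[ x < nX ] loss-y x y m)
          ≤⟨ ∑-mono (∑ᶠ {nY}) (λ y → ∑-mono ∑ᵐ (λ m → ≤-respˡ-≈ (sym (∑-*ˡ (∑ᶠ {nX}) (𝟙 (¬ Fy y m)) _))
               (≤-respʳ-≈ (sym (∑-*ˡ (∑ᶠ {nX}) (num 2) _)) (overweight-y y m)))) ⟩
        ∑[ y < nY ] ∑ₘ (λ m → ∑[ x < nX ] (num 2 * bad x y m))
          ≈⟨ trans (sym (∑³-by-y (λ x y m → num 2 * bad x y m))) (∑³-*ˡ (num 2) bad) ⟩
        num 2 * ∑³ bad ∎

    -- The correlation belongs to the message, so one good pair `x y` already secures the bound for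
    -- all the mass of `m`. A message without a good pair carries bad mass only.
    ∑∣signed∣≥ : num 20 * T⁻¹ * (1# - ∑³ bad) ≤ ∑ₘ (λ m → ∣ signed m ∣)
    ∑∣signed∣≥ = begin
      num 20 * T⁻¹ * (1# - ∑³ bad)
        ≈⟨ *-congˡ (trans (+-congʳ (sym (proj₂ q-dist))) (sym (∑³-- q bad))) ⟩
      num 20 * T⁻¹ * ∑³ (λ x y m → q x y m - bad x y m)
        ≈⟨ trans (*-congˡ (∑³-by-m (λ x y m → q x y m - bad x y m)))
            (sym (∑-*ˡ ∑ᵐ (num 20 * T⁻¹) (λ m → ∑[ x < nX ] ∑[ y < nY ] (q x y m - bad x y m)))) ⟩
      ∑ₘ (λ m → num 20 * T⁻¹ * (∑[ x < nX ] ∑[ y < nY ] (q x y m - bad x y m)))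
        ≤⟨ ∑-mono ∑ᵐ (λ m → each m (toSum em)) ⟩
      ∑ₘ (λ m → ∣ signed m ∣) ∎
      where
      open ≤-Reasoning
      Hit : V → Set
      Hit m = ∃[ x ] ∃[ y ] Good x y m
      each : ∀ m → Hit m ⊎ ¬ Hit m → num 20 * T⁻¹ * (∑[ x < nX ] ∑[ y < nY ] (q x y m - bad x y m))
          ≤ ∣ signed m ∣
      each m (inj₁ (x , y , g)) = ≤-trans
        (*-monoˡ-≤ (0≤num 20 ⊗ 0≤T⁻¹) (∑-mono (∑ᶠ {nX}) (λ x → ∑-mono (∑ᶠ {nY}) (λ y →
          lin (0≤bad x y m) (solve 2 (λ q b → q :- (q :- b) := b) refl (q x y m) (bad x y m))))))
        (Bounds.ℙ[m]≤ (good-bounds g))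
      each m (inj₂ ¬h) = ≤-trans (≈⇒≤ (trans (*-congˡ
          (∑-zero (∑ᶠ {nX}) (λ x → ∑-zero (∑ᶠ {nY}) (λ y → q-bad≈0 x y (bad-cases x y m)))))
        (zeroʳ _))) (0≤∣∣ _)
        where
        q-bad≈0 : ∀ x y → Good x y m ⊎ bad x y m ≈ q x y m → q x y m - bad x y m ≈ 0#
        q-bad≈0 x y (inj₁ g)  = ⊥-elim (¬h (x , y , g))
        q-bad≈0 x y (inj₂ eq) = trans (+-congˡ (-‿cong eq)) (-‿inverseʳ _)


-- The constants, and the signs obtained from a nearly optimal `q`.

module Assembly (em : ExcludedMiddle 0ℓ) (ℝ : RealNumbers) where

  open OrderedField em ℝ
  open Summations em ℝ
  open Exponential em ℝ
  open RankOneSums em ℝ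
  open MinKernel em ℝ
  open Rounding em ℝ
  open ProductKernel em ℝ
  open SignProtocol em ℝ
  open CostBounds em ℝ
  open Truncation em ℝ
  open MarginalInformation em ℝ

  sign-*-≤ : ∀ c {d l} → 0# ≤ d → d ≤ l → sign c * d ≤ l
  sign-*-≤ false 0≤d d≤l = ≤-respˡ-≈ (sym (*-identityˡ _)) d≤l
  sign-*-≤ true {d} {l} 0≤d d≤l = lin (0≤d ⊕ (0≤d ⊕ 0≤- d≤l))
      (solve 2 (λ d l → l :- (:- ` 1) :* d := d :+ (d :+ (l :- d))) refl d l)

  ∣∣-sign : ∀ r → ∃[ σ ] (sign σ * r ≈ ∣ r ∣)
  ∣∣-sign r with total 0# r
  ... | inj₁ _ = false , *-identityˡ r
  ... | inj₂ _ = true , solve 1 (λ r → (:- ` 1) :* r := :- r) refl r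

  num≤exp : ∀ n → num n ≤ exp (num n)
  num≤exp n = ≤-trans (lin 0≤1 (solve 1 (λ n → ` 1 :+ n :- n := ` 1) refl (num n))) (1+x≤exp (num n))

  module Constant-facts {α} (0≤α : 0# ≤ α) where

    open Constants α

    0≤ℓ : 0# ≤ ℓ
    0≤ℓ = (0≤α ⊕ 0≤1) ⊗ proj₁ 0<ln2

    0≤t : 0# ≤ t
    0≤t = 0≤ℓ ⊕ 0≤num 80

    0≤θ : 0# ≤ θ
    0≤θ = 0≤num 3 ⊗ 0≤ℓ ⊕ 0≤num 5 ⊗ 0≤t ⊕ 0≤num 4

    25≤Δ : num 25 ≤ Δ
    25≤Δ = lin (0≤num 2 ⊗ 0≤θ ⊕ 0≤num 3 ⊗ 0≤t)
      (solve 2 (λ θ t → ` 2 :* θ :+ ` 3 :* t :+ ` 25 :- ` 25 := ` 2 :* θ :+ ` 3 :* t) refl θ t)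

    15T⁻¹≤1 : num 15 * T⁻¹ ≤ 1#
    15T⁻¹≤1 = ≤-respʳ-≈ (exp-inverse t) (*-monoʳ-≤ (0≤exp _) (≤-trans
      (lin (0≤ℓ ⊕ 0≤num 66) (solve 1 (λ l → ` 1 :+ (l :+ ` 80) :- ` 15 := l :+ ` 66) refl ℓ)) (1+x≤exp t)))

    module _ {I} (1≤I : 1# ≤ I) where

      0≤I : 0# ≤ I
      0≤I = ≤-trans 0≤1 1≤I

      -- `τ` bounds the squared lengths, `Λ` is the clipping level and `κ = 1 / Λ²`. The additional
      -- `t + 12` in the exponent of `Λ` brings the loss `6 κ τ²` below half of `T⁻¹`.
      τ Λ κ : Carrier
      τ = exp (I * θ)
      Λ = exp (I * θ + t + num 12)
      κ = exp (- (I * θ + t + num 12 + (I * θ + t + num 12)))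

      1≤τ : 1# ≤ τ
      1≤τ = ≤-respˡ-≈ exp-0 (exp-mono (0≤I ⊗ 0≤θ))

      -- This determines `θ`: since `4 ≤ exp 4` and `I ≥ 1`, the exponent
      -- `4 + 2 (ℓ + 2 t) + I (ℓ + t)` is at most `I (3 ℓ + 5 t + 4)`. The factor `4 K²` comes from
      -- the constants `2 K` in `Fx` and `Fy`.
      4KKZ≤τ : num 4 * (K * K) * exp (I * (ℓ + t)) ≤ τ
      4KKZ≤τ = begin
        num 4 * (K * K) * exp (I * (ℓ + t))
            ≤⟨ *-monoʳ-≤ (0≤exp _) (*-monoʳ-≤ (0≤sq K) (num≤exp 4)) ⟩
        exp (num 4) * (K * K) * exp (I * (ℓ + t))        ≈⟨ *-congʳ (*-congˡ (exp-+ _ _)) ⟨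
        exp (num 4) * exp (k + k) * exp (I * (ℓ + t))    ≈⟨ trans (exp-+ _ _) (*-congʳ (exp-+ _ _)) ⟨
        exp (num 4 + (k + k) + I * (ℓ + t))
            ≤⟨ exp-mono (lin (0≤- 1≤I ⊗ (0≤num 4 ⊕ (0≤ℓ ⊕ (0≤t ⊕ 0≤t) ⊕ (0≤ℓ ⊕ (0≤t ⊕ 0≤t)))))
                                                              (solve 3 (λ I l t → I :* (` 3 :* l :+ ` 5 :*
                                                                  t :+ ` 4) :- (` 4 :+ (l :+ (t :+ t) :+
                                                                      (l :+ (t :+ t))) :+ I :* (l :+ t))
                                                                := (I :- ` 1) :* (` 4 :+ (l :+ (t :+ t) :+
                                                                    (l :+ (t :+ t))))) refl I ℓ t)) ⟩
        τ                                                ∎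
        where
        open ≤-Reasoning
        k = ℓ + (t + t)

      κΛ²≈1 : κ * (Λ * Λ) ≈ 1#
      κΛ²≈1 = trans (*-congˡ (sym (exp-+ _ _))) (trans (*-comm _ _) (exp-inverse _))

      2error≤ : num 2 * (κ * (num 6 * (τ * τ))) ≤ T⁻¹
      2error≤ = begin
        num 2 * (κ * (num 6 * (τ * τ)))     ≈⟨ solve 2
            (λ k t → ` 2 :* (k :* (` 6 :* t)) := ` 12 :* (k :* t)) refl κ (τ * τ) ⟩
        num 12 * (κ * (τ * τ))              ≈⟨ *-congˡ (trans (exp-+ _ _) (*-congˡ (exp-+ _ _))) ⟨
        num 12 * exp (- (s + s) + (I * θ + I * θ))   ≤⟨ *-monoʳ-≤ (0≤exp _) (num≤exp 12) ⟩
        exp (num 12) * exp (- (s + s) + (I * θ + I * θ)) ≈⟨ exp-+ _ _ ⟨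
        exp (num 12 + (- (s + s) + (I * θ + I * θ)))     ≤⟨ exp-mono (lin (0≤t ⊕ 0≤num 12)
                                              (solve 2 (λ p t → let s = p :+ t :+ ` 12 in
                                                :- t :- (` 12 :+ (:- (s :+ s) :+ (p :+ p))) := t :+ ` 12)
                                                    refl (I * θ) t)) ⟩
        T⁻¹                                 ∎
        where
        open ≤-Reasoning
        s = I * θ + t + num 12

      -- At least half of `T⁻¹` survives, hence `T⁻¹ / e`. With `κ` this gives the exponent
      -- `2 (I θ + t + 12) + t + 1`, which is at most `Δ I` as `I ≥ 1`; the 25 in `Δ` is 24 + 1.
      final≤ : exp (- (Δ * I)) ≤ κ * (T⁻¹ - κ * (num 6 * (τ * τ)))
      final≤ = begin
        exp (- (Δ * I))              ≤⟨ exp-mono (lin (0≤- 1≤I ⊗ (0≤num 3 ⊗ 0≤t ⊕ 0≤num 25))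
                                          (solve 3 (λ I θ t → let s = I :* θ :+ t :+ ` 12 in
                                            :- (s :+ s) :+ (:- t :+ :- ` 1) :- :-
                                                ((` 2 :* θ :+ ` 3 :* t :+ ` 25) :* I)
                                            := (I :- ` 1) :* (` 3 :* t :+ ` 25)) refl I θ t)) ⟩
        exp (- (s + s) + (- t + - 1#))  ≈⟨ trans (exp-+ _ _) (*-congˡ (exp-+ _ _)) ⟩
        κ * (T⁻¹ * exp (- 1#))       ≤⟨ *-monoˡ-≤ (0≤exp _) (*-cancelˡ-≤ 0<2 (lin
                                          (0≤exp (- t) ⊗ 0≤- 2/e≤1 ⊕ 0≤- 2error≤)
                                          (solve 3 (λ v e E → ` 2 :* (v :- E) :- ` 2 :* (v :* e) := v :*
                                              (` 1 :- ` 2 :* e) :+ (v :- ` 2 :* E))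
                                            refl T⁻¹ (exp (- 1#)) (κ * (num 6 * (τ * τ)))))) ⟩
        κ * (T⁻¹ - κ * (num 6 * (τ * τ))) ∎
        where
        open ≤-Reasoning
        s = I * θ + t + num 12
        2/e≤1 : num 2 * exp (- 1#) ≤ 1#
        2/e≤1 = ≤-respʳ-≈ (exp-inverse 1#) (*-monoʳ-≤ (0≤exp _) (1+x≤exp 1#))

  module Construction {nX nY : ℕ} (f : Fin nX → Fin nY → Bool) {ss : List ℕ}
    {p q : Fin nX → Fin nY → Messages ss → Carrier}
    (p-dist : Joint.IsJointDistribution p) (q-dist : Joint.IsJointDistribution q)
    (q-rect : Joint.Rectangular q (Joint.ℙ[xy] p))
    {I α : Carrier} (1≤I : 1# ≤ I) (0≤α : 0# ≤ α)
    (cost≤ : ∀ x y m → 0# < q x y m → cost f I p q x y m ≤± [ (α + 1#) * I ]) where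

    private
      module P = Joint p
      module Q = Joint q

      X = Fin nX
      Y = Fin nY
      V = Messages ss

      0≤p = proj₁ p-dist
      0≤q = proj₁ q-dist

    open Constants α
    open Constant-facts 0≤α hiding (0≤ℓ; τ; Λ; κ)
    open Typical f p q 0≤p 0≤q 1≤I 0≤α
    open Estimates f p-dist q-dist 1≤I 0≤α cost≤

    μ : X → Y → Carrier
    μ = P.ℙ[xy]

    τ Λ κ : Carrier
    τ = Constant-facts.τ 0≤α 1≤I
    Λ = Constant-facts.Λ 0≤α 1≤I
    κ = Constant-facts.κ 0≤α 1≤I

    0≤κ : 0# ≤ κ
    0≤κ = 0≤exp _

    open Correlation μ 0≤ℙ[xy] f
    open Potential κ 0≤κ

    -- Rectangularity leaves the signs of its two factors open. Since `q` and `μ` are nonnegative,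
    -- the absolute values of the factors represent `q` just as well.
    A : X → V → Carrier
    A x m = ∣ proj₁ q-rect x m ∣

    B : Y → V → Carrier
    B y m = ∣ proj₁ (proj₂ q-rect) y m ∣

    q≈μAB : ∀ x y m → q x y m ≈ μ x y * (A x m * B y m)
    q≈μAB x y m = trans (sym (∣∣-nonneg (0≤q x y m))) (trans (∣∣-cong (proj₂ (proj₂ q-rect) x y m))
      (trans (∣*∣ _ _) (trans (*-congʳ (trans (∣*∣ _ _) (*-congʳ (∣∣-nonneg (0≤ℙ[xy] x y)))))
          (*-assoc _ _ _))))

    -- Up to `τ` this is `p(m|x)`, as `h` is `p(m|y)`. Truncation compares `(A B)²` with the product
    -- `g h`, so the whole of `τ` may sit on one side.
    g : V → X → Carrier
    g m x = τ * (P.ℙ[xm] x m / P.ℙ[x] x)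

    h : V → Y → Carrier
    h m y = P.ℙ[ym] y m / P.ℙ[y] y

    0≤ℙp[xm] : ∀ x m → 0# ≤ P.ℙ[xm] x m
    0≤ℙp[xm] x m = 0≤∑ (∑ᶠ {nY}) (λ y → 0≤p x y m)

    0≤ℙp[ym] : ∀ y m → 0# ≤ P.ℙ[ym] y m
    0≤ℙp[ym] y m = 0≤∑ (∑ᶠ {nX}) (λ x → 0≤p x y m)

    0≤g : ∀ m x → 0# ≤ g m x
    0≤g m x = 0≤exp _ ⊗ (0≤ℙp[xm] x m ⊗ 0≤⁻¹ (0≤ℙ[x] x))

    0≤h : ∀ m y → 0# ≤ h m y
    0≤h m y = 0≤ℙp[ym] y m ⊗ 0≤⁻¹ (0≤ℙ[y] y)

    ∑g≤τ : ∀ x → ∑ₘ (λ m → g m x) ≤ τ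
    ∑g≤τ x = ≤-respˡ-≈ (sym (trans (∑-*ˡ ∑ᵐ τ (λ m → P.ℙ[xm] x m / P.ℙ[x] x))
        (*-congˡ (trans (∑-*ʳ ∑ᵐ (P.ℙ[x] x ⁻¹) (P.ℙ[xm] x))
        (*-congʳ (∑-swap ∑ᵐ nY (λ m y → p x y m)))))))
      (≤-respʳ-≈ (*-identityʳ τ) (*-monoˡ-≤ (0≤exp _) (*-⁻¹-≤1 (P.ℙ[x] x))))

    ∑h≤1 : ∀ y → ∑ₘ (λ m → h m y) ≤ 1#
    ∑h≤1 y = ≤-respˡ-≈ (sym (trans (∑-*ʳ ∑ᵐ (P.ℙ[y] y ⁻¹) (P.ℙ[ym] y))
        (*-congʳ (∑-swap ∑ᵐ nX (λ m x → p x y m)))))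
      (*-⁻¹-≤1 (P.ℙ[y] y))

    private
      -- Here `c` stands for `p(xy)` and `c * AB` for `q(xym)`, so that `c²` cancels. Exchanging the
      -- marginals `qx`, `qy` of `q` for the marginals `px′`, `py′` of `p` costs `(2 K)²`, which is
      -- absorbed in `τ`.
      cancel-densities : ∀ {c AB qx qy px py px′ py′} → 0# < c → 0# < px → 0# < py → 0# ≤ qx → 0# ≤ qy →
        qx ≤ num 2 * K * px′ → qy ≤ num 2 * K * py′ → 0# ≤ px′ → 0# ≤ py′ →
        c * AB * (c * AB) * (px * py) ≤ Z * (qx * qy * (c * c)) →
        AB * AB ≤ τ * (px′ / px) * (py′ / py)
      cancel-densities {c} {AB} {qx} {qy} {px} {py} {px′} {py′} 0<c 0<px 0<py 0≤qx 0≤qy qx≤ qy≤ 0≤px′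
          0≤py′ le =
        ≤-respʳ-≈ (solve 5 (λ t a i b j → t :* (a :* b) :* (i :* j) := t :* (a :* i) :* (b :* j)) refl τ
            px′ (px ⁻¹) py′ (py ⁻¹))
          (*-cancelˡ-≤ 0<pxpy (≤-respʳ-≈ (sym cancelled) (*-cancelˡ-≤ (0<* 0<c 0<c) (begin
            c * c * (px * py * (AB * AB))
                ≈⟨ solve 4 (λ c a b d → c :* c :* (a :* b :* (d :* d)) := c :* d :* (c :* d) :* (a :* b))
                    refl c px py AB ⟩
            c * AB * (c * AB) * (px * py)              ≤⟨ le ⟩
            Z * (qx * qy * (c * c))
                ≤⟨ *-monoˡ-≤ (0≤exp _) (*-monoʳ-≤ (0≤sq c) (*-mono-≤ 0≤qx qx≤ 0≤qy qy≤)) ⟩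
            Z * (num 2 * K * px′ * (num 2 * K * py′) * (c * c))
              ≈⟨ solve 5 (λ z k a b c → z :* (` 2 :* k :* a :* (` 2 :* k :* b) :* (c :* c)) := c :* c :*
                  (` 4 :* (k :* k) :* z :* (a :* b))) refl Z K px′ py′ c ⟩
            c * c * (num 4 * (K * K) * Z * (px′ * py′))
                ≤⟨ *-monoˡ-≤ (0≤sq c) (*-monoʳ-≤ (0≤px′ ⊗ 0≤py′) (4KKZ≤τ 1≤I)) ⟩
            c * c * (τ * (px′ * py′))                  ∎))))
        where
        open ≤-Reasoning
        0<pxpy = 0<* 0<px 0<py
        cancelled : px * py * (τ * (px′ * py′) * (px ⁻¹ * py ⁻¹)) ≈ τ * (px′ * py′)
        cancelled = trans (solve 5 (λ a b t i j → a :* b :* (t :* (i :* j)) := t :* (a :* i) :* (b :* j))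
            refl px py _ (px ⁻¹) (py ⁻¹))
          (trans (*-cong (*-congˡ (⁻¹-inverseʳ (0<⇒≉ 0<px))) (⁻¹-inverseʳ (0<⇒≉ 0<py)))
              (trans (*-identityʳ _) (*-identityʳ _)))

    AB²≤gh : ∀ {x y m} → Good x y m → Fx x m → Fy y m → A x m * B y m * (A x m * B y m) ≤ g m x * h m y
    AB²≤gh {x} {y} {m} good Fx Fy = cancel-densities 0<μ (<-≤-trans 0<μ (ℙ[xy]≤ℙ[x] x y))
        (<-≤-trans 0<μ (ℙ[xy]≤ℙ[y] x y))
      (0≤ℙ[xm] x m) (0≤ℙ[ym] y m) Fx Fy (0≤ℙp[xm] x m) (0≤ℙp[ym] y m)
      (≤-respˡ-≈ (*-congʳ (*-cong (q≈μAB x y m) (q≈μAB x y m))) (Bounds.q²≤ (good-bounds good)))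
      where
      0<μ : 0# < μ x y
      0<μ = 0≤∧≉⇒0< (0≤ℙ[xy] x y) (λ μ≈0 → 0<⇒≉ (proj₁ good)
          (trans (q≈μAB x y m) (trans (*-congʳ μ≈0) (zeroˡ _))))

    module Message (m : V) =
      TruncatedProduct μ 0≤ℙ[xy] f κ 0≤κ (λ x → 0≤∣∣ (proj₁ q-rect x m))
          (λ y → 0≤∣∣ (proj₁ (proj₂ q-rect) y m)) (0≤g m) (0≤h m)

    open Message using (truncated)

    -- Truncation can only lower `A B`, and wherever it does so all of `q x y m` is counted in
    -- `loss`.
    difference-bounds : ∀ x y m → 
      0# ≤ q x y m - μ x y * truncated m x y × q x y m - μ x y * truncated m x y ≤ loss x y m
    difference-bounds x y m = ≤-respʳ-≈ (sym difference) (0≤ℙ[xy] x y ⊗ 0≤- (Message.truncated≤ m x y)) ,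
        upper (loss-cases x y m)
      where
      difference : q x y m - μ x y * truncated m x y ≈ μ x y * (A x m * B y m - truncated m x y)
      difference = trans (+-congʳ (q≈μAB x y m)) (solve 3 (λ u c w → u :* c :- u :* w := u :* (c :- w))
          refl (μ x y) (A x m * B y m) (truncated m x y))
      upper : (Good x y m × Fx x m × Fy y m) ⊎ q x y m ≤ loss x y m →
              q x y m - μ x y * truncated m x y ≤ loss x y m
      upper (inj₁ (good , Fx , Fy)) = ≤-trans (≈⇒≤ (trans difference (trans (*-congˡ (trans
          (+-congˡ (-‿cong (Message.truncated≈ m (AB²≤gh good Fx Fy)))) (-‿inverseʳ _))) (zeroʳ _))))
        (0≤bad x y m ⊕ 0≤loss-x x y m ⊕ 0≤loss-y x y m)
      upper (inj₂ q≤) = ≤-trans (lin (0≤ℙ[xy] x y ⊗ Message.0≤truncated m x y)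
        (solve 2 (λ q w → q :- (q :- w) := w) refl (q x y m) (μ x y * truncated m x y))) q≤

    σ : V → Bool
    σ m = proj₁ (∣∣-sign (signed m))

    W : X → Y → Carrier
    W x y = ∑ₘ (λ m → sign (σ m) * truncated m x y)

    pointwise : ∀ x y m → sign (σ m) * (q x y m * sign (f x y)) - loss x y m
                          ≤ μ x y * (sign (f x y) * (sign (σ m) * truncated m x y))
    pointwise x y m = lin (0≤- (sign-*-≤ (σ m xor f x y) (proj₁ (difference-bounds x y m))
        (proj₂ (difference-bounds x y m))))
      (trans (solve 6 (λ u w q a b l → u :* (a :* (b :* w)) :- (b :* (q :* a) :- l) := l :- b :* a :*
          (q :- u :* w))
          refl (μ x y) (truncated m x y) (q x y m) (sign (f x y)) (sign (σ m)) (loss x y m))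
        (+-congˡ (-‿cong (*-congʳ (sym (sign-xor (σ m) (f x y)))))))

    T⁻¹≤correlate : T⁻¹ ≤ correlate W
    T⁻¹≤correlate = begin
      T⁻¹
        -- With bad mass 3/T the claim is `20/T (1 - 3/T) - 15/T ≥ 1/T`, which amounts to
        -- `15/T ≤ 1`.
        ≤⟨ lin ((0≤num 20 ⊗ 0≤T⁻¹ ⊕ 0≤num 5) ⊗ 0≤- ∑bad≤ ⊕ 0≤num 4 ⊗ 0≤T⁻¹ ⊗ 0≤- 15T⁻¹≤1)
             (solve 2 (λ v S → ` 20 :* v :* (` 1 :- S) :- ` 5 :* S :- v
               := (` 20 :* v :+ ` 5) :* (v :* ` 3 :- S) :+ ` 4 :* v :* (` 1 :- ` 15 :* v)) refl T⁻¹
                   (∑³ bad)) ⟩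
      num 20 * T⁻¹ * (1# - ∑³ bad) - num 5 * ∑³ bad
        ≤⟨ +-mono-≤ ∑∣signed∣≥ (neg-anti-≤ ∑loss≤) ⟩
      ∑ₘ (λ m → ∣ signed m ∣) - ∑³ loss
        ≈⟨ +-congʳ (∑-cong ∑ᵐ (λ m → trans (sym (proj₂ (∣∣-sign (signed m)))) (sym (scaled m)))) ⟩
      ∑ₘ (λ m → ∑[ x < nX ] ∑[ y < nY ] (sign (σ m) * (q x y m * sign (f x y)))) - ∑³ loss
        ≈⟨ trans (∑³-- signed-terms loss) (+-congʳ (∑³-by-m signed-terms)) ⟨
      ∑³ (λ x y m → sign (σ m) * (q x y m * sign (f x y)) - loss x y m)
        ≤⟨ ∑³-mono pointwise ⟩
      ∑³ (λ x y m → μ x y * (sign (f x y) * (sign (σ m) * truncated m x y)))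
        ≈⟨ ∑²-cong (λ x y → trans (∑-*ˡ ∑ᵐ (μ x y) (λ m → sign (f x y) * (sign (σ m) * truncated m x y)))
             (*-congˡ (∑-*ˡ ∑ᵐ (sign (f x y)) (λ m → sign (σ m) * truncated m x y)))) ⟩
      correlate W ∎
      where
      open ≤-Reasoning
      signed-terms : X → Y → V → Carrier
      signed-terms x y m = sign (σ m) * (q x y m * sign (f x y))
      scaled : ∀ m → ∑[ x < nX ] ∑[ y < nY ] (sign (σ m) * (q x y m * sign (f x y))) ≈ sign (σ m) * signed m
      scaled m = trans (∑-cong (∑ᶠ {nX}) (λ x → ∑-*ˡ (∑ᶠ {nY}) (sign (σ m)) (λ y → q x y m * sign (f x y))))
        (∑-*ˡ (∑ᶠ {nX}) (sign (σ m)) (λ x → ∑[ y < nY ] (q x y m * sign (f x y))))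

    decomposition-W : Decomposition W (λ x → ∑ₘ (λ m → g m x)) (λ y → ∑ₘ (λ m → h m y))
    decomposition-W = decomposition-∑ₘ μ 0≤ℙ[xy] f κ 0≤κ {ss}
      {λ m x y → sign (σ m) * truncated m x y} {g} {h} (λ m → Message.decomposition-truncated m (σ m))

    signs : Σ (X → Bool) λ a → Σ (Y → Bool) λ b →
            exp (- (Δ * I)) ≤ correlate (λ x y → sign (a x) * sign (b y))
    signs = conclude (round-decomposition μ 0≤ℙ[xy] f κ 0≤κ decomposition-W ∑g≤τ
        (λ y → ≤-trans (∑h≤1 y) (1≤τ 1≤I)) (≈⇒≤ (proj₂ p-dist)) (0<exp _) (κΛ²≈1 1≤I))
      where
      open ≤-Reasoning
      conclude : RoundedTo μ 0≤ℙ[xy] f Λ (correlate W - κ * (num 6 * (τ * τ))) → _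
      conclude (a , b , le) = a , b , (begin
        exp (- (Δ * I))                                 ≤⟨ final≤ 1≤I ⟩
        κ * (T⁻¹ - κ * (num 6 * (τ * τ)))
            ≤⟨ *-monoˡ-≤ 0≤κ (≤-trans (+-mono-≤ T⁻¹≤correlate ≤-refl) le) ⟩
        κ * (Λ * Λ * correlate (λ x y → sign (a x) * sign (b y)))
          ≈⟨ trans (sym (*-assoc _ _ _)) (trans (*-congʳ (κΛ²≈1 1≤I)) (*-identityˡ _)) ⟩
        correlate (λ x y → sign (a x) * sign (b y))     ∎)


-- Nearly optimal elements of an infimum.

module Infimum (em : ExcludedMiddle 0ℓ) (ℝ : RealNumbers) where

  open OrderedField em ℝ

  -- The infimum itself may not be a value of `F`, so some room above `b` is necessary; here lies
  -- the reason for `α + 1#` in the constants, `I > 0` making `(α + 1) I` larger than `α I`.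
  ⨅-attained : ∀ {A : Set} (F : A → ℝ±) {b c} → b < c → ⨅ F ≤± [ b ] → ∃[ a ] (F a ≤± [ c ])
  ⨅-attained {A} F {b} {c} b<c ⨅≤b = cases (toSum em)
    where
    negate : ∀ s → ¬ (s ≤± [ c ]) → -± s ≤± [ - c ]
    negate ⊥±    s≰c = ⊥-elim (s≰c ⊥±≤[ c ])
    negate [ r ] s≰c = [ neg-anti-≤ (proj₁ (≰⇒> (λ r≤c → s≰c [ r≤c ]≤))) ]≤
    negate ⊤±    s≰c = ⊥±≤[ - c ]

    impossible : ∀ s → s ≤± [ - c ] → ¬ (-± s ≤± [ b ])
    impossible ⊥±    _   ()
    impossible [ r ] s≤  -s≤ = <⇒≱ b<c (lin (0≤- ([≤]-injective s≤) ⊕ 0≤- ([≤]-injective -s≤))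
      (solve 3 (λ r b c → b :- c := :- c :- r :+ (b :- :- r)) refl r b c))
    impossible ⊤±    () _

    cases : (∃[ a ] (F a ≤± [ c ])) ⊎ ¬ (∃[ a ] (F a ≤± [ c ])) → ∃[ a ] (F a ≤± [ c ])
    cases (inj₁ attained) = attained
    cases (inj₂ none)     = ⊥-elim (impossible _
      (⨆-least (λ a → -± F a) [ - c ] (λ a → negate (F a) (λ le → none (a , le)))) ⨅≤b)

-- From marginal information to the advantage of the sign protocol.

module MainTheorem (em : ExcludedMiddle 0ℓ) (ℝ : RealNumbers) where

  open OrderedField em ℝ
  open RankOneSums em ℝ
  open SignProtocol em ℝ
  open CostBounds em ℝ
  open Infimum em ℝ
  open Assembly em ℝ
  open MarginalInformation em ℝ
  open Communication em ℝ

  module _ {α : Carrier} (0<α : 0# < α) where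

    private
      0≤α = proj₁ 0<α

    open Constants α using (Δ)
    open Constant-facts 0≤α using (25≤Δ)

    0<Δ : 0# < Δ
    0<Δ = <-≤-trans 0<1 (≤-trans (lin (0≤num 24) (solve 0 (` 25 :- ` 1 := ` 24) refl)) 25≤Δ)

    exp≤adv : ∀ {I} → 1# ≤ I → ∀ {nX nY} (f : Fin nX → Fin nY → Bool) {ss : List ℕ}
      (p : Fin nX → Fin nY → Messages ss → Carrier) → Joint.IsJointDistribution p →
      ∀ μ → M f I p ≤± [ α * I ] → (∀ x y → μ x y ≈ Joint.ℙ[xy] p x y) →
      [ exp (- (Δ * I)) ] ≤± adv μ (Δ * I) f
    exp≤adv {I} 1≤I f p p-dist μ M≤αI μ≈p = attained (⨅-attained _ αI<[α+1]I M≤αI)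
      where
      αI<[α+1]I : α * I < (α + 1#) * I
      αI<[α+1]I = ≰⇒> λ le → <⇒≱ 0<1 (≤-trans 1≤I (lin (0≤- le)
        (solve 2 (λ a I → ` 0 :- I := a :* I :- (a :+ ` 1) :* I) refl α I)))

      2≤ΔI : fromℕ 2 ≤ Δ * I
      2≤ΔI = ≤-respˡ-≈ (sym (fromℕ≈ 2)) (lin (0≤- 25≤Δ ⊕ 0≤num 23 ⊕ (proj₁ 0<Δ ⊗ 0≤- 1≤I))
        (solve 2 (λ d I → d :* I :- ` 2 := d :- ` 25 :+ ` 23 :+ d :* (I :- ` 1)) refl Δ I))

      0≤μ : ∀ x y → 0# ≤ μ x y
      0≤μ x y = ≤-respʳ-≈ (sym (μ≈p x y)) (Typical.0≤ℙ[xy] f p p (proj₁ p-dist) (proj₁ p-dist) 1≤I 0≤α x y)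

      attained : _ → _
      attained ((q , q-dist , q-rect) , sup≤) = conclude (Construction.signs f p-dist q-dist q-rect 1≤I 0≤α
          (λ x y m 0<q → ≤±-trans ≤-trans (⨆-upper (λ (x , y , m , _) → cost f I p q x y m)
              (x , y , m , 0<q)) sup≤))
        where
        conclude : _ → [ exp (- (Δ * I)) ] ≤± adv μ (Δ * I) f
        conclude (a , b , le) = ≤±-trans ≤-trans
          [ ≤-trans le (≈⇒≤ (Correlation.∑²-cong μ 0≤μ f (λ x y → *-congʳ (sym (μ≈p x y))))) ]≤
          (correlate-signs≤adv μ 0≤μ f a b 2≤ΔI)

theorem9 : (em : ExcludedMiddle 0ℓ) (ℝ : RealNumbers) →
    let open Analysis em ℝ
        open MarginalInformation em ℝ
        open Communication em ℝ
    in
    ∀ (α : Carrier) → 0# < α →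
    ∃[ Δ ] (0# < Δ ×
      (∀ (I : Carrier) → 1# ≤ I →
       ∀ (nX nY : ℕ) (f : Fin nX → Fin nY → Bool)
         (s₀ : ℕ) (ss : List ℕ) (p : Fin nX → Fin nY → Messages (s₀ ∷ ss) → Carrier) →
       IsProtocolDistribution p →
       ∀ (μ : Fin nX → Fin nY → Carrier) →
       M f I p ≤± [ α * I ] →
       (∀ x y → μ x y ≈ Joint.ℙ[xy] p x y) →
       [ exp (- (Δ * I)) ] ≤± adv μ (Δ * I) f))
theorem9 em ℝ α 0<α = _ , 0<Δ 0<α , λ I 1≤I nX nY f s₀ ss p p-protocol μ M≤αI μ≈p →
    exp≤adv 0<α 1≤I f p (proj₁ p-protocol) μ M≤αI μ≈p
  where open MainTheorem em ℝ
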